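{- Let $n\ge1$ and $\lambda,\mu,\nu\vdash n$. There is an explicit bijection $\Theta^n_{\lambda,\mu,\nu}$ between the set $\mathcal{C}(\lambda,\mu,\nu)$ of partitioned 3-cacti and the set of tuples $(\tilde\tau,\sigma_1,\sigma_2,\chi)$ such that, for some integers $g,w,b\ge0$, $\tilde\tau\in\widetilde{\mathcal{CT}}(\lambda,\mu,\nu,g,w,b)$, $\sigma_1\in S_{n+1-\ell(\lambda)-\ell(\nu)+b}$, $\sigma_2\in S_{n-\ell(\mu)-\ell(\nu)+w}$ and $\chi\in\mathcal{OP}^{(n+1-\ell(\lambda)-\ell(\mu)+g)}_{\ell(\nu)-w-b}$.
   Context: $\gamma_n=(1,\ldots,n)$. $\mathcal{C}(\lambda,\mu,\nu)$ is the set of tuples $(\pi_1,\pi_2,\pi_3,\alpha_1,\alpha_2)$ with $\alpha_1,\alpha_2\in S_n$ and $\pi_1,\pi_2,\pi_3$ set partitions of $[n]$ whose block sizes form $\lambda,\mu,\nu$ respectively, such that each block of $\pi_1$ (resp. $\pi_2$, $\pi_3$) is a union of cycles of $\alpha_1$ (resp. $\alpha_2$, $\alpha_3=\alpha_2^{ -1}\alpha_1^{ -1}\gamma_n$). $S_m$ is the symmetric group on $m$ letters; $\mathcal{OP}^{(m)}_r$ is the set of ordered $r$-subsets of $[m]$. $\ell(\lambda)$ is the number of parts of $\lambda$. Let $\mathcal{T}(p_1,p_2,p_3)$ be the set of rooted ordered (plane) trees with $p_1$ white, $p_2$ black and $p_3$ grey vertices, white root, children of white vertices black, of black vertices grey,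 of grey vertices white. For a vertex $u$ and a child $v$ of $u$ one may add a non-tree edge between $u$ and the rightmost child of $v$, forming a triangle rooted at $u$ with middle vertex $v$. A cactus tree has $g$ triangles rooted at grey vertices, $w$ at white vertices and $b$ at black vertices, each triangle having its white, black, grey vertices in clockwise cyclic order white-black-grey-white. A thorn cactus tree additionally has $n+1-p_1-p_2+g$ thorns (half-edges) on white vertices, $n-p_2-p_3+w$ on black vertices and $n+1-p_1-p_3+b$ on grey vertices, placed in the plane order of children, none inside a triangle. The degree of a vertex is (number of children) + (number of thorns) $-\varepsilon+1$, with $\varepsilon=1$ if the vertex is the middle vertex of a triangle and $0$ otherwise. $\widetilde{\mathcal{CT}}(\lambda,\mu,\nu,g,w,b)$ is the set of such thorn cactus trees with $(p_1,p_2,p_3)=(\ell(\lambda),\ell(\mu),\ell(\nu))$ whose white, black and grey degree distributions are $\lambda,\mu,\nu$.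
   Formalization: The degree of the root is taken as children plus thorns, without the +1 (with the literal formula white degrees sum to n+1 and no tree exists), and the rightmost child of a triangle's middle vertex may not itself be a middle vertex, as its non-tree edge would lie inside that triangle. -}

module Defs where

open import Data.Bool.Base using (Bool; true; false; T; _∧_; not; if_then_else_)
open import Data.Nat.Base using (ℕ; zero; suc; _+_; _∸_; _≤ᵇ_; _≡ᵇ_)
open import Data.Nat.Properties using (≤-decTotalOrder)
open import Data.Fin.Base using (Fin; zero; suc)
open import Data.Fin.Properties using (_≟_)
open import Data.List.Base as List using (List; []; _∷_; _++_; length; map; filter; findᵇ)
open import Data.Nat.ListAction using (sum)
open import Data.List.Sort ≤-decTotalOrder using (sort)
open import Data.Maybe.Base using (Maybe; just; nothing; fromMaybe)
open import Data.Vec.Base as Vec using (Vec; lookup; toList; _∷ʳ_)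
open import Data.Product.Base using (Σ; _×_; _,_)
open import Relation.Nullary.Decidable.Core using (⌊_⌋)
open import Relation.Binary.PropositionalEquality.Core using (_≡_)

allᵇ : {A : Set} → (A → Bool) → List A → Bool
allᵇ p []       = true
allᵇ p (x ∷ xs) = p x ∧ allᵇ p xs

countᵇ : {A : Set} → (A → Bool) → List A → ℕ
countᵇ p xs = length (filter (λ x → T? (p x)) xs)
  where
  open import Relation.Nullary.Decidable.Core using (T?)

_≡F_ : {n : ℕ} → Fin n → Fin n → Bool
i ≡F j = ⌊ i ≟ j ⌋

distinctᵇ : {n : ℕ} → List (Fin n) → Bool
distinctᵇ []       = true
distinctᵇ (x ∷ xs) = allᵇ (λ y → not (x ≡F y)) xs ∧ distinctᵇ xs

_≈ₘ_ : List ℕ → List ℕ → Set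
xs ≈ₘ ys = sort xs ≡ sort ys

weaklyDecreasingᵇ : List ℕ → Bool
weaklyDecreasingᵇ []           = true
weaklyDecreasingᵇ (x ∷ [])     = true
weaklyDecreasingᵇ (x ∷ y ∷ xs) = (y ≤ᵇ x) ∧ weaklyDecreasingᵇ (y ∷ xs)

isPartitionOfᵇ : ℕ → List ℕ → Bool
isPartitionOfᵇ n xs = allᵇ (λ k → 1 ≤ᵇ k) xs ∧ weaklyDecreasingᵇ xs ∧ (sum xs ≡ᵇ n)

Partition : ℕ → Set
Partition n = Σ (List ℕ) (λ xs → T (isPartitionOfᵇ n xs))

parts : {n : ℕ} → Partition n → List ℕ
parts (xs , _) = xs

ℓ : {n : ℕ} → Partition n → ℕ
ℓ p = length (parts p)

isPermᵇ : {n : ℕ} → Vec (Fin n) n → Bool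
isPermᵇ v = distinctᵇ (toList v)

S : ℕ → Set
S n = Σ (Vec (Fin n) n) (λ v → T (isPermᵇ v))

app : {n : ℕ} → S n → Fin n → Fin n
app (v , _) i = lookup v i

_∘ₚ_ : {n : ℕ} → Vec (Fin n) n → Vec (Fin n) n → Vec (Fin n) n
σ ∘ₚ τ = Vec.map (lookup σ) τ

inverse : {n : ℕ} → Vec (Fin n) n → Vec (Fin n) n
inverse {n} v = Vec.tabulate (λ j → fromMaybe j (findᵇ (λ i → lookup v i ≡F j) (List.allFin n)))

γ : (n : ℕ) → Vec (Fin n) n
γ zero    = Vec.[]
γ (suc m) = Vec.map suc (Vec.allFin m) ∷ʳ zero

OP : ℕ → ℕ → Set
OP m r = Σ (Vec (Fin m) r) (λ v → T (distinctᵇ (toList v)))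

-- Set partitions of [n].  A set partition is encoded canonically by the
-- map f sending each element to the minimum of its block; such maps are
-- exactly those with f i ≤ i and f (f i) = f i.  The block of i is
-- { j | f j = f i }.

isMinLabellingᵇ : {n : ℕ} → Vec (Fin n) n → Bool
isMinLabellingᵇ {n} f =
  allᵇ (λ i → (Data.Fin.Base.toℕ (lookup f i) ≤ᵇ Data.Fin.Base.toℕ i)
              ∧ (lookup f (lookup f i) ≡F lookup f i))
       (List.allFin n)
  where import Data.Fin.Base

SetPartition : ℕ → Set
SetPartition n = Σ (Vec (Fin n) n) (λ f → T (isMinLabellingᵇ f))

blockSizes : {n : ℕ} → SetPartition n → List ℕ
blockSizes {n} (f , _) =
  map (λ r → countᵇ (λ j → lookup f j ≡F r) (List.allFin n))
      (filter (λ r → Relation.Nullary.Decidable.Core.T? (lookup f r ≡F r)) (List.allFin n))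
  where import Relation.Nullary.Decidable.Core

HasType : {n : ℕ} → SetPartition n → Partition n → Set
HasType π p = blockSizes π ≈ₘ parts p

unionOfCyclesᵇ : {n : ℕ} → SetPartition n → Vec (Fin n) n → Bool
unionOfCyclesᵇ {n} (f , _) α =
  allᵇ (λ i → lookup f (lookup α i) ≡F lookup f i) (List.allFin n)

record IsP3Cactus (n : ℕ) (la mu nu : Partition n)
                  (π₁ π₂ π₃ : SetPartition n) (α₁ α₂ : S n) : Set where
  field
    type₁ : HasType π₁ la
    type₂ : HasType π₂ mu
    type₃ : HasType π₃ nu
    inv₁  : T (unionOfCyclesᵇ π₁ (Σ.proj₁ α₁))
    inv₂  : T (unionOfCyclesᵇ π₂ (Σ.proj₁ α₂))
    inv₃  : T (unionOfCyclesᵇ π₃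
                 (inverse (Σ.proj₁ α₂) ∘ₚ (inverse (Σ.proj₁ α₁) ∘ₚ γ n)))

C : (n : ℕ) → Partition n → Partition n → Partition n → Set
C n la mu nu =
  Σ (SetPartition n × SetPartition n × SetPartition n × S n × S n)
    (λ { (π₁ , π₂ , π₃ , α₁ , α₂) → IsP3Cactus n la mu nu π₁ π₂ π₃ α₁ α₂ })

-- Thorn cactus trees.
--
-- A plane tree with thorns: each vertex carries a flag (true iff it is the
-- middle vertex of a triangle, i.e. a non-tree edge joins its parent to its
-- rightmost child) and the left-to-right sequence of its children and
-- thorns ('just t' = child subtree t, 'nothing' = thorn).

data Tree : Set where
  node : Bool → List (Maybe Tree) → Tree

data Colour : Set where
  white black grey : Colour

next : Colour → Colour
next white = black
next black = grey
next grey  = white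

_≡Cᵇ_ : Colour → Colour → Bool
white ≡Cᵇ white = true
black ≡Cᵇ black = true
grey  ≡Cᵇ grey  = true
_     ≡Cᵇ _     = false

numChildren : List (Maybe Tree) → ℕ
numChildren []              = 0
numChildren (just _ ∷ is)   = suc (numChildren is)
numChildren (nothing ∷ is)  = numChildren is

numThorns : List (Maybe Tree) → ℕ
numThorns []              = 0
numThorns (just _ ∷ is)   = numThorns is
numThorns (nothing ∷ is)  = suc (numThorns is)

record VInfo : Set where
  constructor vinfo
  field
    isRoot   : Bool
    colour   : Colour
    middle   : Bool
    children : ℕ
    thorns   : ℕ

-- degree = children + thorns − ε + 1 (for the root, which has no parent
-- edge: children + thorns)
degree : VInfo → ℕ
degree (vinfo r c m k t) =
  (k + t + (if r then 0 else 1)) ∸ (if m then 1 else 0)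

mutual
  vertices : Bool → Colour → Tree → List VInfo
  vertices r c (node m is) =
    vinfo r c m (numChildren is) (numThorns is) ∷ verticesItems (next c) is

  verticesItems : Colour → List (Maybe Tree) → List VInfo
  verticesItems c []             = []
  verticesItems c (nothing ∷ is) = verticesItems c is
  verticesItems c (just t ∷ is)  = vertices false c t ++ verticesItems c is

allVertices : Tree → List VInfo
allVertices = vertices true white

ofColour : Colour → Tree → List VInfo
ofColour c τ = filter (λ v → Relation.Nullary.Decidable.Core.T? (VInfo.colour v ≡Cᵇ c)) (allVertices τ)
  where import Relation.Nullary.Decidable.Core

numVertices : Colour → Tree → ℕ
numVertices c τ = length (ofColour c τ)

thornsOn : Colour → Tree → ℕ
thornsOn c τ = sum (map VInfo.thorns (ofColour c τ))

trianglesRootedAt : Colour → Tree → ℕ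
trianglesRootedAt c τ = countᵇ VInfo.middle (ofColour (next c) τ)

degrees : Colour → Tree → List ℕ
degrees c τ = map degree (ofColour c τ)

-- Validity of triangles: a middle vertex v has a rightmost child c, no thorn
-- after c (it would lie inside the triangle), and c is not itself a middle
-- vertex (the non-tree edge from v to c's rightmost child would lie inside
-- the triangle).
lastIsPlainChildᵇ : List (Maybe Tree) → Bool
lastIsPlainChildᵇ []                          = false
lastIsPlainChildᵇ (nothing ∷ [])              = false
lastIsPlainChildᵇ (just (node m _) ∷ [])      = not m
lastIsPlainChildᵇ (_ ∷ x ∷ xs)                = lastIsPlainChildᵇ (x ∷ xs)

mutual
  validᵇ : Tree → Bool
  validᵇ (node m is) = (if m then lastIsPlainChildᵇ is else true) ∧ validItemsᵇ is

  validItemsᵇ : List (Maybe Tree) → Bool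
  validItemsᵇ []             = true
  validItemsᵇ (nothing ∷ is) = validItemsᵇ is
  validItemsᵇ (just t ∷ is)  = validᵇ t ∧ validItemsᵇ is

rootNotMiddleᵇ : Tree → Bool
rootNotMiddleᵇ (node m _) = not m

record IsThornCactus (n : ℕ) (la mu nu : Partition n) (g w b : ℕ) (τ : Tree) : Set where
  field
    valid      : T (validᵇ τ ∧ rootNotMiddleᵇ τ)
    #white     : numVertices white τ ≡ ℓ la
    #black     : numVertices black τ ≡ ℓ mu
    #grey      : numVertices grey  τ ≡ ℓ nu
    triGrey    : trianglesRootedAt grey  τ ≡ g
    triWhite   : trianglesRootedAt white τ ≡ w
    triBlack   : trianglesRootedAt black τ ≡ b
    thornsW    : thornsOn white τ + ℓ la + ℓ mu ≡ n + 1 + g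
    thornsB    : thornsOn black τ + ℓ mu + ℓ nu ≡ n + w
    thornsG    : thornsOn grey  τ + ℓ la + ℓ nu ≡ n + 1 + b
    degW       : degrees white τ ≈ₘ parts la
    degB       : degrees black τ ≈ₘ parts mu
    degG       : degrees grey  τ ≈ₘ parts nu

CT~ : (n : ℕ) → Partition n → Partition n → Partition n → ℕ → ℕ → ℕ → Set
CT~ n la mu nu g w b = Σ Tree (IsThornCactus n la mu nu g w b)

Tuples : (n : ℕ) → Partition n → Partition n → Partition n → Set
Tuples n la mu nu =
  Σ ℕ λ g → Σ ℕ λ w → Σ ℕ λ b →
  Σ ℕ λ m₁ → Σ ℕ λ m₂ → Σ ℕ λ m₃ → Σ ℕ λ r →
    (m₁ + ℓ la + ℓ nu ≡ n + 1 + b) ×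
    (m₂ + ℓ mu + ℓ nu ≡ n + w) ×
    (m₃ + ℓ la + ℓ mu ≡ n + 1 + g) ×
    (r + w + b ≡ ℓ nu) ×
    CT~ n la mu nu g w b × S m₁ × S m₂ × OP m₃ r

{-# OPTIONS --safe #-}
-- A block of size d becomes a vertex with d ordered slots.  Reading i ↦ α₃ i ↦ α₂ α₃ i ↦ i + 1 as steps
-- white → grey → black → white turns a partitioned cactus into a closed walk that leaves every vertex once through
-- each of its slots, while the elements of [n] group the 3n slots into n triangles, the orbits of a permutation π
-- of order 3 such that leaving through the slot s leads to the vertex of π s.  As in the BEST theorem, such a walk is
-- determined by π and by the order of the slots at each vertex, and a system of slots admits it if and only if the
-- last slots lead every vertex to the root, i.e. form a tree.  Two edges of this tree lying in one orbit of π form a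
-- triangle of the cactus tree, and the slots met by no tree edge are the thorns.  Completing the partial orbits seen
-- in the tree to all of π amounts to choosing white thorns for the grey-black edges (χ), then grey slots for the
-- black-white edges and the remaining white thorns (σ₁), then black slots for everything still incomplete (σ₂).
module Submission where

open import Defs
import Algebra.Solver.CommutativeMonoid as CMSolver
open import Data.Bool.Base using (Bool; true; false; T; _∧_; not; if_then_else_)
open import Data.Bool.Properties using (T-irrelevant)
open import Data.Fin.Base as Fin using (Fin; zero; suc; toℕ)
import Data.Fin.Properties as FinP
open import Data.List.Base as List using (List; []; _∷_; _++_; _∷ʳ_; length; map; filter; concat; take; drop; allFin; findᵇ)
import Data.List.Membership.DecPropositional as DecMem
open import Data.List.Membership.Propositional using (_∈_; _∉_)
open import Data.List.Membership.Propositional.Properties using (∈-++⁺ʳ; ∈-++⁺ˡ; ∈-++⁻; ∈-allFin; ∈-concat⁺′; ∈-concat⁻′; ∈-deduplicate⁺; ∈-deduplicate⁻; ∈-filter⁺; ∈-filter⁻; ∈-lookup; ∈-map⁺; ∈-map⁻; ∈-∃++)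
open import Data.List.Properties as LP using (++-assoc; ++-cancelˡ; ++-identityʳ; concat-++; concat-map; filter-++; filter-accept; filter-all; filter-none; filter-reject; filter-≐; length-++; length-drop; length-map; length-tabulate; length-take; map-++; map-cong; map-cong-local; map-∘; take++drop≡id; ∷-injectiveʳ; ∷-injectiveˡ; ∷ʳ-++; ∷ʳ-injectiveʳ; ∷ʳ-injectiveˡ)
open import Data.List.Relation.Binary.Permutation.Propositional using (_↭_; ↭-refl; ↭-sym; ↭-trans; ↭-reflexive; prep; swap; ↭⇒↭ₛ; module PermutationReasoning)
open import Data.List.Relation.Binary.Permutation.Propositional.Properties as PermP using (++⁺ʳ; ++⁺ˡ; drop-∷; filter-↭; shift; shifts; ↭-length; ∈-resp-↭)
import Data.List.Relation.Binary.Permutation.Setoid.Properties as PermSP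
import Data.List.Relation.Binary.Pointwise as Pointwise
open import Data.List.Relation.Binary.Subset.Propositional using (_⊆_)
open import Data.List.Relation.Unary.All as All using (All; []; _∷_)
import Data.List.Relation.Unary.All.Properties as AllP
open import Data.List.Relation.Unary.AllPairs using ([]; _∷_)
import Data.List.Relation.Unary.Any as Any
open import Data.List.Relation.Unary.Any using (here; there)
import Data.List.Relation.Unary.Any.Properties as AnyP
open import Data.List.Relation.Unary.Sorted.TotalOrder.Properties using (↗↭↗⇒≋)
import Data.List.Relation.Unary.Unique.DecPropositional.Properties as DedupP
open import Data.List.Relation.Unary.Unique.Propositional using (Unique)
import Data.List.Relation.Unary.Unique.Propositional.Properties as UniqP
open import Data.Maybe.Base using (Maybe; just; nothing; fromMaybe)
open import Data.Nat.Base using (ℕ; zero; suc; _+_; _*_; _∸_; _≤_; _<_; z≤n; s≤s; _≤ᵇ_)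
open import Data.Nat.ListAction using (sum)
import Data.Nat.ListAction.Properties as ℕSum
import Data.Nat.Properties as ℕP
open import Data.Nat.Solver using (module +-*-Solver)
open import Data.Product.Base using (Σ; ∃; ∃₂; _×_; _,_; proj₁; proj₂; -,_)
import Data.Product.Properties as ProdP
open import Data.Sum.Base using (_⊎_; inj₁; inj₂; [_,_]′)
open import Data.Unit.Base using (⊤; tt)
open import Data.Vec.Base as Vec using (Vec; lookup; tabulate; toList)
import Data.Vec.Properties as VecP
open import Function.Base using (_∘_; id; case_of_)
open import Function.Bundles using (_⤖_; mk⤖)
open import Relation.Binary.Definitions using (DecidableEquality)
open import Relation.Binary.PropositionalEquality using (_≡_; _≢_; refl; sym; trans; cong; cong₂; subst; subst₂; setoid; module ≡-Reasoning)
open import Relation.Binary.PropositionalEquality.WithK using (≡-irrelevant)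
open import Relation.Nullary using (¬_; Dec; yes; no; contradiction)
open import Relation.Nullary.Decidable using (⌊_⌋; ¬?; T?)
open import Data.List.Sort ℕP.≤-decTotalOrder using (sort-↭; sort-↗)

-- Three tree edges never lie in one orbit of `π`, since they would close a cycle. So an orbit has
-- no edge and three thorns, one edge and one thorn, or two edges and no thorn, and it contains one
-- slot of each colour. Every colour has n slots in all, and counting them colour by colour shows
-- that the successive choices use up the grey and the black thorns exactly. This is why `σ₁` and
-- `σ₂` are permutations while `χ` is only an ordered subset. Slots have two competing names: in a
-- cactus the time at which they are used, in a tree their colour and position in preorder. No map
-- is inverted directly. Instead the relation `Rep` asks for a renaming that turns the walk of a
-- cactus into a trail of a tree, and it is shown to be total and single-valued in both directions.
-- Totality comes from the two halves of the BEST argument, exploring the tree of last exits and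
-- walking greedily without getting stuck; single-valuedness comes from the rigidity of trails and
-- of trees.

private variable
  A B : Set

-- Lists without repetitions and the pigeonhole principle.

unique-resp-↭ : {xs ys : List A} → xs ↭ ys → Unique xs → Unique ys
unique-resp-↭ p = PermSP.Unique-resp-↭ (setoid _) (↭⇒↭ₛ p)

unique-++⁻ : (xs : List A) {ys : List A} → Unique (xs ++ ys) →
  Unique xs × Unique ys × (∀ {a} → a ∈ xs → a ∉ ys)
unique-++⁻ [] u = [] , u , λ ()
unique-++⁻ (x ∷ xs) (x∉ ∷ u) with unique-++⁻ xs u
... | uxs , uys , dis = (AllP.++⁻ˡ xs x∉ ∷ uxs) , uys ,
  λ { (here refl) a∈ys → All.lookup (AllP.++⁻ʳ xs x∉) a∈ys refl
    ; (there a∈xs) a∈ys → dis a∈xs a∈ys }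

unique-map-on : (f : A → B) {xs : List A} →
  (∀ {a b} → a ∈ xs → b ∈ xs → f a ≡ f b → a ≡ b) → Unique xs → Unique (map f xs)
unique-map-on f inj [] = []
unique-map-on f inj (x∉ ∷ u) =
  AllP.map⁺ (All.tabulate (λ a∈ e → All.lookup x∉ a∈ (inj (here refl) (there a∈) e)))
  ∷ unique-map-on f (λ a b → inj (there a) (there b)) u

complement : {xs ys : List A} → Unique xs → xs ⊆ ys → ∃ λ zs → ys ↭ xs ++ zs
complement {ys = ys} [] sub = ys , ↭-refl
complement {xs = x ∷ xs} (x∉ ∷ u) sub with ∈-∃++ (sub (here refl))
... | ps , qs , refl with complement u (λ {a} a∈ → strip (All.lookup x∉ a∈) (sub (there a∈)))
  where
  strip : ∀ {a} → x ≢ a → a ∈ ps ++ x ∷ qs → a ∈ ps ++ qs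
  strip x≢a a∈ with ∈-++⁻ ps a∈
  ... | inj₁ p = ∈-++⁺ˡ p
  ... | inj₂ (here refl) = contradiction refl x≢a
  ... | inj₂ (there q) = ∈-++⁺ʳ ps q
... | zs , p = zs , ↭-trans (shift x ps qs) (prep x p)

unique-⊆-length : {xs ys : List A} → Unique xs → xs ⊆ ys → length xs ≤ length ys
unique-⊆-length {xs = xs} u sub with complement u sub
... | zs , p = subst (length xs ≤_) (sym (trans (↭-length p) (length-++ xs))) (ℕP.m≤m+n _ _)

-- The complement of `xs` in `ys` has no room to be nonempty. This form of the pigeonhole principle
-- yields the completeness of walks and of the choices of thorns.
unique-⊆-↭ : {xs ys : List A} → Unique xs → xs ⊆ ys → length ys ≤ length xs → xs ↭ ys
unique-⊆-↭ {xs = xs} {ys} u sub le with complement u sub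
... | [] , p = ↭-sym (↭-trans p (↭-reflexive (++-identityʳ xs)))
... | z ∷ zs , p = contradiction le (ℕP.<⇒≱ (subst (length xs <_)
      (sym (trans (↭-length p) (trans (length-++ xs) (ℕP.+-suc _ _)))) (s≤s (ℕP.m≤m+n _ _))))

unique-set-↭ : {xs ys : List A} → Unique xs → Unique ys → xs ⊆ ys → ys ⊆ xs → xs ↭ ys
unique-set-↭ u u′ sub sub′ = unique-⊆-↭ u sub (unique-⊆-length u′ sub′)

∈-concat-unique : {vs : List (List A)} → Unique (concat vs) → ∀ {v w a} →
  v ∈ vs → w ∈ vs → a ∈ v → a ∈ w → v ≡ w
∈-concat-unique {vs = x ∷ vs} u (here refl) (here refl) a∈v a∈w = refl
∈-concat-unique {vs = x ∷ vs} u (here refl) (there w∈) a∈v a∈w =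
  contradiction (∈-concat⁺′ a∈w w∈) (proj₂ (proj₂ (unique-++⁻ x u)) a∈v)
∈-concat-unique {vs = x ∷ vs} u (there v∈) (here refl) a∈v a∈w =
  contradiction (∈-concat⁺′ a∈v v∈) (proj₂ (proj₂ (unique-++⁻ x u)) a∈w)
∈-concat-unique {vs = x ∷ vs} u (there v∈) (there w∈) a∈v a∈w =
  ∈-concat-unique (proj₁ (proj₂ (unique-++⁻ x u))) v∈ w∈ a∈v a∈w

concat-unique⇒unique : {vs : List (List A)} → Unique (concat vs) → ∀ {v} → v ∈ vs → Unique v
concat-unique⇒unique {vs = x ∷ vs} u (here refl) = proj₁ (unique-++⁻ x u)
concat-unique⇒unique {vs = x ∷ vs} u (there v∈) =
  concat-unique⇒unique (proj₁ (proj₂ (unique-++⁻ x u))) v∈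

-- Closed walks with prescribed order of exits.

module Walk (_≟_ : DecidableEquality A) (π : A → A) where
  open DecMem _≟_ using (_∈?_)

  -- A vertex is identified with the list of its slots. The vertex `x` reached from `s` is only
  -- asserted to exist; disjointness of the vertices makes it unique.
  Chain : List (List A) → List A → List A → List A → Set
  Chain vs v [] w = v ≡ w
  Chain vs v (s ∷ ss) w = s ∈ v × ∃ λ x → x ∈ vs × π s ∈ x × Chain vs x ss w

  sect : List A → List A → List A
  sect v = filter (_∈? v)

  -- The analogue of an Eulerian circuit based at `r`: slots are outgoing arcs, `π` tells where an
  -- arc ends, and the order of a vertex as a list prescribes the order of its exits.
  record Trail (vs : List (List A)) (r us : List A) : Set where
    field
      chain   : Chain vs r us r
      ordered : ∀ {v} → v ∈ vs → sect v us ≡ v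
      covers  : us ↭ concat vs

  Chain-mono : ∀ {vs ws} → vs ⊆ ws → ∀ {v w} us → Chain vs v us w → Chain ws v us w
  Chain-mono sub [] e = e
  Chain-mono sub (s ∷ ss) (s∈ , x , x∈ , p , ch) = s∈ , x , sub x∈ , p , Chain-mono sub ss ch

  module _ {vs : List (List A)} (uniq : Unique (concat vs)) where

    -- The walk is deterministic: the next slot has to be the first one of the current vertex not
    -- yet used, and the vertex containing its image is the only possible next vertex.
    trail-unique : ∀ {r us us′} → r ∈ vs → Trail vs r us → Trail vs r us′ → us ≡ us′
    trail-unique {r} {us} {us′} r∈ t t′ =
      go [] r∈ us us′ (Trail.chain t) (Trail.chain t′) (λ v∈ → trans (Trail.ordered t v∈) (sym (Trail.ordered t′ v∈)))
      where
      same : ∀ pre v ss ss′ → sect v (pre ++ ss) ≡ sect v (pre ++ ss′) → sect v ss ≡ sect v ss′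
      same pre v ss ss′ e = ++-cancelˡ (sect v pre) _ _
        (trans (sym (filter-++ (_∈? v) pre ss)) (trans e (filter-++ (_∈? v) pre ss′)))
      go : ∀ pre {v} → v ∈ vs → ∀ ss ss′ → Chain vs v ss r → Chain vs v ss′ r →
           (∀ {x} → x ∈ vs → sect x (pre ++ ss) ≡ sect x (pre ++ ss′)) → ss ≡ ss′
      go pre v∈ [] [] c c′ o = refl
      go pre {v} v∈ [] (s ∷ ss) c (s∈ , _) o
        with () ← trans (same pre v [] (s ∷ ss) (o v∈)) (filter-accept (_∈? v) s∈)
      go pre {v} v∈ (s ∷ ss) [] (s∈ , _) c o
        with () ← trans (sym (same pre v (s ∷ ss) [] (o v∈))) (filter-accept (_∈? v) s∈)
      go pre {v} v∈ (s ∷ ss) (s′ ∷ ss′) (s∈ , x , x∈ , p , ch) (s′∈ , x′ , x′∈ , p′ , ch′) o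
        with refl ← ∷-injectiveˡ (trans (sym (filter-accept (_∈? v) {xs = ss} s∈))
                      (trans (same pre v _ _ (o v∈)) (filter-accept (_∈? v) {xs = ss′} s′∈)))
        with refl ← ∈-concat-unique uniq x∈ x′∈ p p′
        = cong (s ∷_) (go (pre ∷ʳ s) x∈ ss ss′ ch ch′
            (λ {y} y∈ → trans (cong (sect y) (∷ʳ-++ pre s ss))
                         (trans (o y∈) (cong (sect y) (sym (∷ʳ-++ pre s ss′))))))

    _≟L_ : DecidableEquality (List A)
    _≟L_ = LP.≡-dec _≟_

    entries : List A → List A → ℕ
    entries x us = length (filter (λ u → π u ∈? x) us)

    ind : List A → List A → ℕ
    ind v x = if ⌊ v ≟L x ⌋ then 1 else 0

    ind-refl : ∀ v → ind v v ≡ 1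
    ind-refl v with v ≟L v
    ... | yes _ = refl
    ... | no ne = contradiction refl ne

    len-accept : ∀ (f : A → A) {v x s} ss → v ∈ vs → x ∈ vs → f s ∈ v →
      length (filter (λ u → f u ∈? x) (s ∷ ss)) ≡ ind v x + length (filter (λ u → f u ∈? x) ss)
    len-accept f {v} {x} {s} ss v∈ x∈ s∈ with v ≟L x
    ... | yes refl = cong length (filter-accept (λ u → f u ∈? x) s∈)
    ... | no v≢x = cong length (filter-reject (λ u → f u ∈? x)
            (λ s∈x → v≢x (∈-concat-unique uniq v∈ x∈ s∈ s∈x)))

    -- Conservation of flow: passing through `x` costs one entry and one exit, so only the two ends
    -- of the walk can unbalance the count.
    balance : ∀ {x} → x ∈ vs → ∀ {v w} → v ∈ vs → ∀ us → Chain vs v us w →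
      entries x us + ind v x ≡ length (sect x us) + ind w x
    balance x∈ v∈ [] refl = refl
    balance {x} x∈ {v} {w} v∈ (s ∷ ss) (s∈ , y , y∈ , p , ch) = begin
      entries x (s ∷ ss) + ind v x              ≡⟨ cong (_+ ind v x) (len-accept π ss y∈ x∈ p) ⟩
      ind y x + entries x ss + ind v x          ≡⟨ cong (_+ ind v x) (ℕP.+-comm (ind y x) _) ⟩
      entries x ss + ind y x + ind v x          ≡⟨ cong (_+ ind v x) (balance x∈ y∈ ss ch) ⟩
      length (sect x ss) + ind w x + ind v x    ≡⟨ ℕP.+-comm _ (ind v x) ⟩
      ind v x + (length (sect x ss) + ind w x)  ≡⟨ ℕP.+-assoc (ind v x) _ _ ⟨
      ind v x + length (sect x ss) + ind w x    ≡⟨ cong (_+ ind w x) (len-accept id ss v∈ x∈ s∈) ⟨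
      length (sect x (s ∷ ss)) + ind w x        ∎
      where open ≡-Reasoning

    module _ (r : List A) (r∈ : r ∈ vs)
             (closed : ∀ {a} → a ∈ concat vs → π a ∈ concat vs)
             (inj : ∀ {a b} → a ∈ concat vs → b ∈ concat vs → π a ≡ π b → a ≡ b)
             -- That last slots lead every vertex to the root is phrased as an induction principle,
             -- which keeps the walk independent of any representation of trees. `items-rooted`
             -- supplies it later.
             (rooted : ∀ (P : A → Set) → (∀ {a} → a ∈ r → P a) →
               (∀ {x l} → x ∷ʳ l ∈ vs → P (π l) → ∀ {a} → a ∈ x ∷ʳ l → P a) →
               ∀ {a} → a ∈ concat vs → P a)
      where

      -- A partial greedy walk from `r`, standing at `v`. By `pre` the slots used so far form an
      -- initial segment of each vertex, so the next exit is the head of what remains.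
      record State (us v : List A) : Set where
        field
          v∈    : v ∈ vs
          chain : Chain vs r us v
          us!   : Unique us
          us⊆   : us ⊆ concat vs
          pre   : ∀ {x} → x ∈ vs → ∃ λ rest → sect x us ++ rest ≡ x

      module _ {us v} (st : State us v) where
        open State st

        private
          into : List A → List A
          into x = filter (λ u → π u ∈? x) us

          into⊆ : ∀ x {a} → a ∈ into x → a ∈ us × π a ∈ x
          into⊆ x = ∈-filter⁻ (λ u → π u ∈? x)

          into! : ∀ x → Unique (map π (into x))
          into! x = unique-map-on π
            (λ a b → inj (us⊆ (proj₁ (into⊆ x a))) (us⊆ (proj₁ (into⊆ x b))))
            (UniqP.filter⁺ _ us!)

          into-sub : ∀ x → map π (into x) ⊆ x
          into-sub x a∈ with ∈-map⁻ π a∈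
          ... | b , b∈ , refl = proj₂ (into⊆ x b∈)

        entries-≤ : ∀ x → entries x us ≤ length x
        entries-≤ x = subst (_≤ length x) (length-map π (into x)) (unique-⊆-length (into! x) (into-sub x))

        -- The used slots leading into `x` have distinct images in `x`. When there are as many as
        -- `x` has slots, the images exhaust `x`, and injectivity of `π` identifies `a` with one of
        -- the used slots.
        saturated : ∀ {x} → length x ≤ entries x us → ∀ {a} → a ∈ concat vs → π a ∈ x → a ∈ us
        saturated {x} le {a} a∈ πa∈ with ∈-map⁻ π (∈-resp-↭ (↭-sym (unique-⊆-↭ (into! x) (into-sub x)
              (subst (length x ≤_) (sym (length-map π (into x))) le))) πa∈)
        ... | b , b∈ , e with into⊆ x b∈
        ... | b∈us , _ with refl ← inj a∈ (us⊆ b∈us) e = b∈us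

        -- The used slots are an initial segment of the vertex. A nonempty remainder would end in
        -- `l`, which would then occur twice.
        last-used : ∀ {x l} → x ∷ʳ l ∈ vs → l ∈ us → sect (x ∷ʳ l) us ≡ x ∷ʳ l
        last-used {x} {l} x∈ l∈ with pre x∈
        ... | rest , e with List.initLast rest
        ... | [] = trans (sym (++-identityʳ _)) e
        ... | ys List.∷ʳ′ y with refl ← ∷ʳ-injectiveʳ (sect (x ∷ʳ l) us ++ ys) x (trans (++-assoc (sect (x ∷ʳ l) us) ys _) e)
          = contradiction (∈-++⁺ʳ ys (here refl))
            (proj₂ (proj₂ (unique-++⁻ (sect (x ∷ʳ l) us) (subst Unique (sym e) (concat-unique⇒unique uniq x∈))))
              (∈-filter⁺ _ l∈ (∈-++⁺ʳ x (here refl))))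

        -- Stuck away from `r`, the walk would have entered `v` once more often than `v` has slots.
        -- Stuck at `r`, it has used all exits of `r`, hence by balance all entries, among them the
        -- last slots of the vertices attached to `r`. A vertex whose last slot is used is
        -- exhausted, so the argument repeats up the tree.
        stuck : sect v us ≡ v → v ≡ r × concat vs ⊆ us
        stuck e = v≡r , λ a∈ → proj₁ (rooted P root step a∈)
          where
          bal : entries v us + ind r v ≡ suc (length v)
          bal = trans (balance v∈ r∈ us chain)
                  (trans (cong₂ _+_ (cong length e) (ind-refl v)) (ℕP.+-comm (length v) 1))
          v≡r : v ≡ r
          v≡r with r ≟L v | bal
          ... | yes refl | _ = refl
          ... | no _ | b = contradiction (entries-≤ v)
                 (ℕP.<⇒≱ (subst (length v <_) (trans (sym b) (ℕP.+-identityʳ _)) ℕP.≤-refl))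
          -- The second component is what travels along the tree: applied to `π l` it shows that the
          -- last slot `l` has been used.
          P : A → Set
          P a = a ∈ us × (∀ {b} → b ∈ concat vs → π b ≡ a → b ∈ us)
          done : ∀ {x} → x ∈ vs → sect x us ≡ x → ∀ {a} → a ∈ x → P a
          done {x} x∈ ex a∈ = proj₁ (∈-filter⁻ (_∈? x) (subst (_ ∈_) (sym ex) a∈)) ,
            λ { b∈ refl → saturated (ℕP.≤-reflexive (sym ent)) b∈ a∈ }
            where
            ent : entries x us ≡ length x
            ent = ℕP.+-cancelʳ-≡ (ind r x) _ _
              (trans (balance x∈ r∈ us chain) (cong₂ (λ ys w → length ys + ind w x) ex v≡r))
          root : ∀ {a} → a ∈ r → P a
          root = done r∈ (subst (λ w → sect w us ≡ w) v≡r e)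
          step : ∀ {x l} → x ∷ʳ l ∈ vs → P (π l) → ∀ {a} → a ∈ x ∷ʳ l → P a
          step {x} x∈ (_ , back) = done x∈ (last-used x∈
            (back (∈-concat⁺′ (∈-++⁺ʳ x (here refl)) x∈) refl))

        -- If the current vertex had no slot left, `stuck` would make the walk complete, against the
        -- bound on its length.
        advance : length us < length (concat vs) → ∃₂ λ a w → State (us ∷ʳ a) w
        advance lt with pre v∈
        ... | [] , e = contradiction (unique-⊆-length uniq (proj₂ (stuck (trans (sym (++-identityʳ _)) e)))) (ℕP.<⇒≱ lt)
        ... | a ∷ rest , e with ∈-concat⁻′ vs (closed (∈-concat⁺′ {v = a} (subst (a ∈_) e (∈-++⁺ʳ (sect v us) (here refl))) v∈))
        ... | w , πa∈w , w∈ = a , w , record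
          { v∈ = w∈
          ; chain = snoc us chain
          ; us! = UniqP.++⁺ us! ([] ∷ []) λ { (p , here refl) → a∉us p }
          ; us⊆ = λ b∈ → [ us⊆ , (λ { (here refl) → ∈-concat⁺′ a∈v v∈ }) ]′ (∈-++⁻ us b∈)
          ; pre = pre′ }
          where
          a∈v : a ∈ v
          a∈v = subst (a ∈_) e (∈-++⁺ʳ (sect v us) (here refl))
          a∉us : a ∉ us
          a∉us p = proj₂ (proj₂ (unique-++⁻ (sect v us) (subst Unique (sym e) (concat-unique⇒unique uniq v∈))))
                     (∈-filter⁺ (_∈? v) p a∈v) (here refl)
          snoc : ∀ {y} ss → Chain vs y ss v → Chain vs y (ss ∷ʳ a) w
          snoc [] refl = a∈v , w , w∈ , πa∈w , refl
          snoc (s ∷ ss) (s∈ , z , z∈ , p , ch) = s∈ , z , z∈ , p , snoc ss ch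
          pre′ : ∀ {x} → x ∈ vs → ∃ λ rst → sect x (us ∷ʳ a) ++ rst ≡ x
          pre′ {x} x∈ with a ∈? x
          ... | yes a∈x with refl ← ∈-concat-unique uniq x∈ v∈ a∈x a∈v = rest ,
                trans (cong (_++ rest) (trans (filter-++ (_∈? x) us _) (cong (sect x us ++_) (filter-accept (_∈? x) a∈x))))
                 (trans (++-assoc (sect x us) _ _) e)
          ... | no a∉x with pre x∈
          ... | rst , e′ = rst , trans (cong (_++ rst) (trans (filter-++ (_∈? x) us _)
                (trans (cong (sect x us ++_) (filter-reject (_∈? x) a∉x)) (++-identityʳ _)))) e′

      walk : ∀ k → k ≤ length (concat vs) → ∃₂ λ us v → State us v × length us ≡ k
      walk zero _ = [] , r , record { v∈ = r∈ ; chain = refl ; us! = [] ; us⊆ = λ () ; pre = λ _ → _ , refl } , refl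
      walk (suc k) le with walk k (ℕP.<⇒≤ le)
      ... | us , v , st , refl with advance st le
      ... | a , w , st′ = us ∷ʳ a , w , st′ , trans (length-++ us) (ℕP.+-comm _ 1)

      trail-exists : ∃ (Trail vs r)
      trail-exists with walk (length (concat vs)) ℕP.≤-refl
      ... | us , v , st , len = us , record
        { chain = subst (Chain vs r us) (proj₁ (stuck st (ord v∈))) chain
        ; ordered = ord
        ; covers = perm }
        where
        open State st
        perm : us ↭ concat vs
        perm = unique-⊆-↭ us! us⊆ (ℕP.≤-reflexive (sym len))
        ord : ∀ {x} → x ∈ vs → sect x us ≡ x
        ord {x} x∈ with pre x∈
        ... | [] , e = trans (sym (++-identityʳ _)) e
        ... | a ∷ rest , e = contradiction (here refl)
          (proj₂ (proj₂ (unique-++⁻ (sect x us) (subst Unique (sym e) (concat-unique⇒unique uniq x∈))))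
            (∈-filter⁺ (_∈? x) (∈-resp-↭ (↭-sym perm) (∈-concat⁺′ a∈x x∈)) a∈x))
          where
          a∈x : a ∈ x
          a∈x = subst (a ∈_) e (∈-++⁺ʳ (sect x us) (here refl))

-- Trees of vertices with ordered slots.

-- The ordered slots of one vertex, without the last slot if the vertex is not the root, together with
-- everything attached to them.  `one s l J K`: slot s carries an ordinary child, whose slots are those of J followed
-- by l.  `two s l l′ J J′ K`: slot s carries the middle vertex of a triangle, whose slots are those of J followed
-- by l, and whose rightmost child, attached at l, has the slots of J′ followed by l′.
data Items (A : Set) : Set where
  ∅     : Items A
  thorn : (s : A) (K : Items A) → Items A
  one   : (s l : A) (J K : Items A) → Items A
  two   : (s l l′ : A) (J J′ K : Items A) → Items A

slots : Items A → List A
slots ∅ = []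
slots (thorn s K) = s ∷ slots K
slots (one s l J K) = s ∷ slots K
slots (two s l l′ J J′ K) = s ∷ slots K

descendants : Items A → List (List A)
descendants ∅ = []
descendants (thorn s K) = descendants K
descendants (one s l J K) = (slots J ∷ʳ l) ∷ descendants J ++ descendants K
descendants (two s l l′ J J′ K) = (slots J ∷ʳ l) ∷ (slots J′ ∷ʳ l′) ∷ descendants J ++ descendants J′ ++ descendants K

verts : Items A → List (List A)
verts I = slots I ∷ descendants I

-- Preorder, with the last slot of a child directly after the slot that carries the child; `number`
-- counts in the same order.
labels : Items A → List A
labels ∅ = []
labels (thorn s K) = s ∷ labels K
labels (one s l J K) = s ∷ l ∷ labels J ++ labels K
labels (two s l l′ J J′ K) = s ∷ l ∷ l′ ∷ labels J ++ labels J′ ++ labels K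

thorns : Items A → List A
thorns ∅ = []
thorns (thorn s K) = s ∷ thorns K
thorns (one s l J K) = thorns J ++ thorns K
thorns (two s l l′ J J′ K) = thorns J ++ thorns J′ ++ thorns K

-- Orbits of which the tree shows one edge. The pair is ordered along `π`, from the last slot of the
-- child to the slot of the parent; the third slot of the orbit is left open.
ones : Items A → List (A × A)
ones ∅ = []
ones (thorn s K) = ones K
ones (one s l J K) = (l , s) ∷ ones J ++ ones K
ones (two s l l′ J J′ K) = ones J ++ ones J′ ++ ones K

-- Orbits of which the tree shows two edges. Listed along `π`, they are complete.
twos : Items A → List (A × A × A)
twos ∅ = []
twos (thorn s K) = twos K
twos (one s l J K) = twos J ++ twos K
twos (two s l l′ J J′ K) = (l′ , l , s) ∷ twos J ++ twos J′ ++ twos K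

flat : List (A × A × A) → List A
flat [] = []
flat ((x , y , z) ∷ ts) = x ∷ y ∷ z ∷ flat ts

Edges : (A → A) → Items A → Set
Edges π ∅ = ⊤
Edges π (thorn s K) = Edges π K
Edges π (one s l J K) = π l ≡ s × Edges π J × Edges π K
Edges π (two s l l′ J J′ K) = π l ≡ s × π l′ ≡ l × Edges π J × Edges π J′ × Edges π K

flat-++ : (ts us : List (A × A × A)) → flat (ts ++ us) ≡ flat ts ++ flat us
flat-++ [] us = refl
flat-++ ((x , y , z) ∷ ts) us = cong (λ xs → x ∷ y ∷ z ∷ xs) (flat-++ ts us)

module _ {A : Set} where
  open CMSolver (PermP.++-commutativeMonoid {A = A}) using (solve; _⊕_; _⊜_)

  labels↭verts : (I : Items A) → labels I ↭ concat (verts I)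
  labels↭verts ∅ = ↭-refl
  labels↭verts (thorn s K) = prep s (labels↭verts K)
  labels↭verts (one s l J K) rewrite sym (concat-++ (descendants J) (descendants K)) =
    ↭-trans (prep s (prep l (PermP.++⁺ (labels↭verts J) (labels↭verts K))))
      (solve 6 (λ s l j dj k dk → s ⊕ (l ⊕ ((j ⊕ dj) ⊕ (k ⊕ dk))) ⊜ s ⊕ (k ⊕ ((j ⊕ l) ⊕ (dj ⊕ dk))))
        ↭-refl (s ∷ []) (l ∷ []) (slots J) (concat (descendants J)) (slots K) (concat (descendants K)))
  labels↭verts (two s l l′ J J′ K)
    rewrite sym (concat-++ (descendants J) (descendants J′ ++ descendants K))
          | sym (concat-++ (descendants J′) (descendants K)) =
    ↭-trans (prep s (prep l (prep l′ (PermP.++⁺ (labels↭verts J) (PermP.++⁺ (labels↭verts J′) (labels↭verts K))))))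
      (solve 9 (λ s l l′ j dj j′ dj′ k dk → s ⊕ (l ⊕ (l′ ⊕ ((j ⊕ dj) ⊕ ((j′ ⊕ dj′) ⊕ (k ⊕ dk)))))
                 ⊜ s ⊕ (k ⊕ ((j ⊕ l) ⊕ ((j′ ⊕ l′) ⊕ (dj ⊕ (dj′ ⊕ dk))))))
        ↭-refl (s ∷ []) (l ∷ []) (l′ ∷ []) (slots J) (concat (descendants J)) (slots J′) (concat (descendants J′))
               (slots K) (concat (descendants K)))

  -- Slots are sorted by what the tree reveals of their orbits: nothing, one of the two ends of a
  -- single edge, or everything. Uniqueness of labels makes these kinds disjoint, which later
  -- excludes the wrong cases.
  labels↭pieces : (I : Items A) →
    labels I ↭ thorns I ++ map proj₁ (ones I) ++ map proj₂ (ones I) ++ flat (twos I)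
  labels↭pieces ∅ = ↭-refl
  labels↭pieces (thorn s K) = prep s (labels↭pieces K)
  labels↭pieces (one s l J K)
    rewrite map-++ proj₁ (ones J) (ones K) | map-++ proj₂ (ones J) (ones K) | flat-++ (twos J) (twos K) =
    ↭-trans (prep s (prep l (PermP.++⁺ (labels↭pieces J) (labels↭pieces K))))
      (solve 10 (λ s l j₁ j₂ j₃ j₄ k₁ k₂ k₃ k₄ →
          s ⊕ (l ⊕ ((j₁ ⊕ (j₂ ⊕ (j₃ ⊕ j₄))) ⊕ (k₁ ⊕ (k₂ ⊕ (k₃ ⊕ k₄)))))
          ⊜ (j₁ ⊕ k₁) ⊕ ((l ⊕ (j₂ ⊕ k₂)) ⊕ ((s ⊕ (j₃ ⊕ k₃)) ⊕ (j₄ ⊕ k₄))))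
        ↭-refl (s ∷ []) (l ∷ []) (thorns J) (map proj₁ (ones J)) (map proj₂ (ones J)) (flat (twos J))
               (thorns K) (map proj₁ (ones K)) (map proj₂ (ones K)) (flat (twos K)))
  labels↭pieces (two s l l′ J J′ K)
    rewrite map-++ proj₁ (ones J) (ones J′ ++ ones K) | map-++ proj₁ (ones J′) (ones K)
          | map-++ proj₂ (ones J) (ones J′ ++ ones K) | map-++ proj₂ (ones J′) (ones K)
          | flat-++ (twos J) (twos J′ ++ twos K) | flat-++ (twos J′) (twos K) =
    ↭-trans (prep s (prep l (prep l′ (PermP.++⁺ (labels↭pieces J) (PermP.++⁺ (labels↭pieces J′) (labels↭pieces K))))))
      (solve 15 (λ s l l′ j₁ j₂ j₃ j₄ i₁ i₂ i₃ i₄ k₁ k₂ k₃ k₄ →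
          s ⊕ (l ⊕ (l′ ⊕ ((j₁ ⊕ (j₂ ⊕ (j₃ ⊕ j₄))) ⊕ ((i₁ ⊕ (i₂ ⊕ (i₃ ⊕ i₄))) ⊕ (k₁ ⊕ (k₂ ⊕ (k₃ ⊕ k₄)))))))
          ⊜ (j₁ ⊕ (i₁ ⊕ k₁)) ⊕ ((j₂ ⊕ (i₂ ⊕ k₂)) ⊕ ((j₃ ⊕ (i₃ ⊕ k₃)) ⊕ (l′ ⊕ (l ⊕ (s ⊕ (j₄ ⊕ (i₄ ⊕ k₄))))))))
        ↭-refl (s ∷ []) (l ∷ []) (l′ ∷ []) (thorns J) (map proj₁ (ones J)) (map proj₂ (ones J)) (flat (twos J))
               (thorns J′) (map proj₁ (ones J′)) (map proj₂ (ones J′)) (flat (twos J′))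
               (thorns K) (map proj₁ (ones K)) (map proj₂ (ones K)) (flat (twos K)))

module _ {π : A → A} where

  -- A slot carrying a child is the image of the last slot of that child, so it hands `P` to the
  -- whole child. At a triangle this happens twice, the second time through the last slot of the
  -- middle vertex.
  items-rooted : ∀ {vs} (P : A → Set) →
    (∀ {x l} → x ∷ʳ l ∈ vs → P (π l) → ∀ {a} → a ∈ x ∷ʳ l → P a) →
    ∀ J → Edges π J → descendants J ⊆ vs → (∀ {a} → a ∈ slots J → P a) → ∀ {a} → a ∈ concat (descendants J) → P a
  items-rooted P step (thorn s K) e sub root a∈ = items-rooted P step K e sub (root ∘ there) a∈
  items-rooted P step (one s l J K) (refl , eJ , eK) sub root {a} a∈
    with ∈-++⁻ (slots J ∷ʳ l) a∈
  ... | inj₁ p = step (sub (here refl)) (root (here refl)) p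
  ... | inj₂ p with ∈-++⁻ (concat (descendants J)) (subst (a ∈_) (sym (concat-++ (descendants J) (descendants K))) p)
  ... | inj₁ q = items-rooted P step J eJ (sub ∘ there ∘ ∈-++⁺ˡ)
                   (step (sub (here refl)) (root (here refl)) ∘ ∈-++⁺ˡ) q
  ... | inj₂ q = items-rooted P step K eK (sub ∘ there ∘ ∈-++⁺ʳ (descendants J)) (root ∘ there) q
  items-rooted {vs} P step (two s l l′ J J′ K) (refl , refl , eJ , eJ′ , eK) sub root {a} a∈
    with ∈-++⁻ (slots J ∷ʳ l) a∈
  ... | inj₁ p = step (sub (here refl)) (root (here refl)) p
  ... | inj₂ p with ∈-++⁻ (slots J′ ∷ʳ l′) p
  ... | inj₁ q = step {x = slots J′} (sub (there (here refl)))
                   (step (sub (here refl)) (root (here refl)) (∈-++⁺ʳ (slots J) (here refl))) q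
  ... | inj₂ q with ∈-++⁻ (concat (descendants J)) (subst (a ∈_) (sym (concat-++ (descendants J) (descendants J′ ++ descendants K))) q)
  ... | inj₁ h = items-rooted P step J eJ (sub ∘ there ∘ there ∘ ∈-++⁺ˡ)
                   (step (sub (here refl)) (root (here refl)) ∘ ∈-++⁺ˡ) h
  ... | inj₂ h with ∈-++⁻ (concat (descendants J′)) (subst (a ∈_) (sym (concat-++ (descendants J′) (descendants K))) h)
  ... | inj₁ i = items-rooted P step J′ eJ′ (sub ∘ there ∘ there ∘ ∈-++⁺ʳ (descendants J) ∘ ∈-++⁺ˡ)
                   (step {x = slots J′} (sub (there (here refl)))
                     (step (sub (here refl)) (root (here refl)) (∈-++⁺ʳ (slots J) (here refl))) ∘ ∈-++⁺ˡ) i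
  ... | inj₂ i = items-rooted P step K eK
                   (sub ∘ there ∘ there ∘ ∈-++⁺ʳ (descendants J) ∘ ∈-++⁺ʳ (descendants J′)) (root ∘ there) i

  edges-ones : ∀ I → Edges π I → All (λ (l , s) → π l ≡ s) (ones I)
  edges-ones ∅ e = []
  edges-ones (thorn s K) e = edges-ones K e
  edges-ones (one s l J K) (p , eJ , eK) = p ∷ AllP.++⁺ (edges-ones J eJ) (edges-ones K eK)
  edges-ones (two s l l′ J J′ K) (p , q , eJ , eJ′ , eK) =
    AllP.++⁺ (edges-ones J eJ) (AllP.++⁺ (edges-ones J′ eJ′) (edges-ones K eK))

  edges-twos : ∀ I → Edges π I → All (λ (l′ , l , s) → π l′ ≡ l × π l ≡ s) (twos I)
  edges-twos ∅ e = []
  edges-twos (thorn s K) e = edges-twos K e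
  edges-twos (one s l J K) (p , eJ , eK) = AllP.++⁺ (edges-twos J eJ) (edges-twos K eK)
  edges-twos (two s l l′ J J′ K) (p , q , eJ , eJ′ , eK) =
    (q , p) ∷ AllP.++⁺ (edges-twos J eJ) (AllP.++⁺ (edges-twos J′ eJ′) (edges-twos K eK))

  edges⁻ : ∀ I → All (λ (l , s) → π l ≡ s) (ones I) → All (λ (l′ , l , s) → π l′ ≡ l × π l ≡ s) (twos I) → Edges π I
  edges⁻ ∅ o t = tt
  edges⁻ (thorn s K) o t = edges⁻ K o t
  edges⁻ (one s l J K) (p ∷ o) t = p ,
    edges⁻ J (AllP.++⁻ˡ (ones J) o) (AllP.++⁻ˡ (twos J) t) , edges⁻ K (AllP.++⁻ʳ (ones J) o) (AllP.++⁻ʳ (twos J) t)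
  edges⁻ (two s l l′ J J′ K) o ((q , p) ∷ t) = p , q ,
    edges⁻ J (AllP.++⁻ˡ (ones J) o) (AllP.++⁻ˡ (twos J) t) ,
    edges⁻ J′ (AllP.++⁻ˡ (ones J′) (AllP.++⁻ʳ (ones J) o)) (AllP.++⁻ˡ (twos J′) (AllP.++⁻ʳ (twos J) t)) ,
    edges⁻ K (AllP.++⁻ʳ (ones J′) (AllP.++⁻ʳ (ones J) o)) (AllP.++⁻ʳ (twos J′) (AllP.++⁻ʳ (twos J) t))

-- Growing the tree of last slots vertex by vertex.

bare : List A → Items A
bare [] = ∅
bare (x ∷ xs) = thorn x (bare xs)

slots-bare : (xs : List A) → slots (bare xs) ≡ xs
slots-bare [] = refl
slots-bare (x ∷ xs) = cong (x ∷_) (slots-bare xs)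

descendants-bare : (xs : List A) → descendants (bare xs) ≡ []
descendants-bare [] = refl
descendants-bare (x ∷ xs) = descendants-bare xs

edges-bare : (π : A → A) (xs : List A) → Edges π (bare xs)
edges-bare π [] = tt
edges-bare π (x ∷ xs) = edges-bare π xs

module _ (π : A → A) (x : List A) (l : A) where
  open CMSolver (PermP.++-commutativeMonoid {A = List A}) using (solve; _⊕_; _⊜_)

  Inserted : Items A → Items A → Set
  Inserted I I′ = slots I′ ≡ slots I × descendants I′ ↭ (x ∷ʳ l) ∷ descendants I × Edges π I′

  -- The new vertex hangs where `π l` lies. A thorn there becomes a `one`. If `π l` is the last slot
  -- of the child of a `one`, the orbit now shows two edges and the `one` becomes a `two`. Every
  -- other position is already the image of a slot of the tree, which injectivity would identify
  -- with `l`; for the slot `l₁` that closes a triangle this preimage is `s`, because `π` has order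
  -- three.
  insert : (I : Items A) → Edges π I → π l ∈ labels I → l ∉ labels I →
    (∀ {b} → b ∈ labels I → π b ≡ π l → b ≡ l) → (∀ {b} → b ∈ labels I → π (π (π b)) ≡ b) → ∃ (Inserted I)
  insert (thorn s K) e (here πl≡s) l∉ inj cube = one s l (bare x) K , refl ,
    ↭-reflexive (cong₂ _∷_ (cong (_∷ʳ l) (slots-bare x)) (cong (_++ descendants K) (descendants-bare x))) ,
    πl≡s , edges-bare π x , e
  insert (thorn s K) e (there p) l∉ inj cube with insert K e p (l∉ ∘ there) (inj ∘ there) (cube ∘ there)
  ... | K′ , sl , de , e′ = thorn s K′ , cong (s ∷_) sl , de , e′
  insert (one s l₀ J K) (e₀ , eJ , eK) (here πl≡s) l∉ inj cube =
    contradiction (there (here (sym (inj (there (here refl)) (trans e₀ (sym πl≡s)))))) l∉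
  insert (one s l₀ J K) (e₀ , eJ , eK) (there (here πl≡l₀)) l∉ inj cube =
    two s l₀ l J (bare x) K , refl ,
    ↭-trans (↭-reflexive (cong₂ (λ b d → (slots J ∷ʳ l₀) ∷ (b ∷ʳ l) ∷ descendants J ++ d ++ descendants K)
                            (slots-bare x) (descendants-bare x)))
            (swap _ _ ↭-refl) ,
    e₀ , πl≡l₀ , eJ , edges-bare π x , eK
  insert (one s l₀ J K) (e₀ , eJ , eK) (there (there p)) l∉ inj cube with ∈-++⁻ (labels J) p
  ... | inj₁ q with insert J eJ q (l∉ ∘ there ∘ there ∘ ∈-++⁺ˡ) (inj ∘ there ∘ there ∘ ∈-++⁺ˡ) (cube ∘ there ∘ there ∘ ∈-++⁺ˡ)
  ... | J′ , sl , de , e′ = one s l₀ J′ K , refl ,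
        ↭-trans (PermP.++⁺ (↭-reflexive (cong (λ b → (b ∷ʳ l₀) ∷ []) sl)) (++⁺ʳ (descendants K) de)) (swap _ _ ↭-refl) ,
        e₀ , e′ , eK
  insert (one s l₀ J K) (e₀ , eJ , eK) (there (there p)) l∉ inj cube
      | inj₂ q with insert K eK q (l∉ ∘ there ∘ there ∘ ∈-++⁺ʳ (labels J)) (inj ∘ there ∘ there ∘ ∈-++⁺ʳ (labels J)) (cube ∘ there ∘ there ∘ ∈-++⁺ʳ (labels J))
  ... | K′ , sl , de , e′ = one s l₀ J K′ , cong (s ∷_) sl ,
        ↭-trans (prep _ (++⁺ˡ (descendants J) de))
         (solve 4 (λ a d n k → a ⊕ (d ⊕ (n ⊕ k)) ⊜ n ⊕ (a ⊕ (d ⊕ k))) ↭-refl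
           ((slots J ∷ʳ l₀) ∷ []) (descendants J) ((x ∷ʳ l) ∷ []) (descendants K)) ,
        e₀ , eJ , e′
  insert (two s l₀ l₁ J J′ K) (e₀ , e₁ , _) (here πl≡s) l∉ inj cube =
    contradiction (there (here (sym (inj (there (here refl)) (trans e₀ (sym πl≡s)))))) l∉
  insert (two s l₀ l₁ J J′ K) (e₀ , e₁ , _) (there (here πl≡l₀)) l∉ inj cube =
    contradiction (there (there (here (sym (inj (there (there (here refl))) (trans e₁ (sym πl≡l₀))))))) l∉
  insert (two s l₀ l₁ J J′ K) (e₀ , e₁ , _) (there (there (here πl≡l₁))) l∉ inj cube =
    contradiction (here (sym (inj (here refl)
      (trans (cong π (sym (trans (cong π e₁) e₀))) (trans (cube (there (there (here refl)))) (sym πl≡l₁)))))) l∉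
  insert (two s l₀ l₁ J J′ K) (e₀ , e₁ , eJ , eJ′ , eK) (there (there (there p))) l∉ inj cube
    with ∈-++⁻ (labels J) p
  ... | inj₁ q with insert J eJ q (l∉ ∘ there ∘ there ∘ there ∘ ∈-++⁺ˡ) (inj ∘ there ∘ there ∘ there ∘ ∈-++⁺ˡ) (cube ∘ there ∘ there ∘ there ∘ ∈-++⁺ˡ)
  ... | I′ , sl , de , e′ = two s l₀ l₁ I′ J′ K , refl ,
        ↭-trans (PermP.++⁺ (↭-reflexive (cong (λ b → (b ∷ʳ l₀) ∷ []) sl)) (prep _ (++⁺ʳ (descendants J′ ++ descendants K) de)))
          (solve 4 (λ a b n d → a ⊕ (b ⊕ (n ⊕ d)) ⊜ n ⊕ (a ⊕ (b ⊕ d))) ↭-refl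
            ((slots J ∷ʳ l₀) ∷ []) ((slots J′ ∷ʳ l₁) ∷ []) ((x ∷ʳ l) ∷ []) (descendants J ++ descendants J′ ++ descendants K)) ,
        e₀ , e₁ , e′ , eJ′ , eK
  insert (two s l₀ l₁ J J′ K) (e₀ , e₁ , eJ , eJ′ , eK) (there (there (there p))) l∉ inj cube
      | inj₂ p′ with ∈-++⁻ (labels J′) p′
  ... | inj₁ q with insert J′ eJ′ q (l∉ ∘ there ∘ there ∘ there ∘ ∈-++⁺ʳ (labels J) ∘ ∈-++⁺ˡ)
                     (inj ∘ there ∘ there ∘ there ∘ ∈-++⁺ʳ (labels J) ∘ ∈-++⁺ˡ)
                     (cube ∘ there ∘ there ∘ there ∘ ∈-++⁺ʳ (labels J) ∘ ∈-++⁺ˡ)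
  ... | I′ , sl , de , e′ = two s l₀ l₁ J I′ K , refl ,
        ↭-trans (prep _ (PermP.++⁺ (↭-reflexive (cong (λ b → (b ∷ʳ l₁) ∷ []) sl))
                   (++⁺ˡ (descendants J) (++⁺ʳ (descendants K) de))))
          (solve 5 (λ a b j n d → a ⊕ (b ⊕ (j ⊕ (n ⊕ d))) ⊜ n ⊕ (a ⊕ (b ⊕ (j ⊕ d)))) ↭-refl
            ((slots J ∷ʳ l₀) ∷ []) ((slots J′ ∷ʳ l₁) ∷ []) (descendants J) ((x ∷ʳ l) ∷ []) (descendants J′ ++ descendants K)) ,
        e₀ , e₁ , eJ , e′ , eK
  insert (two s l₀ l₁ J J′ K) (e₀ , e₁ , eJ , eJ′ , eK) (there (there (there p))) l∉ inj cube
      | inj₂ p′ | inj₂ q with insert K eK q (l∉ ∘ there ∘ there ∘ there ∘ ∈-++⁺ʳ (labels J) ∘ ∈-++⁺ʳ (labels J′))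
                     (inj ∘ there ∘ there ∘ there ∘ ∈-++⁺ʳ (labels J) ∘ ∈-++⁺ʳ (labels J′))
                     (cube ∘ there ∘ there ∘ there ∘ ∈-++⁺ʳ (labels J) ∘ ∈-++⁺ʳ (labels J′))
  ... | I′ , sl , de , e′ = two s l₀ l₁ J J′ I′ , cong (s ∷_) sl ,
        ↭-trans (prep _ (prep _ (++⁺ˡ (descendants J) (++⁺ˡ (descendants J′) de))))
          (solve 6 (λ a b j j′ n d → a ⊕ (b ⊕ (j ⊕ (j′ ⊕ (n ⊕ d)))) ⊜ n ⊕ (a ⊕ (b ⊕ (j ⊕ (j′ ⊕ d))))) ↭-refl
            ((slots J ∷ʳ l₀) ∷ []) ((slots J′ ∷ʳ l₁) ∷ []) (descendants J) (descendants J′) ((x ∷ʳ l) ∷ []) (descendants K)) ,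
        e₀ , e₁ , eJ , eJ′ , e′

concat-↭ : {xs ys : List (List A)} → xs ↭ ys → concat xs ↭ concat ys
concat-↭ _↭_.refl = ↭-refl
concat-↭ (prep x p) = ++⁺ˡ x (concat-↭ p)
concat-↭ (swap x y p) = ↭-trans (shifts x y) (++⁺ˡ y (++⁺ˡ x (concat-↭ p)))
concat-↭ (_↭_.trans p q) = ↭-trans (concat-↭ p) (concat-↭ q)

concat-unique⇒unique-list : {vs : List (List A)} → Unique (concat vs) → (∀ {x} → x ∈ vs → x ≢ []) → Unique vs
concat-unique⇒unique-list {vs = []} _ _ = []
concat-unique⇒unique-list {vs = [] ∷ vs} u ne = contradiction refl (ne (here refl))
concat-unique⇒unique-list {vs = (a ∷ w) ∷ vs} u ne with unique-++⁻ (a ∷ w) u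
... | _ , u′ , dis = All.tabulate (λ { x∈ refl → dis (here refl) (∈-concat⁺′ (here refl) x∈) }) ∷
  concat-unique⇒unique-list u′ (ne ∘ there)

module _ (_≟_ : DecidableEquality A) (π : A → A) where
  open Walk _≟_ π
  open DecMem _≟_ using (_∈?_)
  open DecMem (LP.≡-dec _≟_) using () renaming (_∈?_ to _∈L?_)

  -- Reading the trail backwards, a vertex is met for the first time through its last slot, which leads to a vertex
  -- already present.
  explore : ∀ {vs r us} → Unique (concat vs) → r ∈ vs → Trail vs r us →
    (∀ {a} → a ∈ concat vs → π (π (π a)) ≡ a) → (∀ {x} → x ∈ vs → x ≢ []) →
    ∃ λ I → slots I ≡ r × verts I ↭ vs × Edges π I
  explore {vs} {r} {us} uniq r∈ trail cube nonempty
    = finish (go [] us refl r∈ chain)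
    where
    open Trail trail

    Discovered : List A → List A → Items A → Set
    -- The last two components say that, apart from the root, the tree contains exactly the vertices
    -- left during `suf`. Hence a vertex missing from the tree has no slot in `suf`.
    Discovered v suf I = slots I ≡ r × Edges π I × verts I ⊆ vs × Unique (concat (verts I)) × v ∈ verts I ×
      (∀ {x} → x ∈ verts I → x ≡ r ⊎ ∃ λ s → s ∈ suf × s ∈ x) ×
      (∀ {s x} → s ∈ suf → x ∈ vs → s ∈ x → x ∈ verts I)

    go : ∀ pre suf {v} → pre ++ suf ≡ us → v ∈ vs → Chain vs v suf r → ∃ (Discovered v suf)
    go pre [] eq v∈ refl = bare r , slots-bare r , edges-bare π r ,
      (λ x∈ → subst (_∈ vs) (sym (only x∈)) r∈) ,
      subst (λ ws → Unique (concat ws)) (sym vr) (subst Unique (sym (++-identityʳ r)) (concat-unique⇒unique uniq r∈)) ,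
      subst (r ∈_) (sym vr) (here refl) , (λ x∈ → inj₁ (only x∈)) , λ ()
      where
      vr : verts (bare r) ≡ r ∷ []
      vr = cong₂ _∷_ (slots-bare r) (descendants-bare r)
      only : ∀ {x} → x ∈ verts (bare r) → x ≡ r
      only {x} x∈ with here e ← subst (x ∈_) vr x∈ = e
    go pre (s ∷ suf) {v} eq v∈ (s∈v , w , w∈ , πs∈w , ch)
      with go (pre ∷ʳ s) suf (trans (∷ʳ-++ pre s suf) eq) w∈ ch
    ... | I , sl , e , v⊆ , u , w∈I , met , found with v ∈L? verts I
    ... | yes v∈I = I , sl , e , v⊆ , u , v∈I ,
          (λ x∈ → [ inj₁ , (λ (t , t∈ , t∈x) → inj₂ (t , there t∈ , t∈x)) ]′ (met x∈)) ,
          λ { (here refl) x∈ s∈x → subst (_∈ verts I) (∈-concat-unique uniq v∈ x∈ s∈v s∈x) v∈I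
            ; (there t∈) x∈ t∈x → found t∈ x∈ t∈x }
    ... | no v∉I with insert π (sect v pre) s I e πs∈ s∉ (λ b∈ → inj (lab⊆ b∈) s∈L) (cube ∘ lab⊆)
      where
      lab⊆ : ∀ {b} → b ∈ labels I → b ∈ concat vs
      lab⊆ b∈ with ∈-concat⁻′ (verts I) (∈-resp-↭ (labels↭verts I) b∈)
      ... | x , b∈x , x∈ = ∈-concat⁺′ b∈x (v⊆ x∈)
      s∈L : s ∈ concat vs
      s∈L = ∈-concat⁺′ s∈v v∈
      inj : ∀ {a b} → a ∈ concat vs → b ∈ concat vs → π a ≡ π b → a ≡ b
      inj a∈ b∈ eq′ = trans (sym (cube a∈)) (trans (cong (π ∘ π) eq′) (cube b∈))
      πs∈ : π s ∈ labels I
      πs∈ = ∈-resp-↭ (↭-sym (labels↭verts I)) (∈-concat⁺′ πs∈w w∈I)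
      s∉ : s ∉ labels I
      s∉ s∈I with ∈-concat⁻′ (verts I) (∈-resp-↭ (labels↭verts I) s∈I)
      ... | x , s∈x , x∈ = v∉I (subst (_∈ verts I) (∈-concat-unique uniq (v⊆ x∈) v∈ s∈x s∈v) x∈)
    ... | I′ , sl′ , de , e′ = I′ , trans sl′ sl , e′ , v⊆′ , u′ , fwd (here refl) ,
          (λ x∈ → old (∈-resp-↭ perm x∈)) ,
          λ { (here refl) x∈ s∈x → subst (_∈ verts I′) (∈-concat-unique uniq v∈ x∈ s∈v s∈x) (fwd (here refl))
            ; (there t∈) x∈ t∈x → fwd (there (found t∈ x∈ t∈x)) }
      where
      none : ∀ ss → (∀ {t} → t ∈ ss → t ∉ v) → sect v ss ≡ []
      none ss h = filter-none (_∈? v) (All.tabulate h)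
      -- Since `v` is new, `suf` contains none of its slots. The trail lists the slots of `v` in
      -- order, so `s` is the last of them.
      shape-v : sect v pre ∷ʳ s ≡ v
      shape-v = begin
        sect v pre ++ s ∷ []              ≡⟨ cong (λ ss → sect v pre ++ s ∷ ss) (none suf (λ t∈ t∈v → v∉I (found t∈ v∈ t∈v))) ⟨
        sect v pre ++ s ∷ sect v suf      ≡⟨ cong (sect v pre ++_) (filter-accept (_∈? v) s∈v) ⟨
        sect v pre ++ sect v (s ∷ suf)    ≡⟨ filter-++ (_∈? v) pre (s ∷ suf) ⟨
        sect v (pre ++ s ∷ suf)           ≡⟨ cong (sect v) eq ⟩
        sect v us                         ≡⟨ ordered v∈ ⟩
        v                                 ∎
        where open ≡-Reasoning
      perm : verts I′ ↭ v ∷ verts I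
      perm = ↭-trans (↭-reflexive (cong (_∷ descendants I′) sl′)) (↭-trans (prep _ (↭-trans de (↭-reflexive (cong (_∷ descendants I) shape-v))))
               (swap _ _ ↭-refl))
      v∉ : ∀ {a} → a ∈ v → a ∉ concat (verts I)
      v∉ a∈v a∈ with ∈-concat⁻′ (verts I) a∈
      ... | x , a∈x , x∈ = v∉I (subst (_∈ verts I) (∈-concat-unique uniq (v⊆ x∈) v∈ a∈x a∈v) x∈)
      u′ : Unique (concat (verts I′))
      u′ = unique-resp-↭ (concat-↭ (↭-sym perm)) (UniqP.++⁺ (concat-unique⇒unique uniq v∈) u (λ (p , q) → v∉ p q))
      fwd : ∀ {x} → x ∈ v ∷ verts I → x ∈ verts I′
      fwd = ∈-resp-↭ (↭-sym perm)
      v⊆′ : verts I′ ⊆ vs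
      v⊆′ x∈ with ∈-resp-↭ perm x∈
      ... | here refl = v∈
      ... | there p = v⊆ p
      old : ∀ {x} → x ∈ v ∷ verts I → x ≡ r ⊎ ∃ λ t → t ∈ s ∷ suf × t ∈ x
      old (here refl) = inj₂ (s , here refl , s∈v)
      old (there p) = [ inj₁ , (λ (t , t∈ , t∈x) → inj₂ (t , there t∈ , t∈x)) ]′ (met p)

    finish : ∃ (Discovered r us) → ∃ λ I → slots I ≡ r × verts I ↭ vs × Edges π I
    finish (I , sl , e , v⊆ , u , _ , _ , v⊇) =
      I , sl , unique-set-↭ (concat-unique⇒unique-list u (λ x∈ → nonempty (v⊆ x∈))) (concat-unique⇒unique-list uniq nonempty) v⊆
        (λ { {[]} x∈ → contradiction refl (nonempty x∈)
           ; {a ∷ x} x∈ → v⊇ (∈-resp-↭ (↭-sym covers) (∈-concat⁺′ (here refl) x∈)) x∈ (here refl) }) , e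

-- Uniqueness of the tree for given vertices and given `π`.

∈-flat : ∀ {x y z : A} ts → (x , y , z) ∈ ts → x ∈ flat ts × y ∈ flat ts × z ∈ flat ts
∈-flat (t ∷ ts) (here refl) = here refl , there (here refl) , there (there (here refl))
∈-flat ((_ , _ , _) ∷ ts) (there p) with ∈-flat ts p
... | i , j , k = there (there (there i)) , there (there (there j)) , there (there (there k))

∈-flat⁻ : ∀ {a : A} ts → a ∈ flat ts → ∃ λ t → t ∈ ts × (a ≡ proj₁ t ⊎ a ≡ proj₁ (proj₂ t) ⊎ a ≡ proj₂ (proj₂ t))
∈-flat⁻ (t ∷ ts) (here e) = t , here refl , inj₁ e
∈-flat⁻ (t ∷ ts) (there (here e)) = t , here refl , inj₂ (inj₁ e)
∈-flat⁻ (t ∷ ts) (there (there (here e))) = t , here refl , inj₂ (inj₂ e)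
∈-flat⁻ (t ∷ ts) (there (there (there p))) with ∈-flat⁻ ts p
... | t′ , t′∈ , h = t′ , there t′∈ , h

module _ (π : A → A) where

  -- The test that separates the constructors in `items-unique`: images of last slots of non-root
  -- vertices are filled, while thorns and the lower ends of single edges are not.
  Filled : Items A → A → Set
  Filled I a = a ∈ map proj₂ (ones I) ⊎ a ∈ flat (twos I)

  filled-last : ∀ I J → Edges π J → ones J ⊆ ones I → twos J ⊆ twos I →
    ∀ {x l} → x ∷ʳ l ∈ descendants J → Filled I (π l)
  filled-last I (thorn s K) e o t p = filled-last I K e o t p
  filled-last I (one s l J K) (e , eJ , eK) o t {x} (here eq) with refl ← ∷ʳ-injectiveʳ x (slots J) eq =
    inj₁ (subst (_∈ _) (sym e) (∈-map⁺ proj₂ (o (here refl))))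
  filled-last I (one s l J K) (e , eJ , eK) o t (there p) with ∈-++⁻ (descendants J) p
  ... | inj₁ q = filled-last I J eJ (o ∘ there ∘ ∈-++⁺ˡ) (t ∘ ∈-++⁺ˡ) q
  ... | inj₂ q = filled-last I K eK (o ∘ there ∘ ∈-++⁺ʳ (ones J)) (t ∘ ∈-++⁺ʳ (twos J)) q
  filled-last I (two s l l′ J J′ K) (e , e′ , _) o t {x} (here eq) with refl ← ∷ʳ-injectiveʳ x (slots J) eq =
    inj₂ (subst (_∈ _) (sym e) (proj₂ (proj₂ (∈-flat (twos I) (t (here refl))))))
  filled-last I (two s l l′ J J′ K) (e , e′ , _) o t {x} (there (here eq)) with refl ← ∷ʳ-injectiveʳ x (slots J′) eq =
    inj₂ (subst (_∈ _) (sym e′) (proj₁ (proj₂ (∈-flat (twos I) (t (here refl))))))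
  filled-last I (two s l l′ J J′ K) (e , e′ , eJ , eJ′ , eK) o t (there (there p)) with ∈-++⁻ (descendants J) p
  ... | inj₁ q = filled-last I J eJ (o ∘ ∈-++⁺ˡ) (t ∘ there ∘ ∈-++⁺ˡ) q
  ... | inj₂ q with ∈-++⁻ (descendants J′) q
  ... | inj₁ h = filled-last I J′ eJ′ (o ∘ ∈-++⁺ʳ (ones J) ∘ ∈-++⁺ˡ) (t ∘ there ∘ ∈-++⁺ʳ (twos J) ∘ ∈-++⁺ˡ) h
  ... | inj₂ h = filled-last I K eK (o ∘ ∈-++⁺ʳ (ones J) ∘ ∈-++⁺ʳ (ones J′)) (t ∘ there ∘ ∈-++⁺ʳ (twos J) ∘ ∈-++⁺ʳ (twos J′)) h

  module _ {I : Items A} (u : Unique (labels I)) where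
    private
      parts-unique = unique-++⁻ (thorns I) (unique-resp-↭ (labels↭pieces I) u)
      parts-unique′ = unique-++⁻ (map proj₁ (ones I)) (proj₁ (proj₂ parts-unique))

    thorn-unfilled : ∀ {a} → a ∈ thorns I → ¬ Filled I a
    thorn-unfilled a∈ (inj₁ p) = proj₂ (proj₂ parts-unique) a∈ (∈-++⁺ʳ (map proj₁ (ones I)) (∈-++⁺ˡ p))
    thorn-unfilled a∈ (inj₂ p) = proj₂ (proj₂ parts-unique) a∈ (∈-++⁺ʳ (map proj₁ (ones I)) (∈-++⁺ʳ (map proj₂ (ones I)) p))

    end-unfilled : ∀ {a} → a ∈ map proj₁ (ones I) → ¬ Filled I a
    end-unfilled a∈ (inj₁ p) = proj₂ (proj₂ parts-unique′) a∈ (∈-++⁺ˡ p)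
    end-unfilled a∈ (inj₂ p) = proj₂ (proj₂ parts-unique′) a∈ (∈-++⁺ʳ (map proj₂ (ones I)) p)

  -- The recursion of `items-unique` runs through parts of the two trees, whereas `Filled` and the
  -- comparison of vertices refer to the whole trees. These inclusions connect the two levels.
  record Sub (I J : Items A) : Set where
    field
      thorns⊆ : thorns J ⊆ thorns I
      ones⊆   : ones J ⊆ ones I
      desc⊆   : descendants J ⊆ descendants I
      edges   : Edges π J

  sub-thorn : ∀ {I s K} → Sub I (thorn s K) → Sub I K
  sub-thorn σ = record { thorns⊆ = thorns⊆ ∘ there ; ones⊆ = ones⊆ ; desc⊆ = desc⊆ ; edges = edges }
    where open Sub σ

  sub-one : ∀ {I s l J K} → Sub I (one s l J K) → Sub I J × Sub I K
  sub-one {J = J} σ =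
    record { thorns⊆ = thorns⊆ ∘ ∈-++⁺ˡ ; ones⊆ = ones⊆ ∘ there ∘ ∈-++⁺ˡ
           ; desc⊆ = desc⊆ ∘ there ∘ ∈-++⁺ˡ ; edges = proj₁ (proj₂ edges) } ,
    record { thorns⊆ = thorns⊆ ∘ ∈-++⁺ʳ (thorns J) ; ones⊆ = ones⊆ ∘ there ∘ ∈-++⁺ʳ (ones J)
           ; desc⊆ = desc⊆ ∘ there ∘ ∈-++⁺ʳ (descendants J) ; edges = proj₂ (proj₂ edges) }
    where open Sub σ

  sub-two : ∀ {I s l l′ J J′ K} → Sub I (two s l l′ J J′ K) → Sub I J × Sub I J′ × Sub I K
  sub-two {J = J} {J′} σ =
    record { thorns⊆ = thorns⊆ ∘ ∈-++⁺ˡ ; ones⊆ = ones⊆ ∘ ∈-++⁺ˡ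
           ; desc⊆ = desc⊆ ∘ there ∘ there ∘ ∈-++⁺ˡ ; edges = proj₁ (proj₂ (proj₂ edges)) } ,
    record { thorns⊆ = thorns⊆ ∘ ∈-++⁺ʳ (thorns J) ∘ ∈-++⁺ˡ ; ones⊆ = ones⊆ ∘ ∈-++⁺ʳ (ones J) ∘ ∈-++⁺ˡ
           ; desc⊆ = desc⊆ ∘ there ∘ there ∘ ∈-++⁺ʳ (descendants J) ∘ ∈-++⁺ˡ ; edges = proj₁ (proj₂ (proj₂ (proj₂ edges))) } ,
    record { thorns⊆ = thorns⊆ ∘ ∈-++⁺ʳ (thorns J) ∘ ∈-++⁺ʳ (thorns J′) ; ones⊆ = ones⊆ ∘ ∈-++⁺ʳ (ones J) ∘ ∈-++⁺ʳ (ones J′)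
           ; desc⊆ = desc⊆ ∘ there ∘ there ∘ ∈-++⁺ʳ (descendants J) ∘ ∈-++⁺ʳ (descendants J′) ; edges = proj₂ (proj₂ (proj₂ (proj₂ edges))) }
    where open Sub σ

  module _ {I I′ : Items A} (e : Edges π I) (e′ : Edges π I′) (dp : descendants I ↭ descendants I′)
           (u : Unique (labels I)) (u′ : Unique (labels I′))
           (inj : ∀ {a b} → a ∈ labels I → b ∈ labels I → π a ≡ π b → a ≡ b) where
    private
      d⊆ : descendants I ⊆ descendants I′
      d⊆ = ∈-resp-↭ dp
      d⊇ : descendants I′ ⊆ descendants I
      d⊇ = ∈-resp-↭ (↭-sym dp)

      du : Unique (concat (descendants I))
      du = proj₁ (proj₂ (unique-++⁻ (slots I) (unique-resp-↭ (labels↭verts I) u)))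

      filled : ∀ {x l} → x ∷ʳ l ∈ descendants I′ → Filled I (π l)
      filled p = filled-last I I e id id (d⊇ p)

      filled′ : ∀ {x l} → x ∷ʳ l ∈ descendants I → Filled I′ (π l)
      filled′ p = filled-last I′ I′ e′ id id (d⊆ p)

      last∈ : ∀ {x l} → x ∷ʳ l ∈ descendants I → l ∈ labels I
      last∈ {x} p = ∈-resp-↭ (↭-sym (labels↭verts I))
        (∈-++⁺ʳ (slots I) (∈-concat⁺′ (∈-++⁺ʳ x (here refl)) p))

      last≡ : ∀ {x l x′ l′} → x ∷ʳ l ∈ descendants I → x′ ∷ʳ l′ ∈ descendants I′ → π l ≡ π l′ → l ≡ l′ × x ≡ x′
      last≡ {x} {l} {x′} p p′ eq with refl ← inj (last∈ p) (last∈ (d⊇ p′)) eq =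
        refl , ∷ʳ-injectiveˡ x x′ (∈-concat-unique du p (d⊇ p′) (∈-++⁺ʳ x (here refl)) (∈-++⁺ʳ x′ (here refl)))

    -- The constructor at a slot is forced: whether it carries a child, and whether the last slot of
    -- this child carries another one, is visible from `Filled`. The child itself is forced by
    -- `last≡`, since `π` is injective and a slot lies in one vertex only.
    items-unique : ∀ J J′ → Sub I J → Sub I′ J′ → slots J ≡ slots J′ → J ≡ J′
    items-unique ∅ ∅ σ σ′ sl = refl
    items-unique ∅ (thorn _ _) σ σ′ ()
    items-unique ∅ (one _ _ _ _) σ σ′ ()
    items-unique ∅ (two _ _ _ _ _ _) σ σ′ ()
    items-unique (thorn _ _) ∅ σ σ′ ()
    items-unique (one _ _ _ _) ∅ σ σ′ ()
    items-unique (two _ _ _ _ _ _) ∅ σ σ′ ()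
    items-unique (thorn s K) (thorn s′ K′) σ σ′ sl =
      cong₂ thorn (∷-injectiveˡ sl) (items-unique K K′ (sub-thorn σ) (sub-thorn σ′) (∷-injectiveʳ sl))
    items-unique (thorn s K) (one s′ l J K′) σ σ′ sl with refl ← ∷-injectiveˡ sl =
      contradiction (subst (Filled I) (proj₁ (Sub.edges σ′)) (filled {slots J} (Sub.desc⊆ σ′ (here refl))))
        (thorn-unfilled u (Sub.thorns⊆ σ (here refl)))
    items-unique (thorn s K) (two s′ l l′ J J′ K′) σ σ′ sl with refl ← ∷-injectiveˡ sl =
      contradiction (subst (Filled I) (proj₁ (Sub.edges σ′)) (filled {slots J} (Sub.desc⊆ σ′ (here refl))))
        (thorn-unfilled u (Sub.thorns⊆ σ (here refl)))
    items-unique (one s l J K) (thorn s′ K′) σ σ′ sl with refl ← ∷-injectiveˡ sl =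
      contradiction (subst (Filled I′) (proj₁ (Sub.edges σ)) (filled′ {slots J} (Sub.desc⊆ σ (here refl))))
        (thorn-unfilled u′ (Sub.thorns⊆ σ′ (here refl)))
    items-unique (two s l l′ J J′ K) (thorn s′ K′) σ σ′ sl with refl ← ∷-injectiveˡ sl =
      contradiction (subst (Filled I′) (proj₁ (Sub.edges σ)) (filled′ {slots J} (Sub.desc⊆ σ (here refl))))
        (thorn-unfilled u′ (Sub.thorns⊆ σ′ (here refl)))
    items-unique (one s l J K) (one s′ m L M) σ σ′ sl
      with refl ← ∷-injectiveˡ sl
      with refl , slJ ← last≡ {slots J} {x′ = slots L} (Sub.desc⊆ σ (here refl)) (Sub.desc⊆ σ′ (here refl))
                          (trans (proj₁ (Sub.edges σ)) (sym (proj₁ (Sub.edges σ′))))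
      = cong₂ (one s l) (items-unique J L (proj₁ (sub-one σ)) (proj₁ (sub-one σ′)) slJ)
                        (items-unique K M (proj₂ (sub-one σ)) (proj₂ (sub-one σ′)) (∷-injectiveʳ sl))
    items-unique (one s l J K) (two s′ m m′ L L′ M) σ σ′ sl
      with refl ← ∷-injectiveˡ sl
      with refl , slJ ← last≡ {slots J} {x′ = slots L} (Sub.desc⊆ σ (here refl)) (Sub.desc⊆ σ′ (here refl))
                          (trans (proj₁ (Sub.edges σ)) (sym (proj₁ (Sub.edges σ′))))
      = contradiction (subst (Filled I) (proj₁ (proj₂ (Sub.edges σ′))) (filled {slots L′} (Sub.desc⊆ σ′ (there (here refl)))))
          (end-unfilled u (∈-map⁺ proj₁ (Sub.ones⊆ σ (here refl))))
    items-unique (two s l l′ J J′ K) (one s′ m L M) σ σ′ sl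
      with refl ← ∷-injectiveˡ sl
      with refl , slJ ← last≡ {slots J} {x′ = slots L} (Sub.desc⊆ σ (here refl)) (Sub.desc⊆ σ′ (here refl))
                          (trans (proj₁ (Sub.edges σ)) (sym (proj₁ (Sub.edges σ′))))
      = contradiction (subst (Filled I′) (proj₁ (proj₂ (Sub.edges σ))) (filled′ {slots J′} (Sub.desc⊆ σ (there (here refl)))))
          (end-unfilled u′ (∈-map⁺ proj₁ (Sub.ones⊆ σ′ (here refl))))
    items-unique (two s l l′ J J′ K) (two s′ m m′ L L′ M) σ σ′ sl
      with refl ← ∷-injectiveˡ sl
      with refl , slJ ← last≡ {slots J} {x′ = slots L} (Sub.desc⊆ σ (here refl)) (Sub.desc⊆ σ′ (here refl))
                          (trans (proj₁ (Sub.edges σ)) (sym (proj₁ (Sub.edges σ′))))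
      with refl , slJ′ ← last≡ {slots J′} {x′ = slots L′} (Sub.desc⊆ σ (there (here refl))) (Sub.desc⊆ σ′ (there (here refl)))
                          (trans (proj₁ (proj₂ (Sub.edges σ))) (sym (proj₁ (proj₂ (Sub.edges σ′)))))
      with refl ← items-unique J L (proj₁ (sub-two σ)) (proj₁ (sub-two σ′)) slJ
      with refl ← items-unique J′ L′ (proj₁ (proj₂ (sub-two σ))) (proj₁ (proj₂ (sub-two σ′))) slJ′
      = cong (two s l l′ J J′) (items-unique K M (proj₂ (proj₂ (sub-two σ))) (proj₂ (proj₂ (sub-two σ′))) (∷-injectiveʳ sl))

  tree-unique : ∀ {I I′} → Edges π I → Edges π I′ → slots I ≡ slots I′ → verts I ↭ verts I′ →
    Unique (labels I) → (∀ {a b} → a ∈ labels I → b ∈ labels I → π a ≡ π b → a ≡ b) → I ≡ I′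
  tree-unique {I} {I′} e e′ sl vp u inj =
    items-unique e e′ (drop-∷ (↭-trans vp (↭-reflexive (cong (_∷ descendants I′) (sym sl))))) u u′ inj I I′
      (record { thorns⊆ = id ; ones⊆ = id ; desc⊆ = id ; edges = e })
      (record { thorns⊆ = id ; ones⊆ = id ; desc⊆ = id ; edges = e′ }) sl
    where
    u′ : Unique (labels I′)
    u′ = unique-resp-↭ (↭-trans (labels↭verts I) (↭-trans (concat-↭ vp) (↭-sym (labels↭verts I′)))) u

-- Colours, shapes and canonical labels.

_≟C_ : DecidableEquality Colour
white ≟C white = yes refl
white ≟C black = no λ ()
white ≟C grey = no λ ()
black ≟C white = no λ ()
black ≟C black = yes refl
black ≟C grey = no λ ()
grey ≟C white = no λ ()
grey ≟C black = no λ ()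
grey ≟C grey = yes refl

next³ : ∀ c → next (next (next c)) ≡ c
next³ white = refl
next³ black = refl
next³ grey = refl

next-injective : ∀ {c d} → next c ≡ next d → c ≡ d
next-injective {c} {d} e = trans (sym (next³ c)) (trans (cong (next ∘ next) e) (next³ d))

mapI : (A → B) → Items A → Items B
mapI f ∅ = ∅
mapI f (thorn s K) = thorn (f s) (mapI f K)
mapI f (one s l J K) = one (f s) (f l) (mapI f J) (mapI f K)
mapI f (two s l l′ J J′ K) = two (f s) (f l) (f l′) (mapI f J) (mapI f J′) (mapI f K)

-- Forgetting the labels leaves a thorn cactus tree: `toTree` and `fromTree` translate between
-- shapes and valid plane trees.
Shape : Set
Shape = Items ⊤

shape : Items A → Shape
shape = mapI (λ _ → tt)

module _ (f : A → B) where

  slots-map : ∀ I → slots (mapI f I) ≡ map f (slots I)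
  slots-map ∅ = refl
  slots-map (thorn s K) = cong (f s ∷_) (slots-map K)
  slots-map (one s l J K) = cong (f s ∷_) (slots-map K)
  slots-map (two s l l′ J J′ K) = cong (f s ∷_) (slots-map K)

  private
    snoc-map : ∀ I l → slots (mapI f I) ∷ʳ f l ≡ map f (slots I ∷ʳ l)
    snoc-map I l = trans (cong (_∷ʳ f l) (slots-map I)) (sym (map-++ f (slots I) (l ∷ [])))

  descendants-map : ∀ I → descendants (mapI f I) ≡ map (map f) (descendants I)
  descendants-map ∅ = refl
  descendants-map (thorn s K) = descendants-map K
  descendants-map (one s l J K) = cong₂ _∷_ (snoc-map J l)
    (trans (cong₂ _++_ (descendants-map J) (descendants-map K)) (sym (map-++ _ (descendants J) _)))
  descendants-map (two s l l′ J J′ K) = cong₂ _∷_ (snoc-map J l) (cong₂ _∷_ (snoc-map J′ l′)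
    (trans (cong₂ _++_ (descendants-map J) (trans (cong₂ _++_ (descendants-map J′) (descendants-map K)) (sym (map-++ _ (descendants J′) _))))
           (sym (map-++ _ (descendants J) _))))

  verts-map : ∀ I → verts (mapI f I) ≡ map (map f) (verts I)
  verts-map I = cong₂ _∷_ (slots-map I) (descendants-map I)

  labels-map : ∀ I → labels (mapI f I) ≡ map f (labels I)
  labels-map ∅ = refl
  labels-map (thorn s K) = cong (f s ∷_) (labels-map K)
  labels-map (one s l J K) = cong (λ xs → f s ∷ f l ∷ xs)
    (trans (cong₂ _++_ (labels-map J) (labels-map K)) (sym (map-++ f (labels J) _)))
  labels-map (two s l l′ J J′ K) = cong (λ xs → f s ∷ f l ∷ f l′ ∷ xs)
    (trans (cong₂ _++_ (labels-map J) (trans (cong₂ _++_ (labels-map J′) (labels-map K)) (sym (map-++ f (labels J′) _))))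
           (sym (map-++ f (labels J) _)))

  edges-map : ∀ {π ρ} I → (∀ {a} → a ∈ labels I → f (π a) ≡ ρ (f a)) → Edges π I → Edges ρ (mapI f I)
  edges-map ∅ h e = tt
  edges-map (thorn s K) h e = edges-map K (h ∘ there) e
  edges-map (one s l J K) h (e , eJ , eK) = trans (sym (h (there (here refl)))) (cong f e) ,
    edges-map J (h ∘ there ∘ there ∘ ∈-++⁺ˡ) eJ , edges-map K (h ∘ there ∘ there ∘ ∈-++⁺ʳ (labels J)) eK
  edges-map (two s l l′ J J′ K) h (e , e′ , eJ , eJ′ , eK) =
    trans (sym (h (there (here refl)))) (cong f e) , trans (sym (h (there (there (here refl))))) (cong f e′) ,
    edges-map J (h ∘ there ∘ there ∘ there ∘ ∈-++⁺ˡ) eJ ,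
    edges-map J′ (h ∘ there ∘ there ∘ there ∘ ∈-++⁺ʳ (labels J) ∘ ∈-++⁺ˡ) eJ′ ,
    edges-map K (h ∘ there ∘ there ∘ there ∘ ∈-++⁺ʳ (labels J) ∘ ∈-++⁺ʳ (labels J′)) eK

  edges-map⁻ : ∀ {π ρ} → (∀ {a b} → f a ≡ f b → a ≡ b) → (∀ a → f (π a) ≡ ρ (f a)) → ∀ I → Edges ρ (mapI f I) → Edges π I
  edges-map⁻ inj h ∅ e = tt
  edges-map⁻ inj h (thorn s K) e = edges-map⁻ inj h K e
  edges-map⁻ inj h (one s l J K) (e , eJ , eK) = inj (trans (h l) e) , edges-map⁻ inj h J eJ , edges-map⁻ inj h K eK
  edges-map⁻ inj h (two s l l′ J J′ K) (e , e′ , eJ , eJ′ , eK) =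
    inj (trans (h l) e) , inj (trans (h l′) e′) , edges-map⁻ inj h J eJ , edges-map⁻ inj h J′ eJ′ , edges-map⁻ inj h K eK

  lift-items : ∀ J → (∀ {b} → b ∈ labels J → ∃ λ a → f a ≡ b) → ∃ λ I → mapI f I ≡ J
  lift-items ∅ h = ∅ , refl
  lift-items (thorn s K) h with h (here refl) | lift-items K (h ∘ there)
  ... | s₀ , refl | K₀ , refl = thorn s₀ K₀ , refl
  lift-items (one s l J K) h with h (here refl) | h (there (here refl))
    | lift-items J (h ∘ there ∘ there ∘ ∈-++⁺ˡ) | lift-items K (h ∘ there ∘ there ∘ ∈-++⁺ʳ (labels J))
  ... | s₀ , refl | l₀ , refl | J₀ , refl | K₀ , refl = one s₀ l₀ J₀ K₀ , refl
  lift-items (two s l l′ J J′ K) h with h (here refl) | h (there (here refl)) | h (there (there (here refl)))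
    | lift-items J (h ∘ there ∘ there ∘ there ∘ ∈-++⁺ˡ)
    | lift-items J′ (h ∘ there ∘ there ∘ there ∘ ∈-++⁺ʳ (labels J) ∘ ∈-++⁺ˡ)
    | lift-items K (h ∘ there ∘ there ∘ there ∘ ∈-++⁺ʳ (labels J) ∘ ∈-++⁺ʳ (labels J′))
  ... | s₀ , refl | l₀ , refl | l₁ , refl | J₀ , refl | J₁ , refl | K₀ , refl = two s₀ l₀ l₁ J₀ J₁ K₀ , refl

shape-map : (f : A → B) (I : Items A) → shape (mapI f I) ≡ shape I
shape-map f ∅ = refl
shape-map f (thorn s K) = cong (thorn tt) (shape-map f K)
shape-map f (one s l J K) = cong₂ (one tt tt) (shape-map f J) (shape-map f K)
shape-map f (two s l l′ J J′ K) rewrite shape-map f J | shape-map f J′ | shape-map f K = refl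

Coloured : (A → Colour) → Colour → Items A → Set
Coloured col c ∅ = ⊤
Coloured col c (thorn s K) = col s ≡ c × Coloured col c K
Coloured col c (one s l J K) = col s ≡ c × col l ≡ next c × Coloured col (next c) J × Coloured col c K
Coloured col c (two s l l′ J J′ K) = col s ≡ c × col l ≡ next c × col l′ ≡ next (next c) ×
  Coloured col (next c) J × Coloured col (next (next c)) J′ × Coloured col c K

-- Colour and position in preorder. The position alone identifies a slot of `model`; the colour is
-- kept with it so that colouring is a projection, independent of the tree.
Label : Set
Label = Colour × ℕ

size : Items A → ℕ
size I = length (labels I)

number : Colour → ℕ → Shape → Items Label
number c k ∅ = ∅
number c k (thorn _ K) = thorn (c , k) (number c (suc k) K)
number c k (one _ _ J K) = one (c , k) (next c , suc k) (number (next c) (2 + k) J) (number c (2 + k + size J) K)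
number c k (two _ _ _ J J′ K) = two (c , k) (next c , suc k) (next (next c) , 2 + k)
  (number (next c) (3 + k) J) (number (next (next c)) (3 + k + size J) J′) (number c (3 + k + size J + size J′) K)

upFrom : ℕ → ℕ → List ℕ
upFrom k zero = []
upFrom k (suc n) = k ∷ upFrom (suc k) n

upFrom-++ : ∀ k m n → upFrom k (m + n) ≡ upFrom k m ++ upFrom (k + m) n
upFrom-++ k zero n = cong (λ j → upFrom j n) (sym (ℕP.+-identityʳ k))
upFrom-++ k (suc m) n = cong (k ∷_) (trans (upFrom-++ (suc k) m n) (cong (λ j → upFrom (suc k) m ++ upFrom j n) (sym (ℕP.+-suc k m))))

upFrom-≤ : ∀ {j} k n → j ∈ upFrom k n → k ≤ j
upFrom-≤ k (suc n) (here refl) = ℕP.≤-refl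
upFrom-≤ k (suc n) (there p) = ℕP.<⇒≤ (upFrom-≤ (suc k) n p)

upFrom! : ∀ k n → Unique (upFrom k n)
upFrom! k zero = []
upFrom! k (suc n) = All.tabulate (λ { p refl → ℕP.<-irrefl refl (upFrom-≤ (suc k) n p) }) ∷ upFrom! (suc k) n

labels-number : ∀ c k I → map proj₂ (labels (number c k I)) ≡ upFrom k (size I)
labels-number c k ∅ = refl
labels-number c k (thorn _ K) = cong (k ∷_) (labels-number c (suc k) K)
labels-number c k (one _ _ J K) = cong (λ xs → k ∷ suc k ∷ xs) (begin
  map proj₂ (labels (number (next c) (2 + k) J) ++ _)
    ≡⟨ trans (map-++ proj₂ (labels (number (next c) (2 + k) J)) _)
         (cong₂ _++_ (labels-number (next c) (2 + k) J) (labels-number c (2 + k + size J) K)) ⟩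
  upFrom (2 + k) (size J) ++ upFrom (2 + k + size J) (size K)
    ≡⟨ upFrom-++ (2 + k) (size J) (size K) ⟨
  upFrom (2 + k) (size J + size K)
    ≡⟨ cong (upFrom (2 + k)) (length-++ (labels J)) ⟨
  upFrom (2 + k) (length (labels J ++ labels K)) ∎)
  where open ≡-Reasoning
labels-number c k (two _ _ _ J J′ K) = cong (λ xs → k ∷ suc k ∷ suc (suc k) ∷ xs) (begin
  map proj₂ (labels (number (next c) (3 + k) J) ++ labels (number (next (next c)) (3 + k + size J) J′) ++ _)
    ≡⟨ trans (map-++ proj₂ (labels (number (next c) (3 + k) J)) _)
         (cong₂ _++_ (labels-number (next c) (3 + k) J) (trans (map-++ proj₂ (labels (number (next (next c)) (3 + k + size J) J′)) _)
           (cong₂ _++_ (labels-number (next (next c)) (3 + k + size J) J′) (labels-number c (3 + k + size J + size J′) K)))) ⟩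
  upFrom (3 + k) (size J) ++ upFrom (3 + k + size J) (size J′) ++ upFrom (3 + k + size J + size J′) (size K)
    ≡⟨ cong (upFrom (3 + k) (size J) ++_) (upFrom-++ (3 + k + size J) (size J′) (size K)) ⟨
  upFrom (3 + k) (size J) ++ upFrom (3 + k + size J) (size J′ + size K)
    ≡⟨ upFrom-++ (3 + k) (size J) (size J′ + size K) ⟨
  upFrom (3 + k) (size J + (size J′ + size K))
    ≡⟨ cong (upFrom (3 + k)) (trans (length-++ (labels J)) (cong (size J +_) (length-++ (labels J′)))) ⟨
  upFrom (3 + k) (length (labels J ++ labels J′ ++ labels K)) ∎)
  where open ≡-Reasoning

labels-number! : ∀ I → Unique (labels (number white 0 I))
labels-number! I = UniqP.map⁻ {f = proj₂} (subst Unique (sym (labels-number white 0 I)) (upFrom! 0 (size I)))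

shape-number : ∀ c k I → shape (number c k I) ≡ I
shape-number c k ∅ = refl
shape-number c k (thorn _ K) = cong (thorn tt) (shape-number c (suc k) K)
shape-number c k (one _ _ J K) = cong₂ (one tt tt) (shape-number _ _ J) (shape-number _ _ K)
shape-number c k (two _ _ _ J J′ K)
  rewrite shape-number (next c) (3 + k) J | shape-number (next (next c)) (3 + k + size J) J′
        | shape-number c (3 + k + size J + size J′) K = refl

coloured-number : ∀ c k I → Coloured proj₁ c (number c k I)
coloured-number c k ∅ = tt
coloured-number c k (thorn _ K) = refl , coloured-number c _ K
coloured-number c k (one _ _ J K) = refl , refl , coloured-number _ _ J , coloured-number c _ K
coloured-number c k (two _ _ _ J J′ K) = refl , refl , refl , coloured-number _ _ J , coloured-number _ _ J′ , coloured-number c _ K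

size-shape : (I : Items A) → size (shape I) ≡ size I
size-shape I = trans (cong length (labels-map _ I)) (length-map _ (labels I))

private
  split-upFrom : ∀ (g : A → ℕ) k xs ys → map g (xs ++ ys) ≡ upFrom k (length (xs ++ ys)) →
    map g xs ≡ upFrom k (length xs) × map g ys ≡ upFrom (k + length xs) (length ys)
  split-upFrom g k [] ys e rewrite ℕP.+-identityʳ k = refl , e
  split-upFrom g k (x ∷ xs) ys e with split-upFrom g (suc k) xs ys (∷-injectiveʳ e)
  ... | p , q = cong₂ _∷_ (∷-injectiveˡ e) p , trans q (cong (λ j → upFrom j (length ys)) (sym (ℕP.+-suc k (length xs))))

-- A canonical label records only colour and preorder position, and both are determined by the
-- shape. Hence a tree with slots of any kind, once relabelled this way, becomes the canonical one.
renumber : (col : A → Colour) (g : A → ℕ) → ∀ c k I → Coloured col c I → map g (labels I) ≡ upFrom k (size I) →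
  mapI (λ a → col a , g a) I ≡ number c k (shape I)
renumber col g c k ∅ cl e = refl
renumber col g c k (thorn s K) (refl , cl) e =
  cong₂ thorn (cong (col s ,_) (∷-injectiveˡ e)) (renumber col g c (suc k) K cl (∷-injectiveʳ e))
renumber col g c k (one s l J K) (refl , cl , clJ , clK) e
  with split-upFrom g (2 + k) (labels J) (labels K) (∷-injectiveʳ (∷-injectiveʳ e))
... | eJ , eK rewrite cl | ∷-injectiveˡ e | ∷-injectiveˡ (∷-injectiveʳ e) | size-shape J
  = cong₂ (one _ _) (renumber col g _ (2 + k) J clJ eJ) (renumber col g c (2 + k + size J) K clK eK)
renumber col g c k (two s l l′ J J′ K) (refl , cl , cl′ , clJ , clJ′ , clK) e
  with split-upFrom g (3 + k) (labels J) (labels J′ ++ labels K) (∷-injectiveʳ (∷-injectiveʳ (∷-injectiveʳ e)))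
... | eJ , e′ with split-upFrom g (3 + k + size J) (labels J′) (labels K) e′
... | eJ′ , eK
  rewrite cl | cl′ | ∷-injectiveˡ e | ∷-injectiveˡ (∷-injectiveʳ e) | ∷-injectiveˡ (∷-injectiveʳ (∷-injectiveʳ e))
        | size-shape J | size-shape J′
        | renumber col g _ (3 + k) J clJ eJ | renumber col g _ (3 + k + size J) J′ clJ′ eJ′
        | renumber col g c (3 + k + size J + size J′) K clK eK = refl

module _ (_≟_ : DecidableEquality A) where

  index : List A → A → ℕ
  index [] a = 0
  index (x ∷ xs) a with a ≟ x
  ... | yes _ = 0
  ... | no _ = suc (index xs a)

  private
    index-here : ∀ x xs → index (x ∷ xs) x ≡ 0
    index-here x xs with x ≟ x
    ... | yes _ = refl
    ... | no ne = contradiction refl ne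

    index-there : ∀ {x a} xs → x ≢ a → index (x ∷ xs) a ≡ suc (index xs a)
    index-there {x} {a} xs ne with a ≟ x
    ... | yes refl = contradiction refl ne
    ... | no _ = refl

    suc-upFrom : ∀ k n → map suc (upFrom k n) ≡ upFrom (suc k) n
    suc-upFrom k zero = refl
    suc-upFrom k (suc n) = cong (suc k ∷_) (suc-upFrom (suc k) n)

  map-index : ∀ xs → Unique xs → map (index xs) xs ≡ upFrom 0 (length xs)
  map-index [] [] = refl
  map-index (x ∷ xs) (x∉ ∷ u) = cong₂ _∷_ (index-here x xs) (begin
    map (index (x ∷ xs)) xs   ≡⟨ map-cong-local (All.map (index-there xs) x∉) ⟩
    map (suc ∘ index xs) xs   ≡⟨ map-∘ xs ⟩
    map suc (map (index xs) xs) ≡⟨ cong (map suc) (map-index xs u) ⟩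
    map suc (upFrom 0 (length xs)) ≡⟨ suc-upFrom 0 (length xs) ⟩
    upFrom 1 (length xs) ∎)
    where open ≡-Reasoning

  index-injective : ∀ xs {a b} → a ∈ xs → b ∈ xs → index xs a ≡ index xs b → a ≡ b
  index-injective (x ∷ xs) {a} {b} p q e with a ≟ x | b ≟ x
  ... | yes refl | yes refl = refl
  ... | no a≢x | no b≢x with p | q
  ... | here refl | _ = contradiction refl a≢x
  ... | there _ | here refl = contradiction refl b≢x
  ... | there p′ | there q′ = index-injective xs p′ q′ (ℕP.suc-injective e)

-- Counting slots colour by colour.

module _ {A : Set} (col : A → Colour) where

  ones-coloured : ∀ c I → Coloured col c I → All (λ (l , s) → col l ≡ next (col s)) (ones I)
  ones-coloured c ∅ cl = []
  ones-coloured c (thorn s K) (_ , cl) = ones-coloured c K cl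
  ones-coloured c (one s l J K) (p , q , clJ , clK) =
    trans q (cong next (sym p)) ∷ AllP.++⁺ (ones-coloured _ J clJ) (ones-coloured c K clK)
  ones-coloured c (two s l l′ J J′ K) (p , q , r , clJ , clJ′ , clK) =
    AllP.++⁺ (ones-coloured _ J clJ) (AllP.++⁺ (ones-coloured _ J′ clJ′) (ones-coloured c K clK))

  twos-coloured : ∀ c I → Coloured col c I →
    All (λ (l′ , l , s) → col l ≡ next (col s) × col l′ ≡ next (col l)) (twos I)
  twos-coloured c ∅ cl = []
  twos-coloured c (thorn s K) (_ , cl) = twos-coloured c K cl
  twos-coloured c (one s l J K) (p , q , clJ , clK) = AllP.++⁺ (twos-coloured _ J clJ) (twos-coloured c K clK)
  twos-coloured c (two s l l′ J J′ K) (p , q , r , clJ , clJ′ , clK) =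
    (trans q (cong next (sym p)) , trans r (cong next (sym q))) ∷
    AllP.++⁺ (twos-coloured _ J clJ) (AllP.++⁺ (twos-coloured _ J′ clJ′) (twos-coloured c K clK))

  ofCol : Colour → List A → List A
  ofCol q = filter (λ a → col a ≟C q)

  upper : Colour → List (A × A) → List (A × A)
  upper q = filter (λ e → col (proj₂ e) ≟C q)

  length-ofCol-upper : ∀ q es → length (ofCol q (map proj₂ es)) ≡ length (upper q es)
  length-ofCol-upper q [] = refl
  length-ofCol-upper q ((l , s) ∷ es) with col s ≟C q
  ... | yes p = cong suc (length-ofCol-upper q es)
  ... | no p = length-ofCol-upper q es

  length-ofCol-lower : ∀ q es → All (λ (l , s) → col l ≡ next (col s)) es →
    length (ofCol (next q) (map proj₁ es)) ≡ length (upper q es)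
  length-ofCol-lower q [] [] = refl
  length-ofCol-lower q ((l , s) ∷ es) (p ∷ ps) with col l ≟C next q | col s ≟C q
  ... | yes _ | yes _ = cong suc (length-ofCol-lower q es ps)
  ... | no _ | no _ = length-ofCol-lower q es ps
  ... | yes a | no b = contradiction (next-injective (trans (sym p) a)) b
  ... | no a | yes b = contradiction (trans p (cong next b)) a

  -- Along a triangle the colour advances by `next` twice, so each triple meets every colour once.
  length-ofCol-flat : ∀ q ts → All (λ (l′ , l , s) → col l ≡ next (col s) × col l′ ≡ next (col l)) ts →
    length (ofCol q (flat ts)) ≡ length ts
  length-ofCol-flat q [] [] = refl
  length-ofCol-flat q ((l′ , l , s) ∷ ts) ((p , p′) ∷ ps) = begin
    length (ofCol q (l′ ∷ l ∷ s ∷ flat ts))                                   ≡⟨ cons l′ _ ⟩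
    δ (col l′) + length (ofCol q (l ∷ s ∷ flat ts))                           ≡⟨ cong (δ (col l′) +_) (trans (cons l _) (cong (δ (col l) +_) (cons s _))) ⟩
    δ (col l′) + (δ (col l) + (δ (col s) + length (ofCol q (flat ts))))       ≡⟨ cong (λ m → δ (col l′) + (δ (col l) + (δ (col s) + m))) (length-ofCol-flat q ts ps) ⟩
    δ (col l′) + (δ (col l) + (δ (col s) + length ts))                        ≡⟨ cong₂ (λ d e → δ d + (δ e + (δ (col s) + length ts))) (trans p′ (cong next p)) p ⟩
    δ (next (next (col s))) + (δ (next (col s)) + (δ (col s) + length ts))    ≡⟨ once (col s) q ⟩
    suc (length ts)                                                           ∎
    where
    open ≡-Reasoning
    δ : Colour → ℕ
    δ d = if ⌊ d ≟C q ⌋ then 1 else 0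
    cons : ∀ a xs → length (ofCol q (a ∷ xs)) ≡ δ (col a) + length (ofCol q xs)
    cons a xs with col a ≟C q
    ... | yes _ = refl
    ... | no _ = refl
    once : ∀ d q {m} → (if ⌊ next (next d) ≟C q ⌋ then 1 else 0) + ((if ⌊ next d ≟C q ⌋ then 1 else 0) + ((if ⌊ d ≟C q ⌋ then 1 else 0) + m)) ≡ suc m
    once white white = refl
    once white black = refl
    once white grey = refl
    once black white = refl
    once black black = refl
    once black grey = refl
    once grey white = refl
    once grey black = refl
    once grey grey = refl

filter-colours : {X : Set} (f : X → Colour) (xs : List X) →
  xs ↭ filter (λ x → f x ≟C white) xs ++ filter (λ x → f x ≟C black) xs ++ filter (λ x → f x ≟C grey) xs
filter-colours f [] = ↭-refl
filter-colours f (x ∷ xs) with f x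
... | white = prep x (filter-colours f xs)
... | black = ↭-trans (prep x (filter-colours f xs)) (↭-sym (shift x (filter (λ x → f x ≟C white) xs) _))
... | grey = ↭-trans (prep x (filter-colours f xs))
  (↭-trans (↭-sym (shift x (filter (λ x → f x ≟C white) xs) _))
    (++⁺ˡ (filter (λ x → f x ≟C white) xs) (↭-sym (shift x (filter (λ x → f x ≟C black) xs) _))))

-- Permutations of order three given by their orbits.

join : List (A × A) → List A → List (A × A × A)
join ((l , s) ∷ es) (z ∷ zs) = (l , s , z) ∷ join es zs
join _ _ = []

join₃ : List A → List A → List A → List (A × A × A)
join₃ (w ∷ ws) (g ∷ gs) (b ∷ bs) = (w , g , b) ∷ join₃ ws gs bs
join₃ _ _ _ = []

module _ {A : Set} where
  open CMSolver (PermP.++-commutativeMonoid {A = A}) using (solve; _⊕_; _⊜_)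

  flat-join : (es : List (A × A)) (zs : List A) → length zs ≡ length es →
    flat (join es zs) ↭ map proj₁ es ++ map proj₂ es ++ zs
  flat-join [] [] e = ↭-refl
  flat-join ((l , s) ∷ es) (z ∷ zs) e = ↭-trans (prep l (prep s (prep z (flat-join es zs (ℕP.suc-injective e)))))
    (solve 6 (λ l s z a b c → l ⊕ (s ⊕ (z ⊕ (a ⊕ (b ⊕ c)))) ⊜ l ⊕ (a ⊕ (s ⊕ (b ⊕ (z ⊕ c))))) ↭-refl
      (l ∷ []) (s ∷ []) (z ∷ []) (map proj₁ es) (map proj₂ es) zs)

  flat-join₃ : (ws gs bs : List A) → length gs ≡ length ws → length bs ≡ length ws →
    flat (join₃ ws gs bs) ↭ ws ++ gs ++ bs
  flat-join₃ [] [] [] e e′ = ↭-refl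
  flat-join₃ (w ∷ ws) (g ∷ gs) (b ∷ bs) e e′ =
    ↭-trans (prep w (prep g (prep b (flat-join₃ ws gs bs (ℕP.suc-injective e) (ℕP.suc-injective e′)))))
    (solve 6 (λ l s z a b c → l ⊕ (s ⊕ (z ⊕ (a ⊕ (b ⊕ c)))) ⊜ l ⊕ (a ⊕ (s ⊕ (b ⊕ (z ⊕ c))))) ↭-refl
      (w ∷ []) (g ∷ []) (b ∷ []) ws gs bs)

Orbit : (A → A) → A × A × A → Set
Orbit π (x , y , z) = π x ≡ y × π y ≡ z × π z ≡ x

module _ (_≟_ : DecidableEquality A) where

  -- Slots outside all triples are fixed. The first matching triple decides, so the triples become
  -- orbits only when `flat ts` has no repetitions.
  rotate : List (A × A × A) → A → A
  rotate [] a = a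
  rotate ((x , y , z) ∷ ts) a with a ≟ x | a ≟ y | a ≟ z
  ... | yes _ | _ | _ = y
  ... | no _ | yes _ | _ = z
  ... | no _ | no _ | yes _ = x
  ... | no _ | no _ | no _ = rotate ts a

  rotate-skip : ∀ {x y z a} ts → a ≢ x → a ≢ y → a ≢ z → rotate ((x , y , z) ∷ ts) a ≡ rotate ts a
  rotate-skip {x} {y} {z} {a} ts p q r with a ≟ x | a ≟ y | a ≟ z
  ... | yes e | _ | _ = contradiction e p
  ... | no _ | yes e | _ = contradiction e q
  ... | no _ | no _ | yes e = contradiction e r
  ... | no _ | no _ | no _ = refl

  rotate-orbits : ∀ ts → Unique (flat ts) → ∀ {t} → t ∈ ts → Orbit (rotate ts) t
  rotate-orbits ((x , y , z) ∷ ts) (x∉ ∷ y∉ ∷ z∉ ∷ u) (here refl) = px , py , pz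
    where
    px : rotate ((x , y , z) ∷ ts) x ≡ y
    px with x ≟ x
    ... | yes _ = refl
    ... | no ne = contradiction refl ne
    py : rotate ((x , y , z) ∷ ts) y ≡ z
    py with y ≟ x | y ≟ y
    ... | yes refl | _ = contradiction refl (All.lookup x∉ (here refl))
    ... | no _ | yes _ = refl
    ... | no _ | no ne = contradiction refl ne
    pz : rotate ((x , y , z) ∷ ts) z ≡ x
    pz with z ≟ x | z ≟ y | z ≟ z
    ... | yes refl | _ | _ = contradiction refl (All.lookup x∉ (there (here refl)))
    ... | no _ | yes refl | _ = contradiction refl (All.lookup y∉ (here refl))
    ... | no _ | no _ | yes _ = refl
    ... | no _ | no _ | no ne = contradiction refl ne
  rotate-orbits ((x , y , z) ∷ ts) (x∉ ∷ y∉ ∷ z∉ ∷ u) {a , b , c} (there t∈)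
    with rotate-orbits ts u t∈ | ∈-flat ts t∈
  ... | p , q , r | a∈ , b∈ , c∈ = trans (skip a∈) p , trans (skip b∈) q , trans (skip c∈) r
    where
    skip : ∀ {d} → d ∈ flat ts → rotate ((x , y , z) ∷ ts) d ≡ rotate ts d
    skip d∈ = rotate-skip ts (λ { refl → All.lookup x∉ (there (there d∈)) refl })
      (λ { refl → All.lookup y∉ (there d∈) refl }) (λ { refl → All.lookup z∉ d∈ refl })

  orbits-cube : ∀ {π : A → A} ts → (∀ {t} → t ∈ ts → Orbit π t) → ∀ {a} → a ∈ flat ts → π (π (π a)) ≡ a
  orbits-cube {π} ts o a∈ with ∈-flat⁻ ts a∈
  ... | t , t∈ , h with o t∈ | h
  ... | p , q , r | inj₁ refl = trans (cong (π ∘ π) p) (trans (cong π q) r)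
  ... | p , q , r | inj₂ (inj₁ refl) = trans (cong (π ∘ π) q) (trans (cong π r) p)
  ... | p , q , r | inj₂ (inj₂ refl) = trans (cong (π ∘ π) r) (trans (cong π p) q)

  orbits-closed : ∀ {π : A → A} ts → (∀ {t} → t ∈ ts → Orbit π t) → ∀ {a} → a ∈ flat ts → π a ∈ flat ts
  orbits-closed ts o a∈ with ∈-flat⁻ ts a∈
  ... | t , t∈ , h with o t∈ | ∈-flat ts t∈ | h
  ... | p , q , r | x , y , z | inj₁ refl = subst (_∈ flat ts) (sym p) y
  ... | p , q , r | x , y , z | inj₂ (inj₁ refl) = subst (_∈ flat ts) (sym q) z
  ... | p , q , r | x , y , z | inj₂ (inj₂ refl) = subst (_∈ flat ts) (sym r) x

  orbits-agree : ∀ {π ρ : A → A} ts → (∀ {t} → t ∈ ts → Orbit π t) → (∀ {t} → t ∈ ts → Orbit ρ t) →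
    ∀ {a} → a ∈ flat ts → π a ≡ ρ a
  orbits-agree ts o o′ a∈ with ∈-flat⁻ ts a∈
  ... | t , t∈ , h with o t∈ | o′ t∈ | h
  ... | p , q , r | p′ , q′ , r′ | inj₁ refl = trans p (sym p′)
  ... | p , q , r | p′ , q′ , r′ | inj₂ (inj₁ refl) = trans q (sym q′)
  ... | p , q , r | p′ , q′ , r′ | inj₂ (inj₂ refl) = trans r (sym r′)

-- The completing slots are the images of the upper ends. Together with `join₃-orbit` this makes the
-- coding of a rotation by chosen thorns injective.
join-orbit : ∀ {π : A → A} es zs → length zs ≡ length es → (∀ {t} → t ∈ join es zs → Orbit π t) → zs ≡ map (π ∘ proj₂) es
join-orbit [] [] e o = refl
join-orbit (_ ∷ es) (z ∷ zs) e o =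
  cong₂ _∷_ (sym (proj₁ (proj₂ (o (here refl))))) (join-orbit es zs (ℕP.suc-injective e) (o ∘ there))

join₃-orbit : ∀ {π : A → A} ws gs bs → length gs ≡ length ws → length bs ≡ length ws →
  (∀ {t} → t ∈ join₃ ws gs bs → Orbit π t) → gs ≡ map π ws × bs ≡ map π (map π ws)
join₃-orbit [] [] [] e e′ o = refl , refl
join₃-orbit (w ∷ ws) (g ∷ gs) (b ∷ bs) e e′ o
  with o (here refl) | join₃-orbit ws gs bs (ℕP.suc-injective e) (ℕP.suc-injective e′) (o ∘ there)
... | refl , refl , _ | refl , refl = refl , refl

∈-join : ∀ {π : A → A} es → All (λ (l , s) → π l ≡ s × π (π s) ≡ l) es →
  ∀ {t} → t ∈ join es (map (π ∘ proj₂) es) → Orbit π t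
∈-join (_ ∷ es) ((p , q) ∷ _) (here refl) = p , refl , q
∈-join (_ ∷ es) (_ ∷ ps) (there t∈) = ∈-join es ps t∈

∈-join₃ : ∀ {π : A → A} ws → All (λ w → π (π (π w)) ≡ w) ws →
  ∀ {t} → t ∈ join₃ ws (map π ws) (map π (map π ws)) → Orbit π t
∈-join₃ (_ ∷ ws) (p ∷ _) (here refl) = refl , refl , p
∈-join₃ (_ ∷ ws) (_ ∷ ps) (there t∈) = ∈-join₃ ws ps t∈

-- Along `π` colours run against `next`, because the last slot of a child is sent to a slot of its
-- parent.
Turned : (A → Colour) → A × A × A → Set
Turned col (x , y , z) = next (col y) ≡ col x × next (col z) ≡ col y × next (col x) ≡ col z

orbits-turn : ∀ {π : A → A} (col : A → Colour) ts → (∀ {t} → t ∈ ts → Orbit π t) → (∀ {t} → t ∈ ts → Turned col t) →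
  ∀ {a} → a ∈ flat ts → next (col (π a)) ≡ col a
orbits-turn col ts o tu a∈ with ∈-flat⁻ ts a∈
... | t , t∈ , h with o t∈ | tu t∈ | h
... | p , q , r | x , y , z | inj₁ refl = trans (cong (next ∘ col) p) x
... | p , q , r | x , y , z | inj₂ (inj₁ refl) = trans (cong (next ∘ col) q) y
... | p , q , r | x , y , z | inj₂ (inj₂ refl) = trans (cong (next ∘ col) r) z

∈-join⁺ : ∀ {l s : A} es zs → length zs ≡ length es → (l , s) ∈ es → ∃ λ z → (l , s , z) ∈ join es zs
∈-join⁺ (_ ∷ es) (z ∷ zs) e (here refl) = z , here refl
∈-join⁺ (_ ∷ es) (z ∷ zs) e (there p) with ∈-join⁺ es zs (ℕP.suc-injective e) p
... | z′ , q = z′ , there q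

∈-join⁻ : ∀ {l s z : A} es zs → (l , s , z) ∈ join es zs → (l , s) ∈ es × z ∈ zs
∈-join⁻ (_ ∷ es) (z ∷ zs) (here refl) = here refl , here refl
∈-join⁻ (_ ∷ es) (z ∷ zs) (there p) with ∈-join⁻ es zs p
... | q , r = there q , there r

∈-join₃⁻ : ∀ {w g b : A} ws gs bs → (w , g , b) ∈ join₃ ws gs bs → w ∈ ws × g ∈ gs × b ∈ bs
∈-join₃⁻ (_ ∷ ws) (_ ∷ gs) (_ ∷ bs) (here refl) = here refl , here refl , here refl
∈-join₃⁻ (_ ∷ ws) (_ ∷ gs) (_ ∷ bs) (there p) with ∈-join₃⁻ ws gs bs p
... | q , r , t = there q , there r , there t

-- Completing the orbits that the tree shows only in part.

module Completion {A : Set} (_≟_ : DecidableEquality A) (col : A → Colour)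
  (I : Items A) {c₀ : Colour} (cl : Coloured col c₀ I) (u : Unique (labels I)) where
  open DecMem _≟_ using (_∈?_)
  open CMSolver (PermP.++-commutativeMonoid {A = A}) using (solve; _⊕_; _⊜_)

  S# : Colour → List A
  S# q = ofCol col q (thorns I)

  -- Edges are classified by the colour of the parent. The missing third slot of an edge in
  -- `E# (next q)` has colour `q`, which decides the thorns it may be completed with.
  E# : Colour → List (A × A)
  E# q = upper col q (ones I)

  rest : List A → List A
  rest zW = filter (λ a → ¬? (a ∈? zW)) (S# white)

  -- The choices `χ`, `σ₁`, `σ₂` as lists of slots. By their lengths, `zG` and `zB` are orderings of
  -- all grey and all black thorns, while `zW` takes only one white thorn for each edge with a black
  -- parent.
  record Codes (zW zG zB : List A) : Set where
    field
      zW! : Unique zW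
      zG! : Unique zG
      zB! : Unique zB
      zW⊆ : zW ⊆ S# white
      zG⊆ : zG ⊆ S# grey
      zB⊆ : zB ⊆ S# black
      |zW| : length zW ≡ length (E# black)
      |zG| : length zG ≡ length (S# grey)
      |zB| : length zB ≡ length (S# black)

  -- The triangles of the tree, the edges of the tree completed by zW, zG and zB, and the orbits containing no edge.
  cycles : List A → List A → List A → List (A × A × A)
  cycles zW zG zB = twos I ++ join (E# black) zW ++
    join (E# white) (take (length (E# white)) zG) ++ join (E# grey) (take (length (E# grey)) zB) ++
    join₃ (rest zW) (drop (length (E# white)) zG) (drop (length (E# grey)) zB)

  -- The two middle terms are the two ways of lying on a single edge: as the end at the child, whose
  -- parent then has colour `q`, or as the end at the parent.
  |L| : ∀ q → length (ofCol col (next q) (labels I)) ≡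
    length (S# (next q)) + (length (E# q) + (length (E# (next q)) + length (twos I)))
  |L| q = begin
    length (F (labels I))
      ≡⟨ ↭-length (filter-↭ (λ a → col a ≟C next q) (labels↭pieces I)) ⟩
    length (F (thorns I ++ map proj₁ (ones I) ++ map proj₂ (ones I) ++ flat (twos I)))
      ≡⟨ len-++ (thorns I) _ ⟩
    length (S# (next q)) + length (F (map proj₁ (ones I) ++ map proj₂ (ones I) ++ flat (twos I)))
      ≡⟨ cong (length (S# (next q)) +_) (trans (len-++ (map proj₁ (ones I)) _)
          (cong₂ _+_ (length-ofCol-lower col q (ones I) (ones-coloured col c₀ I cl)) (trans (len-++ (map proj₂ (ones I)) _)
             (cong₂ _+_ (length-ofCol-upper col (next q) (ones I)) (length-ofCol-flat col (next q) (twos I) (twos-coloured col c₀ I cl)))))) ⟩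
    _ ∎
    where
    open ≡-Reasoning
    F = ofCol col (next q)
    len-++ : ∀ xs ys → length (F (xs ++ ys)) ≡ length (F xs) + length (F ys)
    len-++ xs ys = trans (cong length (filter-++ _ xs ys)) (length-++ (F xs))

  module _ {n} (bal : ∀ q → length (ofCol col q (labels I)) ≡ n) where

    private
      arrange : ∀ a b c d → a + b + (c + d) ≡ a + (c + (b + d))
      arrange = +-*-Solver.solve 4 (λ a b c d → a :+ b :+ (c :+ d) := a :+ (c :+ (b :+ d))) refl
        where open +-*-Solver using (_:+_; _:=_)

    -- Two instances of `|L|` with the same total n are compared; the triangles and one class of
    -- edges cancel.
    SW+EW : length (S# white) + length (E# white) ≡ length (S# grey) + length (E# black)
    SW+EW = ℕP.+-cancelʳ-≡ (length (E# grey) + length (twos I)) _ _ (begin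
      sw + ew + (eg + t)     ≡⟨ arrange sw ew eg t ⟩
      sw + (eg + (ew + t))   ≡⟨ |L| grey ⟨
      _                      ≡⟨ trans (bal white) (sym (bal grey)) ⟩
      _                      ≡⟨ |L| black ⟩
      sg + (eb + (eg + t))   ≡⟨ ℕP.+-assoc sg eb (eg + t) ⟨
      sg + eb + (eg + t)     ∎)
      where
      open ≡-Reasoning
      sw = length (S# white)
      sg = length (S# grey)
      ew = length (E# white)
      eg = length (E# grey)
      eb = length (E# black)
      t = length (twos I)

    SB+EB : length (S# black) + length (E# black) ≡ length (S# white) + length (E# grey)
    SB+EB = ℕP.+-cancelʳ-≡ (length (E# white) + length (twos I)) _ _ (begin
      sb + eb + (ew + t)     ≡⟨ arrange sb eb ew t ⟩
      sb + (ew + (eb + t))   ≡⟨ |L| white ⟨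
      _                      ≡⟨ trans (bal black) (sym (bal white)) ⟩
      _                      ≡⟨ |L| grey ⟩
      sw + (eg + (ew + t))   ≡⟨ ℕP.+-assoc sw eg (ew + t) ⟨
      sw + eg + (ew + t)     ∎)
      where
      open ≡-Reasoning
      sw = length (S# white)
      sb = length (S# black)
      ew = length (E# white)
      eg = length (E# grey)
      eb = length (E# black)
      t = length (twos I)

    thorns! : Unique (thorns I)
    thorns! = proj₁ (unique-++⁻ (thorns I) (unique-resp-↭ (labels↭pieces I) u))

    rest-↭ : ∀ {zW} → Unique zW → zW ⊆ S# white → zW ++ rest zW ↭ S# white
    rest-↭ {zW} z! z⊆ = unique-set-↭
      (UniqP.++⁺ z! (UniqP.filter⁺ _ (UniqP.filter⁺ _ thorns!)) (λ (p , q) → proj₂ (∈-filter⁻ (λ a → ¬? (a ∈? zW)) {xs = S# white} q) p))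
      (UniqP.filter⁺ _ thorns!)
      (λ a∈ → [ z⊆ , (λ p → proj₁ (∈-filter⁻ (λ a → ¬? (a ∈? zW)) p)) ]′ (∈-++⁻ zW a∈))
      (λ {a} a∈ → case a ∈? zW of λ { (yes p) → ∈-++⁺ˡ p ; (no p) → ∈-++⁺ʳ zW (∈-filter⁺ _ a∈ p) })

    -- Grey thorns complete the edges with white parents and continue the white thorns left over by
    -- `zW`; black thorns complete the edges with grey parents and close the same left-over orbits.
    -- The counts agree by `SW+EW` and `SB+EB`, so `cycles` neither lacks a thorn nor loses one.
    |rest| : ∀ {zW} → Unique zW → zW ⊆ S# white → length zW ≡ length (E# black) →
      length (E# white) + length (rest zW) ≡ length (S# grey) × length (E# grey) + length (rest zW) ≡ length (S# black)
    |rest| {zW} z! z⊆ |z| =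
      ℕP.+-cancelʳ-≡ (length (E# black)) _ _ (trans (arr (length (E# white)) (length (rest zW)) (length (E# black)))
        (trans (cong (_+ length (E# white)) sw) SW+EW)) ,
      ℕP.+-cancelʳ-≡ (length (E# black)) _ _ (trans (arr (length (E# grey)) (length (rest zW)) (length (E# black)))
        (trans (cong (_+ length (E# grey)) sw) (sym SB+EB)))
      where
      sw : length (E# black) + length (rest zW) ≡ length (S# white)
      sw = trans (cong (_+ length (rest zW)) (sym |z|)) (trans (sym (length-++ zW)) (↭-length (rest-↭ z! z⊆)))
      arr : ∀ a b c → a + b + c ≡ c + b + a
      arr = +-*-Solver.solve 3 (λ a b c → a :+ b :+ c := c :+ b :+ a) refl
        where open +-*-Solver using (_:+_; _:=_)

    module _ {zW zG zB} (codes : Codes zW zG zB) where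
      open Codes codes

      private
        kW = length (E# white)
        kG = length (E# grey)

        take-len : ∀ k (zs : List A) {m r : ℕ} → length zs ≡ m → k + r ≡ m → length (take k zs) ≡ k × length (drop k zs) ≡ r
        take-len k zs {m} {r} refl e =
          trans (length-take k zs) (ℕP.m≤n⇒m⊓n≡m (subst (k ≤_) e (ℕP.m≤m+n k r))) ,
          trans (length-drop k zs) (trans (cong (_∸ k) (sym e)) (ℕP.m+n∸m≡n k r))

        lG = take-len kW zG |zG| (proj₁ (|rest| zW! zW⊆ |zW|))
        lB = take-len kG zB |zB| (proj₂ (|rest| zW! zW⊆ |zW|))

        zG↭ : take kW zG ++ drop kW zG ↭ S# grey
        zG↭ = ↭-trans (↭-reflexive (take++drop≡id kW zG)) (unique-⊆-↭ zG! zG⊆ (ℕP.≤-reflexive (sym |zG|)))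

        zB↭ : take kG zB ++ drop kG zB ↭ S# black
        zB↭ = ↭-trans (↭-reflexive (take++drop≡id kG zB)) (unique-⊆-↭ zB! zB⊆ (ℕP.≤-reflexive (sym |zB|)))

        map-E : ∀ (f : A × A → A) → map f (E# white) ++ map f (E# black) ++ map f (E# grey) ↭ map f (ones I)
        map-E f = ↭-trans (↭-reflexive (sym (trans (map-++ f (E# white) _) (cong (map f (E# white) ++_) (map-++ f (E# black) _)))))
                    (PermP.map⁺ f (↭-sym (filter-colours (col ∘ proj₂) (ones I))))

      flat-cycles : flat (cycles zW zG zB) ↭ labels I
      flat-cycles = begin
        flat (cycles zW zG zB)
          ≡⟨ trans (flat-++ (twos I) _) (cong (flat (twos I) ++_) (trans (flat-++ (join (E# black) zW) _)
               (cong (flat (join (E# black) zW) ++_) (trans (flat-++ (join (E# white) (take kW zG)) _)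
                 (cong (flat (join (E# white) (take kW zG)) ++_) (flat-++ (join (E# grey) (take kG zB)) _)))))) ⟩
        flat (twos I) ++ flat (join (E# black) zW) ++ flat (join (E# white) (take kW zG)) ++ flat (join (E# grey) (take kG zB)) ++
          flat (join₃ (rest zW) (drop kW zG) (drop kG zB))
          ↭⟨ ++⁺ˡ (flat (twos I)) (PermP.++⁺ (flat-join (E# black) zW |zW|) (PermP.++⁺ (flat-join (E# white) _ (proj₁ lG))
               (PermP.++⁺ (flat-join (E# grey) _ (proj₁ lB)) (flat-join₃ (rest zW) _ _ (proj₂ lG) (proj₂ lB))))) ⟩
        flat (twos I) ++ (map proj₁ (E# black) ++ map proj₂ (E# black) ++ zW) ++ (map proj₁ (E# white) ++ map proj₂ (E# white) ++ take kW zG) ++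
          (map proj₁ (E# grey) ++ map proj₂ (E# grey) ++ take kG zB) ++ (rest zW ++ drop kW zG ++ drop kG zB)
          ↭⟨ solve 13 (λ t b₁ b₂ z w₁ w₂ x g₁ g₂ y r x′ y′ →
               t ⊕ ((b₁ ⊕ (b₂ ⊕ z)) ⊕ ((w₁ ⊕ (w₂ ⊕ x)) ⊕ ((g₁ ⊕ (g₂ ⊕ y)) ⊕ (r ⊕ (x′ ⊕ y′)))))
               ⊜ ((z ⊕ r) ⊕ ((y ⊕ y′) ⊕ (x ⊕ x′))) ⊕ ((w₁ ⊕ (b₁ ⊕ g₁)) ⊕ ((w₂ ⊕ (b₂ ⊕ g₂)) ⊕ t))) ↭-refl
               (flat (twos I)) (map proj₁ (E# black)) (map proj₂ (E# black)) zW (map proj₁ (E# white)) (map proj₂ (E# white)) (take kW zG)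
               (map proj₁ (E# grey)) (map proj₂ (E# grey)) (take kG zB) (rest zW) (drop kW zG) (drop kG zB) ⟩
        ((zW ++ rest zW) ++ (take kG zB ++ drop kG zB) ++ (take kW zG ++ drop kW zG)) ++
          (map proj₁ (E# white) ++ map proj₁ (E# black) ++ map proj₁ (E# grey)) ++
          (map proj₂ (E# white) ++ map proj₂ (E# black) ++ map proj₂ (E# grey)) ++ flat (twos I)
          ↭⟨ PermP.++⁺ (↭-trans (PermP.++⁺ (rest-↭ zW! zW⊆) (PermP.++⁺ zB↭ zG↭)) (↭-sym (filter-colours col (thorns I))))
               (PermP.++⁺ (map-E proj₁) (++⁺ʳ (flat (twos I)) (map-E proj₂))) ⟩
        thorns I ++ map proj₁ (ones I) ++ map proj₂ (ones I) ++ flat (twos I)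
          ↭⟨ labels↭pieces I ⟨
        labels I ∎
        where open PermutationReasoning

      cycles! : Unique (flat (cycles zW zG zB))
      cycles! = unique-resp-↭ (↭-sym flat-cycles) u

      -- Each code stands in a known position of the orbits listed by `cycles`, so it consists of
      -- values of `π`. The left-over white thorns depend on `zW` alone, which is why `zW` has to be
      -- recovered before the other two.
      codes-determined : ∀ {π} → (∀ {t} → t ∈ cycles zW zG zB → Orbit π t) →
        zW ≡ map (π ∘ proj₂) (E# black) ×
        zG ≡ map (π ∘ proj₂) (E# white) ++ map π (rest zW) ×
        zB ≡ map (π ∘ proj₂) (E# grey) ++ map π (map π (rest zW))
      codes-determined o =
        join-orbit (E# black) zW |zW| (o ∘ ∈-++⁺ʳ (twos I) ∘ ∈-++⁺ˡ) ,
        trans (sym (take++drop≡id kW zG)) (cong₂ _++_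
          (join-orbit (E# white) _ (proj₁ lG) (o ∘ ∈-++⁺ʳ (twos I) ∘ ∈-++⁺ʳ (join (E# black) zW) ∘ ∈-++⁺ˡ)) (proj₁ last3)) ,
        trans (sym (take++drop≡id kG zB)) (cong₂ _++_
          (join-orbit (E# grey) _ (proj₁ lB) (o ∘ ∈-++⁺ʳ (twos I) ∘ ∈-++⁺ʳ (join (E# black) zW)
            ∘ ∈-++⁺ʳ (join (E# white) (take kW zG)) ∘ ∈-++⁺ˡ)) (proj₂ last3))
        where
        last3 = join₃-orbit (rest zW) (drop kW zG) (drop kG zB) (proj₂ lG) (proj₂ lB)
          (o ∘ ∈-++⁺ʳ (twos I) ∘ ∈-++⁺ʳ (join (E# black) zW)
            ∘ ∈-++⁺ʳ (join (E# white) (take kW zG)) ∘ ∈-++⁺ʳ (join (E# grey) (take kG zB)))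

      private
        white-part = join (E# white) (take kW zG)
        grey-part = join (E# grey) (take kG zB)

        in-black : ∀ {t} → t ∈ join (E# black) zW → t ∈ cycles zW zG zB
        in-black = ∈-++⁺ʳ (twos I) ∘ ∈-++⁺ˡ
        in-white : ∀ {t} → t ∈ white-part → t ∈ cycles zW zG zB
        in-white = ∈-++⁺ʳ (twos I) ∘ ∈-++⁺ʳ (join (E# black) zW) ∘ ∈-++⁺ˡ
        in-grey : ∀ {t} → t ∈ grey-part → t ∈ cycles zW zG zB
        in-grey = ∈-++⁺ʳ (twos I) ∘ ∈-++⁺ʳ (join (E# black) zW) ∘ ∈-++⁺ʳ white-part ∘ ∈-++⁺ˡ

        one-in : ∀ {l s} → (l , s) ∈ ones I → ∃ λ z → (l , s , z) ∈ cycles zW zG zB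
        one-in {l} {s} p with col s in eq
        ... | white = -, in-white (proj₂ (∈-join⁺ (E# white) _ (proj₁ lG) (∈-filter⁺ _ p eq)))
        ... | black = -, in-black (proj₂ (∈-join⁺ (E# black) _ |zW| (∈-filter⁺ _ p eq)))
        ... | grey = -, in-grey (proj₂ (∈-join⁺ (E# grey) _ (proj₁ lB) (∈-filter⁺ _ p eq)))

        colour-S : ∀ {q xs a} → xs ⊆ S# q → a ∈ xs → col a ≡ q
        colour-S {q} sub a∈ = proj₂ (∈-filter⁻ (λ a → col a ≟C q) {xs = thorns I} (sub a∈))

        turned-join : ∀ q {zs} → zs ⊆ S# q → ∀ {t} → t ∈ join (E# (next q)) zs → Turned col t
        turned-join q {zs} sub {l , s , z} t∈ with ∈-join⁻ (E# (next q)) zs t∈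
        ... | e∈ , z∈ with ∈-filter⁻ (λ e → col (proj₂ e) ≟C next q) {xs = ones I} e∈
        ... | p , cs = sym cl′ , trans (cong next (colour-S sub z∈)) (sym cs) ,
              trans (cong next (trans cl′ (cong next cs))) (trans (next³ q) (sym (colour-S sub z∈)))
          where cl′ = All.lookup (ones-coloured col c₀ I cl) p

        take⊆ : ∀ k (xs : List A) → take k xs ⊆ xs
        take⊆ k xs a∈ = subst (_ ∈_) (take++drop≡id k xs) (∈-++⁺ˡ a∈)

        drop⊆ : ∀ k (xs : List A) → drop k xs ⊆ xs
        drop⊆ k xs a∈ = subst (_ ∈_) (take++drop≡id k xs) (∈-++⁺ʳ (take k xs) a∈)

        turned : ∀ {t} → t ∈ cycles zW zG zB → Turned col t
        turned {x , y , z} t∈ with ∈-++⁻ (twos I) t∈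
        ... | inj₁ p with All.lookup (twos-coloured col c₀ I cl) p
        ... | e , e′ = sym e′ , sym e , trans (cong next (trans e′ (cong next e))) (next³ (col z))
        turned {x , y , z} t∈ | inj₂ p with ∈-++⁻ (join (E# black) zW) p
        ... | inj₁ q = turned-join white zW⊆ q
        ... | inj₂ q with ∈-++⁻ white-part q
        ... | inj₁ r = turned-join grey (zG⊆ ∘ take⊆ kW zG) r
        ... | inj₂ r with ∈-++⁻ grey-part r
        ... | inj₁ h = turned-join black (zB⊆ ∘ take⊆ kG zB) h
        ... | inj₂ h with ∈-join₃⁻ (rest zW) (drop kW zG) (drop kG zB) h
        ... | x∈ , y∈ , z∈
          rewrite colour-S (λ a∈ → proj₁ (∈-filter⁻ (λ a → ¬? (a ∈? zW)) {xs = S# white} a∈)) x∈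
                | colour-S (zG⊆ ∘ drop⊆ kW zG) y∈ | colour-S (zB⊆ ∘ drop⊆ kG zB) z∈ = refl , refl , refl

      rotation : A → A
      rotation = rotate _≟_ (cycles zW zG zB)

      rotation-orbits : ∀ {t} → t ∈ cycles zW zG zB → Orbit rotation t
      rotation-orbits = rotate-orbits _≟_ (cycles zW zG zB) cycles!

      rotation-edges : Edges rotation I
      rotation-edges = edges⁻ I (All.tabulate (λ p → proj₁ (rotation-orbits (proj₂ (one-in p)))))
        (All.tabulate (λ p → let (a , b , _) = rotation-orbits (∈-++⁺ˡ p) in a , b))

      rotation-cube : ∀ {a} → a ∈ labels I → rotation (rotation (rotation a)) ≡ a
      rotation-cube a∈ = orbits-cube _≟_ (cycles zW zG zB) rotation-orbits (∈-resp-↭ (↭-sym flat-cycles) a∈)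

      rotation-closed : ∀ {a} → a ∈ labels I → rotation a ∈ labels I
      rotation-closed a∈ = ∈-resp-↭ flat-cycles
        (orbits-closed _≟_ (cycles zW zG zB) rotation-orbits (∈-resp-↭ (↭-sym flat-cycles) a∈))

      rotation-turn : ∀ {a} → a ∈ labels I → next (col (rotation a)) ≡ col a
      rotation-turn a∈ = orbits-turn col (cycles zW zG zB) rotation-orbits turned (∈-resp-↭ (↭-sym flat-cycles) a∈)

    module _ (π : A → A) (closed : ∀ {a} → a ∈ labels I → π a ∈ labels I)
             (cube : ∀ {a} → a ∈ labels I → π (π (π a)) ≡ a)
             (turn : ∀ {a} → a ∈ labels I → next (col (π a)) ≡ col a) (edges : Edges π I) where
      private
        inj : ∀ {a b} → a ∈ labels I → b ∈ labels I → π a ≡ π b → a ≡ b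
        inj a∈ b∈ e = trans (sym (cube a∈)) (trans (cong (π ∘ π) e) (cube b∈))

        lower# = map proj₁ (ones I)
        upper# = map proj₂ (ones I)

        data Kind (a : A) : Set where
          is-thorn : a ∈ thorns I → Kind a
          is-lower : ∀ {s} → (a , s) ∈ ones I → Kind a
          is-upper : ∀ {l} → (l , a) ∈ ones I → Kind a
          in-two   : a ∈ flat (twos I) → Kind a

        ℓ∈ : ∀ {a} → a ∈ thorns I ++ lower# ++ upper# ++ flat (twos I) → a ∈ labels I
        ℓ∈ = ∈-resp-↭ (↭-sym (labels↭pieces I))

        thorn∈ : thorns I ⊆ labels I
        thorn∈ = ℓ∈ ∘ ∈-++⁺ˡ
        lower∈ : ∀ {l s} → (l , s) ∈ ones I → l ∈ labels I
        lower∈ p = ℓ∈ (∈-++⁺ʳ (thorns I) (∈-++⁺ˡ (∈-map⁺ proj₁ p)))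
        upper∈ : ∀ {l s} → (l , s) ∈ ones I → s ∈ labels I
        upper∈ p = ℓ∈ (∈-++⁺ʳ (thorns I) (∈-++⁺ʳ lower# (∈-++⁺ˡ (∈-map⁺ proj₂ p))))
        two∈ : flat (twos I) ⊆ labels I
        two∈ p = ℓ∈ (∈-++⁺ʳ (thorns I) (∈-++⁺ʳ lower# (∈-++⁺ʳ upper# p)))

        kind : ∀ {a} → a ∈ labels I → Kind a
        kind a∈ with ∈-++⁻ (thorns I) (∈-resp-↭ (labels↭pieces I) a∈)
        ... | inj₁ p = is-thorn p
        ... | inj₂ p with ∈-++⁻ lower# p
        ... | inj₁ q with ∈-map⁻ proj₁ q
        ... | _ , q′ , refl = is-lower q′
        kind a∈ | inj₂ p | inj₂ q with ∈-++⁻ upper# q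
        ... | inj₁ r with ∈-map⁻ proj₂ r
        ... | _ , r′ , refl = is-upper r′
        kind a∈ | inj₂ p | inj₂ q | inj₂ r = in-two r

        d₁ = unique-++⁻ (thorns I) (unique-resp-↭ (labels↭pieces I) u)
        d₂ = unique-++⁻ lower# (proj₁ (proj₂ d₁))
        d₃ = unique-++⁻ upper# (proj₁ (proj₂ d₂))

        thorn≢lower : ∀ {a s} → a ∈ thorns I → (a , s) ∉ ones I
        thorn≢lower a∈ p = proj₂ (proj₂ d₁) a∈ (∈-++⁺ˡ (∈-map⁺ proj₁ p))
        thorn≢upper : ∀ {a l} → a ∈ thorns I → (l , a) ∉ ones I
        thorn≢upper a∈ p = proj₂ (proj₂ d₁) a∈ (∈-++⁺ʳ lower# (∈-++⁺ˡ (∈-map⁺ proj₂ p)))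
        thorn≢two : ∀ {a} → a ∈ thorns I → a ∉ flat (twos I)
        thorn≢two a∈ p = proj₂ (proj₂ d₁) a∈ (∈-++⁺ʳ lower# (∈-++⁺ʳ upper# p))
        lower≢upper : ∀ {a s l} → (a , s) ∈ ones I → (l , a) ∉ ones I
        lower≢upper p q = proj₂ (proj₂ d₂) (∈-map⁺ proj₁ p) (∈-++⁺ˡ (∈-map⁺ proj₂ q))
        upper≢two : ∀ {a l} → (l , a) ∈ ones I → a ∉ flat (twos I)
        upper≢two p q = proj₂ (proj₂ d₃) (∈-map⁺ proj₂ p) q

        π-one : ∀ {l s} → (l , s) ∈ ones I → π l ≡ s
        π-one = All.lookup (edges-ones I edges)

        two-orbit : ∀ {t} → t ∈ twos I → Orbit π t
        two-orbit {l′ , l , s} t∈ with All.lookup (edges-twos I edges) t∈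
        ... | p , q = p , q , trans (cong π (trans (sym q) (cong π (sym p)))) (cube (two∈ (proj₁ (∈-flat (twos I) t∈))))

        π-two⁻ : ∀ {a} → a ∈ labels I → π a ∈ flat (twos I) → a ∈ flat (twos I)
        π-two⁻ a∈ p = subst (_∈ flat (twos I)) (cube a∈) (orbits-closed _≟_ (twos I) two-orbit (orbits-closed _≟_ (twos I) two-orbit p))

        -- Any other kind of slot would place `l` or `s` on a second edge or in a triangle, and one
        -- label would then occur twice among the pieces.
        one-thorn : ∀ {l s} → (l , s) ∈ ones I → π s ∈ thorns I
        one-thorn {l} {s} p with kind (closed (upper∈ p))
        ... | is-thorn q = q
        ... | is-lower q = contradiction (subst (λ x → (_ , x) ∈ ones I) (trans (sym (π-one q)) (trans (cong (π ∘ π) (sym (π-one p))) (cube (lower∈ p)))) q)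
                             (lower≢upper p)
        ... | is-upper q = contradiction p (lower≢upper (subst (λ x → (x , _) ∈ ones I) (inj (lower∈ q) (upper∈ p) (π-one q)) q))
        ... | in-two q = contradiction (π-two⁻ (upper∈ p) q) (upper≢two p)

        -- An orbit through a thorn shows at most one edge. If the image of the thorn is on that
        -- edge, it is the lower end, and the thorn is the third slot that completes it.
        thorn-thorn : ∀ {a} → a ∈ thorns I → π a ∈ thorns I ⊎ ∃ λ s → (π a , s) ∈ ones I × π s ≡ a
        thorn-thorn {a} a∈ with kind (closed (thorn∈ a∈))
        ... | is-thorn q = inj₁ q
        ... | is-lower {s} q = inj₂ (s , q , trans (cong π (sym (π-one q))) (cube (thorn∈ a∈)))
        ... | is-upper q = contradiction (subst (λ x → (x , _) ∈ ones I) (inj (lower∈ q) (thorn∈ a∈) (π-one q)) q) (thorn≢lower a∈)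
        ... | in-two q = contradiction (π-two⁻ (thorn∈ a∈) q) (thorn≢two a∈)

        turn′ : ∀ {a q} → a ∈ labels I → col a ≡ next q → col (π a) ≡ q
        turn′ a∈ e = next-injective (trans (turn a∈) e)

        E⁻ : ∀ {q l s} → (l , s) ∈ E# q → (l , s) ∈ ones I × col s ≡ q
        E⁻ {q} = ∈-filter⁻ (λ e → col (proj₂ e) ≟C q)

        S⁻ : ∀ {q a} → a ∈ S# q → a ∈ thorns I × col a ≡ q
        S⁻ {q} = ∈-filter⁻ (λ a → col a ≟C q)

        S⁺ : ∀ {q a} → a ∈ thorns I → col a ≡ q → a ∈ S# q
        S⁺ {q} = ∈-filter⁺ (λ a → col a ≟C q)

        πE : ∀ q → map (π ∘ proj₂) (E# (next q)) ⊆ S# q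
        πE q a∈ with ∈-map⁻ (π ∘ proj₂) a∈
        ... | (l , s) , p , refl with E⁻ p
        ... | p′ , e = S⁺ (one-thorn p′) (turn′ (upper∈ p′) e)

        E!₂ : ∀ q → Unique (map proj₂ (E# q))
        E!₂ q = subset-unique (ones I) (proj₁ d₃)
          where
          subset-unique : ∀ es → Unique (map proj₂ es) → Unique (map proj₂ (upper col q es))
          subset-unique [] u = []
          subset-unique ((l , s) ∷ es) (s∉ ∷ u) with col s ≟C q
          ... | yes _ = All.tabulate (λ a∈ → All.lookup s∉ (sub a∈)) ∷ subset-unique es u
            where
            sub : map proj₂ (upper col q es) ⊆ map proj₂ es
            sub a∈ with ∈-map⁻ proj₂ a∈
            ... | e , e∈ , refl = ∈-map⁺ proj₂ (proj₁ (∈-filter⁻ (λ e → col (proj₂ e) ≟C q) e∈))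
          ... | no _ = subset-unique es u

      -- The equations of `codes-determined`, read as definitions.
      zW₀ zG₀ zB₀ : List A
      zW₀ = map (π ∘ proj₂) (E# black)
      zG₀ = map (π ∘ proj₂) (E# white) ++ map π (rest zW₀)
      zB₀ = map (π ∘ proj₂) (E# grey) ++ map π (map π (rest zW₀))

      private
        rest⁻ : ∀ {a} → a ∈ rest zW₀ → a ∈ thorns I × col a ≡ white × a ∉ zW₀
        rest⁻ a∈ with ∈-filter⁻ (λ a → ¬? (a ∈? zW₀)) {xs = S# white} a∈
        ... | p , q with S⁻ p
        ... | p₁ , p₂ = p₁ , p₂ , q

        -- If `π a` were the lower end of an edge, the parent would be black and `a` would complete
        -- that edge, hence belong to `zW₀`.
        grey-rest : ∀ {a} → a ∈ rest zW₀ → π a ∈ thorns I × col (π a) ≡ grey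
        grey-rest {a} a∈ with rest⁻ a∈
        ... | t , cw , nz with turn′ (thorn∈ t) cw | thorn-thorn t
        ... | cg | inj₁ p = p , cg
        ... | cg | inj₂ (s , p , e) = contradiction
              (subst (_∈ zW₀) e (∈-map⁺ (π ∘ proj₂) (∈-filter⁺ (λ e → col (proj₂ e) ≟C black) p
                 (next-injective (trans (sym (All.lookup (ones-coloured col c₀ I cl) p)) cg))))) nz

        black-rest : ∀ {a} → a ∈ rest zW₀ → π (π a) ∈ thorns I × col (π (π a)) ≡ black
        black-rest {a} a∈ with rest⁻ a∈ | grey-rest a∈
        ... | t , _ | tg , cg with thorn-thorn tg
        ... | inj₁ p = p , turn′ (thorn∈ tg) cg
        ... | inj₂ (s , p , e) = contradiction
              (subst (λ x → (_ , x) ∈ ones I) (trans (sym (π-one p)) (cube (thorn∈ t))) p) (thorn≢upper t)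

        π-map! : ∀ {xs} → xs ⊆ labels I → Unique xs → Unique (map π xs)
        π-map! sub = unique-map-on π (λ a b → inj (sub a) (sub b))

        E⊆ : ∀ q → map proj₂ (E# q) ⊆ labels I
        E⊆ q a∈ with ∈-map⁻ proj₂ a∈
        ... | _ , p , refl = upper∈ (proj₁ (E⁻ p))

        rest! : Unique (rest zW₀)
        rest! = UniqP.filter⁺ _ (UniqP.filter⁺ _ thorns!)

        rest⊆ : rest zW₀ ⊆ labels I
        rest⊆ = thorn∈ ∘ proj₁ ∘ rest⁻

        πrest⊆ : map π (rest zW₀) ⊆ thorns I
        πrest⊆ a∈ with ∈-map⁻ π a∈
        ... | b , b∈ , refl = proj₁ (grey-rest b∈)

        apart : ∀ q {xs} → xs ⊆ thorns I → Unique xs → Unique (map (π ∘ proj₂) (E# q) ++ map π xs)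
        apart q {xs} sub x! = subst Unique
          (trans (map-++ π (map proj₂ (E# q)) xs) (cong (_++ map π xs) (sym (map-∘ (E# q)))))
          (π-map! (λ a∈ → [ E⊆ q , thorn∈ ∘ sub ]′ (∈-++⁻ (map proj₂ (E# q)) a∈))
            (UniqP.++⁺ (E!₂ q) x! λ { (p , p′) → case ∈-map⁻ proj₂ p of λ { (_ , e∈ , refl) → thorn≢upper (sub p′) (proj₁ (E⁻ e∈)) } }))

        zW₀! : Unique zW₀
        zW₀! = subst Unique (sym (map-∘ (E# black))) (π-map! (E⊆ black) (E!₂ black))

        |z| : ∀ {f : A × A → A} {g : A → A} es xs {m} → length es + length xs ≡ m → length (map f es ++ map g xs) ≡ m
        |z| {f} {g} es xs e = trans (length-++ (map f es)) (trans (cong₂ _+_ (length-map f es) (length-map g xs)) e)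

        |rest|₀ = |rest| zW₀! (πE white) (length-map _ (E# black))

      codes₀ : Codes zW₀ zG₀ zB₀
      codes₀ = record
        { zW! = zW₀!
        ; zG! = apart white (proj₁ ∘ rest⁻) rest!
        ; zB! = apart grey πrest⊆ (π-map! rest⊆ rest!)
        ; zW⊆ = πE white
        ; zG⊆ = λ a∈ → [ πE grey , (λ p → case ∈-map⁻ π p of λ { (b , b∈ , refl) → S⁺ (proj₁ (grey-rest b∈)) (proj₂ (grey-rest b∈)) }) ]′
                  (∈-++⁻ (map (π ∘ proj₂) (E# white)) a∈)
        ; zB⊆ = λ a∈ → [ πE black , (λ p → case ∈-map⁻ π p of λ { (_ , q , refl) → case ∈-map⁻ π q of λ { (b , b∈ , refl) →
                    S⁺ (proj₁ (black-rest b∈)) (proj₂ (black-rest b∈)) } }) ]′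
                  (∈-++⁻ (map (π ∘ proj₂) (E# grey)) a∈)
        ; |zW| = length-map _ (E# black)
        ; |zG| = |z| (E# white) (rest zW₀) (proj₁ |rest|₀)
        ; |zB| = |z| (E# grey) (map π (rest zW₀)) (trans (cong (length (E# grey) +_) (length-map π (rest zW₀))) (proj₂ |rest|₀)) }

      private
        take-map : ∀ (f : A × A → A) es xs → take (length es) (map f es ++ xs) ≡ map f es
        take-map f [] xs = refl
        take-map f (e ∷ es) xs = cong (f e ∷_) (take-map f es xs)

        drop-map : ∀ (f : A × A → A) es xs → drop (length es) (map f es ++ xs) ≡ xs
        drop-map f [] xs = refl
        drop-map f (e ∷ es) xs = drop-map f es xs

        one-orbits : ∀ q → All (λ (l , s) → π l ≡ s × π (π s) ≡ l) (E# q)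
        one-orbits q = All.tabulate (λ p → let p′ = proj₁ (E⁻ p) in
          π-one p′ , trans (cong (π ∘ π) (sym (π-one p′))) (cube (lower∈ p′)))

      orbits₀ : ∀ {t} → t ∈ cycles zW₀ zG₀ zB₀ → Orbit π t
      orbits₀ {t} t∈
        rewrite take-map (π ∘ proj₂) (E# white) (map π (rest zW₀)) | drop-map (π ∘ proj₂) (E# white) (map π (rest zW₀))
              | take-map (π ∘ proj₂) (E# grey) (map π (map π (rest zW₀))) | drop-map (π ∘ proj₂) (E# grey) (map π (map π (rest zW₀)))
        with ∈-++⁻ (twos I) t∈
      ... | inj₁ p = two-orbit p
      ... | inj₂ p with ∈-++⁻ (join (E# black) zW₀) p
      ... | inj₁ q = ∈-join (E# black) (one-orbits black) q
      ... | inj₂ q with ∈-++⁻ (join (E# white) (map (π ∘ proj₂) (E# white))) q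
      ... | inj₁ r = ∈-join (E# white) (one-orbits white) r
      ... | inj₂ r with ∈-++⁻ (join (E# grey) (map (π ∘ proj₂) (E# grey))) r
      ... | inj₁ h = ∈-join (E# grey) (one-orbits grey) h
      ... | inj₂ h = ∈-join₃ (rest zW₀) (All.tabulate (cube ∘ rest⊆)) h

-- Thorn cactus trees as shapes.

∧⁺ : ∀ {a b} → T a → T b → T (a ∧ b)
∧⁺ {true} _ p = p

∧⁻ : ∀ {a b} → T (a ∧ b) → T a × T b
∧⁻ {true} p = tt , p

-- In a `two` the third vertex of the triangle becomes the rightmost child of the middle vertex,
-- whose flag records the triangle. This child occupies no slot among those of `J`: it hangs at the
-- last slot of the middle vertex, the one leading to the parent.
toItems : Shape → List (Maybe Tree)
toItems ∅ = []
toItems (thorn _ K) = nothing ∷ toItems K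
toItems (one _ _ J K) = just (node false (toItems J)) ∷ toItems K
toItems (two _ _ _ J J′ K) = just (node true (toItems J ∷ʳ just (node false (toItems J′)))) ∷ toItems K

toTree : Shape → Tree
toTree I = node false (toItems I)

node-injective : ∀ {b xs ys} → just (node b xs) ≡ just (node b ys) → xs ≡ ys
node-injective refl = refl

toItems-injective : ∀ I I′ → toItems I ≡ toItems I′ → I ≡ I′
toItems-injective ∅ ∅ e = refl
toItems-injective ∅ (thorn _ _) ()
toItems-injective ∅ (one _ _ _ _) ()
toItems-injective ∅ (two _ _ _ _ _ _) ()
toItems-injective (thorn _ _) ∅ ()
toItems-injective (thorn _ K) (thorn _ K′) e = cong (thorn tt) (toItems-injective K K′ (∷-injectiveʳ e))
toItems-injective (thorn _ _) (one _ _ _ _) ()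
toItems-injective (thorn _ _) (two _ _ _ _ _ _) ()
toItems-injective (one _ _ _ _) ∅ ()
toItems-injective (one _ _ _ _) (thorn _ _) ()
toItems-injective (one _ _ J K) (one _ _ L M) e =
  cong₂ (one tt tt) (toItems-injective J L (node-injective (∷-injectiveˡ e))) (toItems-injective K M (∷-injectiveʳ e))
toItems-injective (one _ _ _ _) (two _ _ _ _ _ _) ()
toItems-injective (two _ _ _ _ _ _) ∅ ()
toItems-injective (two _ _ _ _ _ _) (thorn _ _) ()
toItems-injective (two _ _ _ _ _ _) (one _ _ _ _) ()
toItems-injective (two _ _ _ J J′ K) (two _ _ _ L L′ M) e
  with refl ← toItems-injective J L (∷ʳ-injectiveˡ _ (toItems L) (node-injective (∷-injectiveˡ e)))
  with refl ← toItems-injective J′ L′ (node-injective (∷ʳ-injectiveʳ (toItems J) (toItems L) (node-injective (∷-injectiveˡ e))))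
  with refl ← toItems-injective K M (∷-injectiveʳ e) = refl

validItems-++ : ∀ xs {ys} → T (validItemsᵇ xs) → T (validItemsᵇ ys) → T (validItemsᵇ (xs ++ ys))
validItems-++ [] p q = q
validItems-++ (nothing ∷ xs) p q = validItems-++ xs p q
validItems-++ (just t ∷ xs) p q with ∧⁻ {validᵇ t} p
... | a , b = ∧⁺ a (validItems-++ xs b q)

lastIsPlainChild-∷ʳ : ∀ xs {ys} → T (lastIsPlainChildᵇ (xs ∷ʳ just (node false ys)))
lastIsPlainChild-∷ʳ [] = tt
lastIsPlainChild-∷ʳ (nothing ∷ []) = tt
lastIsPlainChild-∷ʳ (just (node _ _) ∷ []) = tt
lastIsPlainChild-∷ʳ (nothing ∷ y ∷ xs) = lastIsPlainChild-∷ʳ (y ∷ xs)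
lastIsPlainChild-∷ʳ (just (node _ _) ∷ y ∷ xs) = lastIsPlainChild-∷ʳ (y ∷ xs)

toItems-valid : ∀ I → T (validItemsᵇ (toItems I))
toItems-valid ∅ = tt
toItems-valid (thorn _ K) = toItems-valid K
toItems-valid (one _ _ J K) = ∧⁺ (toItems-valid J) (toItems-valid K)
toItems-valid (two _ _ _ J J′ K) =
  ∧⁺ (∧⁺ (lastIsPlainChild-∷ʳ (toItems J)) (validItems-++ (toItems J) (toItems-valid J) (∧⁺ (toItems-valid J′) tt))) (toItems-valid K)

-- Validity of a middle vertex says that its last item is a child without flag, that is, a `one`.
-- Splitting it off undoes the `∷ʳ` in `toItems`.
unsnoc-plain : ∀ I → T (lastIsPlainChildᵇ (toItems I)) → ∃₂ λ J J′ → toItems I ≡ toItems J ∷ʳ just (node false (toItems J′))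
unsnoc-plain (thorn _ K@(thorn _ _)) p with unsnoc-plain K p
... | J , J′ , e = thorn tt J , J′ , cong (nothing ∷_) e
unsnoc-plain (thorn _ K@(one _ _ _ _)) p with unsnoc-plain K p
... | J , J′ , e = thorn tt J , J′ , cong (nothing ∷_) e
unsnoc-plain (thorn _ K@(two _ _ _ _ _ _)) p with unsnoc-plain K p
... | J , J′ , e = thorn tt J , J′ , cong (nothing ∷_) e
unsnoc-plain (one _ _ M ∅) p = ∅ , M , refl
unsnoc-plain (one _ _ M K@(thorn _ _)) p with unsnoc-plain K p
... | J , J′ , e = one tt tt M J , J′ , cong (_ ∷_) e
unsnoc-plain (one _ _ M K@(one _ _ _ _)) p with unsnoc-plain K p
... | J , J′ , e = one tt tt M J , J′ , cong (_ ∷_) e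
unsnoc-plain (one _ _ M K@(two _ _ _ _ _ _)) p with unsnoc-plain K p
... | J , J′ , e = one tt tt M J , J′ , cong (_ ∷_) e
unsnoc-plain (two _ _ _ M M′ K@(thorn _ _)) p with unsnoc-plain K p
... | J , J′ , e = two tt tt tt M M′ J , J′ , cong (_ ∷_) e
unsnoc-plain (two _ _ _ M M′ K@(one _ _ _ _)) p with unsnoc-plain K p
... | J , J′ , e = two tt tt tt M M′ J , J′ , cong (_ ∷_) e
unsnoc-plain (two _ _ _ M M′ K@(two _ _ _ _ _ _)) p with unsnoc-plain K p
... | J , J′ , e = two tt tt tt M M′ J , J′ , cong (_ ∷_) e

fromItems : ∀ is → T (validItemsᵇ is) → ∃ λ I → toItems I ≡ is
fromItems [] p = ∅ , refl
fromItems (nothing ∷ is) p with fromItems is p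
... | K , refl = thorn tt K , refl
fromItems (just (node false js) ∷ is) p with ∧⁻ {validItemsᵇ js} p
... | pj , pk with fromItems js pj | fromItems is pk
... | J , refl | K , refl = one tt tt J K , refl
fromItems (just (node true js) ∷ is) p with ∧⁻ {lastIsPlainChildᵇ js ∧ validItemsᵇ js} p
... | p′ , pk with ∧⁻ {lastIsPlainChildᵇ js} p′
... | pl , pj with fromItems js pj | fromItems is pk
... | J , refl | K , refl with unsnoc-plain J pl
... | L , L′ , e = two tt tt tt L L′ K , cong (λ ys → just (node true ys) ∷ toItems K) (sym e)

fromTree : ∀ τ → T (validᵇ τ ∧ rootNotMiddleᵇ τ) → ∃ λ I → toTree I ≡ τ
fromTree (node false is) p with fromItems is (proj₁ (∧⁻ {validItemsᵇ is} p))
... | I , refl = I , refl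
fromTree (node true is) p with () ← proj₂ (∧⁻ {lastIsPlainChildᵇ is ∧ validItemsᵇ is} p)

toTree-valid : ∀ I → T (validᵇ (toTree I) ∧ rootNotMiddleᵇ (toTree I))
toTree-valid I = ∧⁺ (toItems-valid I) tt

verticesItems-++ : ∀ c xs ys → verticesItems c (xs ++ ys) ≡ verticesItems c xs ++ verticesItems c ys
verticesItems-++ c [] ys = refl
verticesItems-++ c (nothing ∷ xs) ys = verticesItems-++ c xs ys
verticesItems-++ c (just t ∷ xs) ys = trans (cong (vertices false c t ++_) (verticesItems-++ c xs ys)) (sym (++-assoc (vertices false c t) _ _))

numChildren-∷ʳ : ∀ xs t → numChildren (xs ∷ʳ just t) ≡ suc (numChildren xs)
numChildren-∷ʳ [] t = refl
numChildren-∷ʳ (nothing ∷ xs) t = numChildren-∷ʳ xs t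
numChildren-∷ʳ (just _ ∷ xs) t = cong suc (numChildren-∷ʳ xs t)

numThorns-∷ʳ : ∀ xs t → numThorns (xs ∷ʳ just t) ≡ numThorns xs
numThorns-∷ʳ [] t = refl
numThorns-∷ʳ (nothing ∷ xs) t = cong suc (numThorns-∷ʳ xs t)
numThorns-∷ʳ (just _ ∷ xs) t = numThorns-∷ʳ xs t

length-slots : (I : Items A) → numChildren (toItems (shape I)) + numThorns (toItems (shape I)) ≡ length (slots I)
length-slots ∅ = refl
length-slots (thorn s K) = trans (ℕP.+-suc _ _) (cong suc (length-slots K))
length-slots (one s l J K) = cong suc (length-slots K)
length-slots (two s l l′ J J′ K) = cong suc (length-slots K)

-- Colours are recorded next to the slot lists, since the slots of a shape carry none.
cdesc : Colour → Items A → List (Colour × List A)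
cdesc c ∅ = []
cdesc c (thorn s K) = cdesc c K
cdesc c (one s l J K) = (next c , slots J ∷ʳ l) ∷ cdesc (next c) J ++ cdesc c K
cdesc c (two s l l′ J J′ K) = (next c , slots J ∷ʳ l) ∷ (next (next c) , slots J′ ∷ʳ l′) ∷ cdesc (next c) J ++ cdesc (next (next c)) J′ ++ cdesc c K

cverts : Colour → Items A → List (Colour × List A)
cverts c I = (c , slots I) ∷ cdesc c I

map-cdesc : ∀ c (I : Items A) → map proj₂ (cdesc c I) ≡ descendants I
map-cdesc c ∅ = refl
map-cdesc c (thorn s K) = map-cdesc c K
map-cdesc c (one s l J K) = cong (_ ∷_) (trans (map-++ proj₂ (cdesc (next c) J) _) (cong₂ _++_ (map-cdesc _ J) (map-cdesc _ K)))
map-cdesc c (two s l l′ J J′ K) = cong (λ xs → _ ∷ _ ∷ xs)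
  (trans (map-++ proj₂ (cdesc (next c) J) _) (cong₂ _++_ (map-cdesc _ J)
    (trans (map-++ proj₂ (cdesc (next (next c)) J′) _) (cong₂ _++_ (map-cdesc _ J′) (map-cdesc _ K)))))

cdesc-coloured : (col : A → Colour) → ∀ c I → Coloured col c I →
  All (λ a → col a ≡ c) (slots I) × All (λ (d , x) → All (λ a → col a ≡ d) x) (cdesc c I)
cdesc-coloured col c ∅ cl = [] , []
cdesc-coloured col c (thorn s K) (p , cl) with cdesc-coloured col c K cl
... | a , b = p ∷ a , b
cdesc-coloured col c (one s l J K) (p , q , clJ , clK) with cdesc-coloured col _ J clJ | cdesc-coloured col c K clK
... | a , b | a′ , b′ = p ∷ a′ , AllP.++⁺ a (q ∷ []) ∷ AllP.++⁺ b b′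
cdesc-coloured col c (two s l l′ J J′ K) (p , q , r , clJ , clJ′ , clK)
  with cdesc-coloured col _ J clJ | cdesc-coloured col _ J′ clJ′ | cdesc-coloured col c K clK
... | a , b | a′ , b′ | a″ , b″ = p ∷ a″ , AllP.++⁺ a (q ∷ []) ∷ AllP.++⁺ a′ (r ∷ []) ∷ AllP.++⁺ b (AllP.++⁺ b′ b″)

cdeg : VInfo → Colour × ℕ
cdeg v = VInfo.colour v , degree v

clen : Colour × List A → Colour × ℕ
clen (c , x) = c , length x

private
  shift-mid : {X : Set} (a b : X) (xs ys zs : List X) → (a ∷ xs ++ b ∷ ys) ++ zs ↭ a ∷ b ∷ xs ++ ys ++ zs
  shift-mid a b xs ys zs = prep a (↭-trans (↭-reflexive (++-assoc xs (b ∷ ys) zs)) (shift b xs (ys ++ zs)))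

  length-∷ʳ′ : (xs : List A) (x : A) → length (xs ∷ʳ x) ≡ length xs + 1
  length-∷ʳ′ xs x = length-++ xs

-- Only a permutation, because the plane tree lists the descendants of a middle vertex coming from
-- `J` before its rightmost child, whereas `cdesc` puts the two vertices of the triangle side by
-- side.
cdeg-desc : ∀ c (I : Items A) → map cdeg (verticesItems (next c) (toItems (shape I))) ↭ map clen (cdesc c I)
cdeg-desc c ∅ = ↭-refl
cdeg-desc c (thorn s K) = cdeg-desc c K
cdeg-desc c (one s l J K) = ↭-trans (prep _ (↭-reflexive (map-++ cdeg (verticesItems (next (next c)) (toItems (shape J))) _)))
  (↭-trans (PermP.++⁺ (↭-reflexive (cong (λ m → (next c , m) ∷ []) (trans (cong (_+ 1) (length-slots J)) (sym (length-∷ʳ′ (slots J) l)))))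
             (PermP.++⁺ (cdeg-desc (next c) J) (cdeg-desc c K)))
    (prep _ (↭-reflexive (sym (map-++ clen (cdesc (next c) J) _)))))
cdeg-desc {A = A} c (two s l l′ J J′ K) = begin
  map cdeg ((x ∷ verticesItems (next (next c)) (tJ ∷ʳ just (node false tJ′))) ++ verticesItems (next c) tK)
    ≡⟨ cong (λ ys → map cdeg ((x ∷ ys) ++ verticesItems (next c) tK)) (trans (verticesItems-++ (next (next c)) tJ _) (cong (vJ ++_) (++-identityʳ _))) ⟩
  map cdeg ((x ∷ vJ ++ y ∷ vJ′) ++ vK)
    ↭⟨ PermP.map⁺ cdeg (shift-mid x y vJ vJ′ vK) ⟩
  cdeg x ∷ cdeg y ∷ map cdeg (vJ ++ vJ′ ++ vK)
    ≡⟨ cong₂ (λ m m′ → (next c , m) ∷ (next (next c) , m′) ∷ map cdeg (vJ ++ vJ′ ++ vK)) dx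
         (trans (cong (_+ 1) (length-slots J′)) (sym (length-∷ʳ′ (slots J′) l′))) ⟩
  (next c , length (slots J ∷ʳ l)) ∷ (next (next c) , length (slots J′ ∷ʳ l′)) ∷ map cdeg (vJ ++ vJ′ ++ vK)
    ↭⟨ prep _ (prep _ (↭-trans (↭-reflexive (trans (map-++ cdeg vJ _) (cong (map cdeg vJ ++_) (map-++ cdeg vJ′ _))))
         (↭-trans (PermP.++⁺ (cdeg-desc (next c) J) (PermP.++⁺ (cdeg-desc (next (next c)) J′) (cdeg-desc c K)))
           (↭-reflexive (sym (trans (map-++ clen (cdesc (next c) J) _) (cong (map clen (cdesc (next c) J) ++_) (map-++ clen (cdesc (next (next c)) J′) _)))))))) ⟩
  map clen (cdesc c (two s l l′ J J′ K)) ∎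
  where
  open PermutationReasoning
  tJ = toItems (shape J)
  tJ′ = toItems (shape J′)
  tK = toItems (shape K)
  vJ = verticesItems (next (next c)) tJ
  vJ′ = verticesItems (next (next (next c))) tJ′
  vK = verticesItems (next c) tK
  items = tJ ∷ʳ just (node false tJ′)
  x = vinfo false (next c) true (numChildren items) (numThorns items)
  y = vinfo false (next (next c)) false (numChildren tJ′) (numThorns tJ′)
  -- The additional rightmost child and the correction for a middle vertex cancel, which leaves the
  -- slots of `J` and the last slot.
  dx : degree x ≡ length (slots J ∷ʳ l)
  dx = trans (cong (_∸ 1) (trans (cong₂ (λ k t → k + t + 1) (numChildren-∷ʳ tJ _) (numThorns-∷ʳ tJ _)) (cong (λ m → suc m + 1) (length-slots J))))
         (sym (length-∷ʳ′ (slots J) l))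

cdeg-all : (I : Items A) → map cdeg (allVertices (toTree (shape I))) ↭ map clen (cverts white I)
cdeg-all I = PermP.++⁺ (↭-reflexive (cong (λ m → (white , m) ∷ []) (trans (ℕP.+-identityʳ _) (length-slots I)))) (cdeg-desc white I)

≡Cᵇ⇒≡ : ∀ c d → T (c ≡Cᵇ d) → c ≡ d
≡Cᵇ⇒≡ white white _ = refl
≡Cᵇ⇒≡ black black _ = refl
≡Cᵇ⇒≡ grey grey _ = refl

≡⇒≡Cᵇ : ∀ {c d} → c ≡ d → T (c ≡Cᵇ d)
≡⇒≡Cᵇ {white} refl = tt
≡⇒≡Cᵇ {black} refl = tt
≡⇒≡Cᵇ {grey} refl = tt

-- Degrees, thorns, triangles and vertices of a shape.

δ : Colour → Colour → ℕ
δ q c = if ⌊ c ≟C q ⌋ then 1 else 0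

δ-next : ∀ q c → δ (next q) (next c) ≡ δ q c
δ-next white white = refl
δ-next white black = refl
δ-next white grey = refl
δ-next black white = refl
δ-next black black = refl
δ-next black grey = refl
δ-next grey white = refl
δ-next grey black = refl
δ-next grey grey = refl

vertsOf : Colour → Items A → List (List A)
vertsOf q I = map proj₂ (filter (λ p → proj₁ p ≟C q) (cverts white I))

filter-map : {X Y : Set} (f : X → Y) {P : Y → Set} {Q : X → Set} (P? : ∀ y → Dec (P y)) (Q? : ∀ x → Dec (Q x)) →
  (∀ x → P (f x) → Q x) → (∀ x → Q x → P (f x)) → ∀ xs → filter P? (map f xs) ≡ map f (filter Q? xs)
filter-map f P? Q? h h′ [] = refl
filter-map f P? Q? h h′ (x ∷ xs) with P? (f x) | Q? x
... | yes _ | yes _ = cong (f x ∷_) (filter-map f P? Q? h h′ xs)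
... | no _ | no _ = filter-map f P? Q? h h′ xs
... | yes p | no q = contradiction (h x p) q
... | no p | yes q = contradiction (h′ x q) p

degrees↭ : ∀ q (I : Items A) → degrees q (toTree (shape I)) ↭ map length (vertsOf q I)
degrees↭ q I = begin
  map degree (ofColour q τ)                                          ≡⟨ map-∘ (ofColour q τ) ⟩
  map proj₂ (map cdeg (ofColour q τ))                                ≡⟨ cong (map proj₂) (filter-map cdeg (λ p → proj₁ p ≟C q) (λ v → T? (VInfo.colour v ≡Cᵇ q)) (λ _ → ≡⇒≡Cᵇ) (λ v → ≡Cᵇ⇒≡ (VInfo.colour v) q) (allVertices τ)) ⟨
  map proj₂ (filter (λ p → proj₁ p ≟C q) (map cdeg (allVertices τ))) ↭⟨ PermP.map⁺ proj₂ (filter-↭ (λ p → proj₁ p ≟C q) (cdeg-all I)) ⟩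
  map proj₂ (filter (λ p → proj₁ p ≟C q) (map clen (cverts white I))) ≡⟨ cong (map proj₂) (filter-map clen (λ p → proj₁ p ≟C q) (λ p → proj₁ p ≟C q) (λ _ → id) (λ _ → id) (cverts white I)) ⟩
  map proj₂ (map clen F)                                              ≡⟨ map-∘ F ⟨
  map (length ∘ proj₂) F                                              ≡⟨ map-∘ F ⟩
  map length (vertsOf q I)                                            ∎
  where
  open PermutationReasoning
  τ = toTree (shape I)
  F = filter (λ p → proj₁ p ≟C q) (cverts white I)

length-ofCol-labels : (col : A → Colour) (I : Items A) → Coloured col white I → ∀ q →
  length (ofCol col q (labels I)) ≡ sum (map length (vertsOf q I))
length-ofCol-labels col I cl q = trans (↭-length (filter-↭ (λ a → col a ≟C q)
    (↭-trans (labels↭verts I) (↭-reflexive (cong (λ vs → slots I ++ concat vs) (sym (map-cdesc white I)))))))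
  (go (cverts white I) (proj₁ cs ∷ proj₂ cs))
  where
  cs = cdesc-coloured col white I cl
  go : ∀ cv → All (λ (d , x) → All (λ a → col a ≡ d) x) cv →
    length (ofCol col q (concat (map proj₂ cv))) ≡ sum (map length (map proj₂ (filter (λ p → proj₁ p ≟C q) cv)))
  go [] [] = refl
  go ((d , x) ∷ cv) (p ∷ ps) with d ≟C q
  ... | yes refl = trans (cong length (filter-++ (λ a → col a ≟C q) x _))
        (trans (length-++ (ofCol col q x)) (cong₂ _+_ (cong length (filter-all (λ a → col a ≟C q) p)) (go cv ps)))
  ... | no d≢q = trans (cong length (trans (filter-++ (λ a → col a ≟C q) x _)
        (cong (_++ ofCol col q (concat (map proj₂ cv))) (filter-none (λ a → col a ≟C q) (All.map (λ e e′ → d≢q (trans (sym e) e′)) p))))) (go cv ps)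

-- A common form for the numerical parameters of a shape: the weights `f`, `g`, `h` are summed over
-- thorns, single edges and triangles. Relations between parameters then reduce to `weigh-+` and
-- `weigh-cong`.
weigh : (Colour → ℕ) → (Colour → ℕ) → (Colour → ℕ) → Colour → Items A → ℕ
weigh f g h c ∅ = 0
weigh f g h c (thorn s K) = f c + weigh f g h c K
weigh f g h c (one s l J K) = g c + (weigh f g h (next c) J + weigh f g h c K)
weigh f g h c (two s l l′ J J′ K) = h c + (weigh f g h (next c) J + (weigh f g h (next (next c)) J′ + weigh f g h c K))

weigh-map : ∀ (k : A → B) f g h c I → weigh f g h c (mapI k I) ≡ weigh f g h c I
weigh-map k f g h c ∅ = refl
weigh-map k f g h c (thorn s K) = cong (f c +_) (weigh-map k f g h c K)
weigh-map k f g h c (one s l J K) = cong (g c +_) (cong₂ _+_ (weigh-map k f g h _ J) (weigh-map k f g h c K))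
weigh-map k f g h c (two s l l′ J J′ K) =
  cong (h c +_) (cong₂ _+_ (weigh-map k f g h _ J) (cong₂ _+_ (weigh-map k f g h _ J′) (weigh-map k f g h c K)))

module _ (col : A → Colour) where
  private
    0# : Colour → ℕ
    0# _ = 0

    δ-cons : {X : Set} (f : X → Colour) → ∀ q x xs → length (filter (λ y → f y ≟C q) (x ∷ xs)) ≡ δ q (f x) + length (filter (λ y → f y ≟C q) xs)
    δ-cons f q x xs with f x ≟C q
    ... | yes _ = refl
    ... | no _ = refl

    len-++ : {X : Set} (f : X → Colour) → ∀ q xs ys → length (filter (λ y → f y ≟C q) (xs ++ ys)) ≡
      length (filter (λ y → f y ≟C q) xs) + length (filter (λ y → f y ≟C q) ys)
    len-++ f q xs ys = trans (cong length (filter-++ _ xs ys)) (length-++ (filter (λ y → f y ≟C q) xs))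

  |thorns| : ∀ q c I → Coloured col c I → length (ofCol col q (thorns I)) ≡ weigh (δ q) 0# 0# c I
  |thorns| q c ∅ cl = refl
  |thorns| q c (thorn s K) (refl , cl) = trans (δ-cons col q s (thorns K)) (cong (δ q c +_) (|thorns| q c K cl))
  |thorns| q c (one s l J K) (_ , _ , clJ , clK) = trans (len-++ col q (thorns J) _) (cong₂ _+_ (|thorns| q _ J clJ) (|thorns| q c K clK))
  |thorns| q c (two s l l′ J J′ K) (_ , _ , _ , clJ , clJ′ , clK) = trans (len-++ col q (thorns J) _)
    (cong₂ _+_ (|thorns| q _ J clJ) (trans (len-++ col q (thorns J′) _) (cong₂ _+_ (|thorns| q _ J′ clJ′) (|thorns| q c K clK))))

  |ones| : ∀ q c I → Coloured col c I → length (upper col q (ones I)) ≡ weigh 0# (δ q) 0# c I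
  |ones| q c ∅ cl = refl
  |ones| q c (thorn s K) (refl , cl) = |ones| q c K cl
  |ones| q c (one s l J K) (refl , _ , clJ , clK) = trans (δ-cons (col ∘ proj₂) q (l , s) (ones J ++ ones K))
    (cong (δ q c +_) (trans (len-++ (col ∘ proj₂) q (ones J) _) (cong₂ _+_ (|ones| q _ J clJ) (|ones| q c K clK))))
  |ones| q c (two s l l′ J J′ K) (_ , _ , _ , clJ , clJ′ , clK) = trans (len-++ (col ∘ proj₂) q (ones J) _)
    (cong₂ _+_ (|ones| q _ J clJ) (trans (len-++ (col ∘ proj₂) q (ones J′) _) (cong₂ _+_ (|ones| q _ J′ clJ′) (|ones| q c K clK))))

  |twos| : ∀ c (I : Items A) → length (twos I) ≡ weigh 0# 0# (λ _ → 1) c I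
  |twos| c ∅ = refl
  |twos| c (thorn s K) = |twos| c K
  |twos| c (one s l J K) = trans (length-++ (twos J)) (cong₂ _+_ (|twos| _ J) (|twos| c K))
  |twos| c (two s l l′ J J′ K) = cong suc (trans (length-++ (twos J)) (cong₂ _+_ (|twos| _ J)
    (trans (length-++ (twos J′)) (cong₂ _+_ (|twos| _ J′) (|twos| c K)))))

weigh-+ : ∀ f g h f′ g′ h′ c (I : Items A) → weigh f g h c I + weigh f′ g′ h′ c I ≡
  weigh (λ d → f d + f′ d) (λ d → g d + g′ d) (λ d → h d + h′ d) c I
weigh-+ f g h f′ g′ h′ c ∅ = refl
weigh-+ f g h f′ g′ h′ c (thorn s K) = trans
  (solve 4 (λ a b x y → (a :+ x) :+ (b :+ y) := (a :+ b) :+ (x :+ y)) refl (f c) (f′ c) _ _) (cong (f c + f′ c +_) (weigh-+ f g h f′ g′ h′ c K))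
  where open +-*-Solver
weigh-+ f g h f′ g′ h′ c (one s l J K) = trans
  (solve 6 (λ a b x y x′ y′ → (a :+ (x :+ y)) :+ (b :+ (x′ :+ y′)) := (a :+ b) :+ ((x :+ x′) :+ (y :+ y′))) refl (g c) (g′ c)
    (weigh f g h (next c) J) (weigh f g h c K) (weigh f′ g′ h′ (next c) J) (weigh f′ g′ h′ c K))
  (cong (g c + g′ c +_) (cong₂ _+_ (weigh-+ f g h f′ g′ h′ _ J) (weigh-+ f g h f′ g′ h′ c K)))
  where open +-*-Solver
weigh-+ f g h f′ g′ h′ c (two s l l′ J J′ K) = trans
  (solve 8 (λ a b x y z x′ y′ z′ → (a :+ (x :+ (y :+ z))) :+ (b :+ (x′ :+ (y′ :+ z′))) := (a :+ b) :+ ((x :+ x′) :+ ((y :+ y′) :+ (z :+ z′)))) refl (h c) (h′ c)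
    (weigh f g h (next c) J) (weigh f g h (next (next c)) J′) (weigh f g h c K) (weigh f′ g′ h′ (next c) J) (weigh f′ g′ h′ (next (next c)) J′) (weigh f′ g′ h′ c K))
  (cong (h c + h′ c +_) (cong₂ _+_ (weigh-+ f g h f′ g′ h′ _ J) (cong₂ _+_ (weigh-+ f g h f′ g′ h′ _ J′) (weigh-+ f g h f′ g′ h′ c K))))
  where open +-*-Solver

weigh-cong : ∀ {f g h f′ g′ h′} → (∀ c → f c ≡ f′ c) → (∀ c → g c ≡ g′ c) → (∀ c → h c ≡ h′ c) → ∀ c (I : Items A) →
  weigh f g h c I ≡ weigh f′ g′ h′ c I
weigh-cong p q r c ∅ = refl
weigh-cong p q r c (thorn s K) = cong₂ _+_ (p c) (weigh-cong p q r c K)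
weigh-cong p q r c (one s l J K) = cong₂ _+_ (q c) (cong₂ _+_ (weigh-cong p q r _ J) (weigh-cong p q r c K))
weigh-cong p q r c (two s l l′ J J′ K) =
  cong₂ _+_ (r c) (cong₂ _+_ (weigh-cong p q r _ J) (cong₂ _+_ (weigh-cong p q r _ J′) (weigh-cong p q r c K)))

-- With `α`, `β` equal to 0, 1 this counts thorns and with 1, 0 middle vertices, so that one
-- induction serves both.
weight : ℕ → ℕ → VInfo → ℕ
weight α β v = (if VInfo.middle v then α else 0) + β * VInfo.thorns v

ofColourV : Colour → List VInfo → List VInfo
ofColourV q = filter (λ v → T? (VInfo.colour v ≡Cᵇ q))

total : ℕ → ℕ → Colour → List VInfo → ℕ
total α β q vs = sum (map (weight α β) (ofColourV q vs))

total-∷ : ∀ α β q v vs → total α β q (v ∷ vs) ≡ δ q (VInfo.colour v) * weight α β v + total α β q vs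
total-∷ α β q v vs with VInfo.colour v | q
... | white | white = cong (_+ total α β white vs) (sym (ℕP.*-identityˡ (weight α β v)))
... | white | black = refl
... | white | grey = refl
... | black | white = refl
... | black | black = cong (_+ total α β black vs) (sym (ℕP.*-identityˡ (weight α β v)))
... | black | grey = refl
... | grey | white = refl
... | grey | black = refl
... | grey | grey = cong (_+ total α β grey vs) (sym (ℕP.*-identityˡ (weight α β v)))

total-++ : ∀ α β q vs ws → total α β q (vs ++ ws) ≡ total α β q vs + total α β q ws
total-++ α β q vs ws = trans (cong (sum ∘ map (weight α β)) (filter-++ _ vs ws))
  (trans (cong sum (map-++ (weight α β) (ofColourV q vs) _)) (ℕSum.sum-++ (map (weight α β) (ofColourV q vs)) _))

-- `verticesItems` lists only the vertices below the current one, whose own thorns therefore enter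
-- as a separate term.
total-items : ∀ α β q c (I : Shape) →
  δ q c * (β * numThorns (toItems I)) + total α β q (verticesItems (next c) (toItems I)) ≡
  weigh (λ d → δ q d * β) (λ _ → 0) (λ d → δ q (next d) * α) c I
total-items α β q c ∅ = trans (ℕP.+-identityʳ _) (trans (cong (δ q c *_) (ℕP.*-zeroʳ β)) (ℕP.*-zeroʳ (δ q c)))
total-items α β q c (thorn _ K) = trans
  (solve 4 (λ d b t m → d :* (b :* (con 1 :+ t)) :+ m := d :* b :+ (d :* (b :* t) :+ m)) refl (δ q c) β (numThorns (toItems K)) _)
  (cong (δ q c * β +_) (total-items α β q c K))
  where open +-*-Solver
total-items α β q c (one _ _ J K) = begin
  δ q c * (β * tK) + total α β q ((x ∷ vJ) ++ vK)
    ≡⟨ cong (δ q c * (β * tK) +_) (trans (total-++ α β q (x ∷ vJ) vK) (cong (_+ total α β q vK) (total-∷ α β q x vJ))) ⟩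
  δ q c * (β * tK) + ((δ q (next c) * (β * tJ) + total α β q vJ) + total α β q vK)
    ≡⟨ solve 4 (λ a b m n → a :+ ((b :+ m) :+ n) := (b :+ m) :+ (a :+ n)) refl (δ q c * (β * tK)) (δ q (next c) * (β * tJ)) (total α β q vJ) (total α β q vK) ⟩
  (δ q (next c) * (β * tJ) + total α β q vJ) + (δ q c * (β * tK) + total α β q vK)
    ≡⟨ cong₂ _+_ (total-items α β q (next c) J) (total-items α β q c K) ⟩
  _ ∎
  where
  open ≡-Reasoning
  open +-*-Solver
  tJ = numThorns (toItems J)
  tK = numThorns (toItems K)
  vJ = verticesItems (next (next c)) (toItems J)
  vK = verticesItems (next c) (toItems K)
  x = vinfo false (next c) false (numChildren (toItems J)) tJ
total-items α β q c (two _ _ _ J J′ K) = begin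
  δ q c * (β * tK) + total α β q ((x ∷ verticesItems (next (next c)) (toItems J ∷ʳ just (node false (toItems J′)))) ++ vK)
    ≡⟨ cong (λ ys → δ q c * (β * tK) + total α β q ((x ∷ ys) ++ vK)) (trans (verticesItems-++ (next (next c)) (toItems J) _) (cong (vJ ++_) (++-identityʳ _))) ⟩
  δ q c * (β * tK) + total α β q ((x ∷ vJ ++ y ∷ vJ′) ++ vK)
    ≡⟨ cong (δ q c * (β * tK) +_) (trans (total-++ α β q (x ∷ vJ ++ y ∷ vJ′) vK) (cong (_+ total α β q vK) (trans (total-∷ α β q x (vJ ++ y ∷ vJ′))
         (cong₂ (λ t m → δ q (next c) * (α + β * t) + m) (numThorns-∷ʳ (toItems J) _) (trans (total-++ α β q vJ (y ∷ vJ′)) (cong (total α β q vJ +_) (total-∷ α β q y vJ′))))))) ⟩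
  δ q c * (β * tK) + ((δ q (next c) * (α + β * tJ) + (total α β q vJ + (δ q (next (next c)) * (β * tJ′) + total α β q vJ′))) + total α β q vK)
    ≡⟨ solve 8 (λ d₁ a bj m b₂ m′ b₃ n → b₃ :+ ((d₁ :* (a :+ bj) :+ (m :+ (b₂ :+ m′))) :+ n) := d₁ :* a :+ ((d₁ :* bj :+ m) :+ ((b₂ :+ m′) :+ (b₃ :+ n)))) refl
         (δ q (next c)) α (β * tJ) (total α β q vJ) (δ q (next (next c)) * (β * tJ′)) (total α β q vJ′) (δ q c * (β * tK)) (total α β q vK) ⟩
  δ q (next c) * α + ((δ q (next c) * (β * tJ) + total α β q vJ) + ((δ q (next (next c)) * (β * tJ′) + total α β q vJ′) + (δ q c * (β * tK) + total α β q vK)))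
    ≡⟨ cong (δ q (next c) * α +_) (cong₂ _+_ (total-items α β q (next c) J) (cong₂ _+_ (total-items α β q (next (next c)) J′) (total-items α β q c K))) ⟩
  _ ∎
  where
  open ≡-Reasoning
  open +-*-Solver
  items = toItems J ∷ʳ just (node false (toItems J′))
  tJ = numThorns (toItems J)
  tJ′ = numThorns (toItems J′)
  tK = numThorns (toItems K)
  vJ = verticesItems (next (next c)) (toItems J)
  vJ′ = verticesItems (next (next (next c))) (toItems J′)
  vK = verticesItems (next c) (toItems K)
  x = vinfo false (next c) true (numChildren items) (numThorns items)
  y = vinfo false (next (next c)) false (numChildren (toItems J′)) tJ′

private
  0# : Colour → ℕ
  0# _ = 0

thornCount oneCount twoCount : Colour → Shape → ℕ
thornCount q = weigh (δ q) 0# 0# white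
oneCount q = weigh 0# (δ q) 0# white
twoCount q = weigh 0# 0# (δ q) white

private
  total-tree : ∀ α β q I → total α β q (allVertices (toTree I)) ≡ weigh (λ d → δ q d * β) 0# (λ d → δ q (next d) * α) white I
  total-tree α β q I = trans (total-∷ α β q (vinfo true white false (numChildren (toItems I)) (numThorns (toItems I))) (verticesItems (next white) (toItems I))) (total-items α β q white I)

  weight-thorns : ∀ vs → map VInfo.thorns vs ≡ map (weight 0 1) vs
  weight-thorns vs = map-cong (λ v → sym (trans (cong₂ _+_ (if-same (VInfo.middle v)) (ℕP.*-identityˡ _)) refl)) vs
    where
    if-same : ∀ b → (if b then 0 else 0) ≡ 0
    if-same true = refl
    if-same false = refl

  count-middle : ∀ vs → countᵇ VInfo.middle vs ≡ sum (map (weight 1 0) vs)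
  count-middle [] = refl
  count-middle (v ∷ vs) with VInfo.middle v
  ... | true = cong suc (count-middle vs)
  ... | false = count-middle vs

thornsOn-toTree : ∀ q I → thornsOn q (toTree I) ≡ thornCount q I
thornsOn-toTree q I = trans (cong sum (weight-thorns (ofColour q (toTree I)))) (trans (total-tree 0 1 q I)
  (weigh-cong (λ c → ℕP.*-identityʳ (δ q c)) (λ _ → refl) (λ c → ℕP.*-zeroʳ (δ q (next c))) white I))

triangles-toTree : ∀ q I → trianglesRootedAt q (toTree I) ≡ twoCount q I
triangles-toTree q I = trans (count-middle (ofColour (next q) (toTree I))) (trans (total-tree 1 0 (next q) I)
  (weigh-cong (λ c → ℕP.*-zeroʳ (δ (next q) c)) (λ _ → refl) (λ c → trans (ℕP.*-identityʳ _) (δ-next q c)) white I))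

-- A vertex of colour `next q` is the root, the lower end of a single edge from colour `q`, the
-- middle vertex of a triangle rooted at `q`, or the third vertex of a triangle rooted one colour
-- earlier, at `next (next q)`.
numVertices-toTree : ∀ q I → numVertices (next q) (toTree I) ≡ δ (next q) white + (oneCount q I + (twoCount q I + twoCount (next (next q)) I))
numVertices-toTree q I = begin
  length (ofColour (next q) (toTree I))             ≡⟨ length-map degree (ofColour (next q) (toTree I)) ⟨
  length (degrees (next q) (toTree I))              ≡⟨ cong (λ J → length (degrees (next q) (toTree J))) (shape-id I) ⟨
  length (degrees (next q) (toTree (shape I)))      ≡⟨ ↭-length (degrees↭ (next q) I) ⟩
  length (map length (vertsOf (next q) I))          ≡⟨ trans (length-map length (vertsOf (next q) I)) (length-map proj₂ (filter (λ p → proj₁ p ≟C next q) (cverts white I))) ⟩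
  length (filter (λ p → proj₁ p ≟C next q) (cverts white I)) ≡⟨ cons (white , slots I) (cdesc white I) ⟩
  δ (next q) white + length (filter (λ p → proj₁ p ≟C next q) (cdesc white I)) ≡⟨ cong (δ (next q) white +_) (go white I) ⟩
  δ (next q) white + weigh 0# (δ q) (λ d → δ q d + δ (next (next q)) d) white I
    ≡⟨ cong (δ (next q) white +_) (trans (cong (oneCount q I +_) (weigh-+ _ _ _ _ _ _ white I)) (trans (weigh-+ _ _ _ _ _ _ white I)
        (weigh-cong (λ _ → refl) (λ d → ℕP.+-identityʳ (δ q d)) (λ _ → refl) white I))) ⟨
  _ ∎
  where
  open ≡-Reasoning
  shape-id : ∀ I → shape I ≡ I
  shape-id ∅ = refl
  shape-id (thorn _ K) = cong (thorn tt) (shape-id K)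
  shape-id (one _ _ J K) = cong₂ (one tt tt) (shape-id J) (shape-id K)
  shape-id (two _ _ _ J J′ K) rewrite shape-id J | shape-id J′ | shape-id K = refl
  cons : ∀ (p : Colour × List ⊤) ps → length (filter (λ p → proj₁ p ≟C next q) (p ∷ ps)) ≡ δ (next q) (proj₁ p) + length (filter (λ p → proj₁ p ≟C next q) ps)
  cons p ps with proj₁ p ≟C next q
  ... | yes _ = refl
  ... | no _ = refl
  cat : ∀ (ps qs : List (Colour × List ⊤)) → length (filter (λ p → proj₁ p ≟C next q) (ps ++ qs)) ≡
    length (filter (λ p → proj₁ p ≟C next q) ps) + length (filter (λ p → proj₁ p ≟C next q) qs)
  cat ps qs = trans (cong length (filter-++ _ ps qs)) (length-++ (filter (λ p → proj₁ p ≟C next q) ps))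
  δ₂ : ∀ c → δ (next q) (next (next c)) ≡ δ (next (next q)) c
  δ₂ c = trans (sym (δ-next (next q) (next (next c)))) (cong (δ (next (next q))) (next³ c))
  go : ∀ c I → length (filter (λ p → proj₁ p ≟C next q) (cdesc c I)) ≡ weigh 0# (δ q) (λ d → δ q d + δ (next (next q)) d) c I
  go c ∅ = refl
  go c (thorn _ K) = go c K
  go c (one _ _ J K) = trans (cons (next c , slots J ∷ʳ tt) (cdesc (next c) J ++ cdesc c K)) (cong₂ _+_ (δ-next q c) (trans (cat (cdesc (next c) J) _) (cong₂ _+_ (go _ J) (go c K))))
  go c (two _ _ _ J J′ K) = trans (cons (next c , slots J ∷ʳ tt) ((next (next c) , slots J′ ∷ʳ tt) ∷ cdesc (next c) J ++ cdesc (next (next c)) J′ ++ cdesc c K))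
    (trans (cong₂ _+_ (δ-next q c) (trans (cons (next (next c) , slots J′ ∷ʳ tt) (cdesc (next c) J ++ cdesc (next (next c)) J′ ++ cdesc c K)) (cong₂ _+_ (δ₂ c)
      (trans (cat (cdesc (next c) J) _) (cong₂ _+_ (go _ J) (trans (cat (cdesc (next (next c)) J′) _) (cong₂ _+_ (go _ J′) (go c K))))))))
      (sym (ℕP.+-assoc (δ q c) _ _)))

-- Multisets, integer partitions and ordered subsets.

≈ₘ⇒↭ : ∀ {xs ys} → xs ≈ₘ ys → xs ↭ ys
≈ₘ⇒↭ {xs} {ys} e = ↭-trans (↭-sym (sort-↭ xs)) (↭-trans (↭-reflexive e) (sort-↭ ys))

↭⇒≈ₘ : ∀ {xs ys} → xs ↭ ys → xs ≈ₘ ys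
↭⇒≈ₘ {xs} {ys} p = Pointwise.Pointwise-≡⇒≡ (↗↭↗⇒≋ ℕP.≤-totalOrder (sort-↗ xs) (sort-↗ ys)
  (↭⇒↭ₛ (↭-trans (sort-↭ xs) (↭-trans p (↭-sym (sort-↭ ys))))))

sum-parts : ∀ {n} (p : Partition n) → sum (parts p) ≡ n
sum-parts {n} (xs , ok) = ℕP.≡ᵇ⇒≡ (sum xs) n (proj₂ (∧⁻ {weaklyDecreasingᵇ xs} (proj₂ (∧⁻ {allᵇ (λ k → 1 ≤ᵇ k) xs} ok))))

≡F⇒≡ : ∀ {n} {i j : Fin n} → T (i ≡F j) → i ≡ j
≡F⇒≡ {i = i} {j} p with i FinP.≟ j
... | yes e = e

≡⇒≡F : ∀ {n} {i j : Fin n} → i ≡ j → T (i ≡F j)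
≡⇒≡F {i = i} {j} e with i FinP.≟ j
... | yes _ = tt
... | no ne = contradiction e ne

allᵇ⁻ : {X : Set} {p : X → Bool} (xs : List X) → T (allᵇ p xs) → All (T ∘ p) xs
allᵇ⁻ [] _ = []
allᵇ⁻ {p = p} (x ∷ xs) h with ∧⁻ {p x} h
... | a , b = a ∷ allᵇ⁻ xs b

allᵇ⁺ : {X : Set} {p : X → Bool} {xs : List X} → All (T ∘ p) xs → T (allᵇ p xs)
allᵇ⁺ [] = tt
allᵇ⁺ (a ∷ b) = ∧⁺ a (allᵇ⁺ b)

distinct⇒unique : ∀ {n} (xs : List (Fin n)) → T (distinctᵇ xs) → Unique xs
distinct⇒unique [] _ = []
distinct⇒unique (x ∷ xs) h with ∧⁻ {allᵇ (λ y → not (x ≡F y)) xs} h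
... | a , b = All.map (λ {y} → neg y) (allᵇ⁻ xs a) ∷ distinct⇒unique xs b
  where
  neg : ∀ y → T (not (x ≡F y)) → x ≢ y
  neg y p with x FinP.≟ y
  ... | no ne = ne

unique⇒distinct : ∀ {n} {xs : List (Fin n)} → Unique xs → T (distinctᵇ xs)
unique⇒distinct [] = tt
unique⇒distinct {xs = x ∷ xs} (a ∷ b) = ∧⁺ {allᵇ (λ y → not (x ≡F y)) xs} (allᵇ⁺ (All.map (λ {y} → neg y) a)) (unique⇒distinct b)
  where
  neg : ∀ y → x ≢ y → T (not (x ≡F y))
  neg y ne with x FinP.≟ y
  ... | yes e = ne e
  ... | no _ = tt

lookup-unique : {xs : List A} → Unique xs → ∀ {i j} → List.lookup xs i ≡ List.lookup xs j → i ≡ j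
lookup-unique (x∉ ∷ u) {zero} {zero} e = refl
lookup-unique {xs = x ∷ xs} (x∉ ∷ u) {zero} {suc j} e = contradiction e (All.lookup x∉ (∈-lookup j))
lookup-unique {xs = x ∷ xs} (x∉ ∷ u) {suc i} {zero} e = contradiction (sym e) (All.lookup x∉ (∈-lookup i))
lookup-unique (x∉ ∷ u) {suc i} {suc j} e = cong suc (lookup-unique u e)

indices : {X : List A} → ∀ zs → zs ⊆ X → ∃ λ (v : Vec (Fin (length X)) (length zs)) → map (List.lookup X) (toList v) ≡ zs
indices [] sub = Vec.[] , refl
indices (z ∷ zs) sub with indices zs (sub ∘ there)
... | v , e = Any.index (sub (here refl)) Vec.∷ v , cong₂ _∷_ (sym (AnyP.lookup-index (sub (here refl)))) e

module _ {X : List A} (X! : Unique X) where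

  map-lookup-injective : ∀ {k} (v v′ : Vec (Fin (length X)) k) → map (List.lookup X) (toList v) ≡ map (List.lookup X) (toList v′) → v ≡ v′
  map-lookup-injective Vec.[] Vec.[] e = refl
  map-lookup-injective (i Vec.∷ v) (j Vec.∷ v′) e =
    cong₂ Vec._∷_ (lookup-unique X! (∷-injectiveˡ e)) (map-lookup-injective v v′ (∷-injectiveʳ e))

  -- `S k` and `OP k k` unfold to the same type, so permutations are decoded here as well, as full
  -- orderings of `X`.
  choice : ∀ {k} → OP (length X) k → List A
  choice (v , _) = map (List.lookup X) (toList v)

  choice! : ∀ {k} (o : OP (length X) k) → Unique (choice o)
  choice! (v , d) = UniqP.map⁺ (lookup-unique X!) (distinct⇒unique (toList v) d)

  choice⊆ : ∀ {k} (o : OP (length X) k) → choice o ⊆ X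
  choice⊆ (v , _) a∈ with ∈-map⁻ (List.lookup X) a∈
  ... | i , _ , refl = ∈-lookup i

  |choice| : ∀ {k} (o : OP (length X) k) → length (choice o) ≡ k
  |choice| (v , _) = trans (length-map (List.lookup X) (toList v)) (VecP.length-toList v)

  choice-injective : ∀ {k} (o o′ : OP (length X) k) → choice o ≡ choice o′ → o ≡ o′
  choice-injective (v , d) (v′ , d′) e with refl ← map-lookup-injective v v′ e = cong (v ,_) (T-irrelevant d d′)

  choice-surjective : ∀ {k} zs → Unique zs → zs ⊆ X → length zs ≡ k → ∃ λ (o : OP (length X) k) → choice o ≡ zs
  choice-surjective zs z! z⊆ refl with indices zs z⊆
  ... | v , e = (v , unique⇒distinct (UniqP.map⁻ {f = List.lookup X} (subst Unique (sym e) z!))) , e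

-- Tuples reduced to a shape and three choices.

_≟L_ : DecidableEquality Label
_≟L_ = ProdP.≡-dec _≟C_ ℕP._≟_

model : Shape → Items Label
model sh = number white 0 sh

module Cp (sh : Shape) = Completion _≟L_ proj₁ (model sh) (coloured-number white 0 sh) (labels-number! sh)

module _ (sh : Shape) where
  private
    weigh-model : ∀ f g h → weigh f g h white (model sh) ≡ weigh f g h white sh
    weigh-model f g h = trans (sym (weigh-map (λ _ → tt) f g h white (model sh))) (cong (weigh f g h white) (shape-number white 0 sh))

  |S#| : ∀ q → length (Cp.S# sh q) ≡ thornCount q sh
  |S#| q = trans (|thorns| proj₁ q white (model sh) (coloured-number white 0 sh)) (weigh-model _ _ _)

  |E#| : ∀ q → length (Cp.E# sh q) ≡ oneCount q sh
  |E#| q = trans (|ones| proj₁ q white (model sh) (coloured-number white 0 sh)) (weigh-model _ _ _)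

  |T#| : length (twos (model sh)) ≡ twoCount white sh + (twoCount black sh + twoCount grey sh)
  |T#| = trans (|twos| proj₁ white (model sh)) (trans (weigh-model _ _ _) (sym (trans (cong (twoCount white sh +_) (weigh-+ _ _ _ _ _ _ white sh))
    (trans (weigh-+ _ _ _ _ _ _ white sh) (weigh-cong (λ _ → refl) (λ _ → refl) (λ { white → refl ; black → refl ; grey → refl }) white sh)))))

module Tup (n : ℕ) (la mu nu : Partition n) where

  type : Colour → Partition n
  type white = la
  type black = mu
  type grey = nu

  -- The degree conditions are the only data kept: the numbers of vertices and thorns required of a
  -- thorn cactus tree follow from them, as `thornCactus` shows.
  Deg : Shape → Set
  Deg sh = degrees white (toTree sh) ≈ₘ parts la × degrees black (toTree sh) ≈ₘ parts mu × degrees grey (toTree sh) ≈ₘ parts nu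

  deg : ∀ sh → Deg sh → ∀ q → degrees q (toTree sh) ≈ₘ parts (type q)
  deg sh (a , b , c) white = a
  deg sh (a , b , c) black = b
  deg sh (a , b , c) grey = c

  -- A vertex has as many slots as its degree, and the degrees of one colour form a partition of n.
  balanced : ∀ sh → Deg sh → ∀ q → length (ofCol proj₁ q (labels (model sh))) ≡ n
  balanced sh d q = begin
    length (ofCol proj₁ q (labels (model sh)))      ≡⟨ length-ofCol-labels proj₁ (model sh) (coloured-number white 0 sh) q ⟩
    sum (map length (vertsOf q (model sh)))         ≡⟨ ℕSum.sum-↭ (degrees↭ q (model sh)) ⟨
    sum (degrees q (toTree (shape (model sh))))     ≡⟨ cong (λ s → sum (degrees q (toTree s))) (shape-number white 0 sh) ⟩
    sum (degrees q (toTree sh))                     ≡⟨ ℕSum.sum-↭ (≈ₘ⇒↭ (deg sh d q)) ⟩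
    sum (parts (type q))                            ≡⟨ sum-parts (type q) ⟩
    n                                               ∎
    where open ≡-Reasoning

  module _ (sh : Shape) (d : Deg sh) where
    private
      th on tw : Colour → ℕ
      th q = thornCount q sh
      on q = oneCount q sh
      tw q = twoCount q sh

    slot-count : ∀ q → n ≡ th (next q) + (on q + (on (next q) + (tw white + (tw black + tw grey))))
    slot-count q = trans (sym (balanced sh d (next q))) (trans (Cp.|L| sh q)
      (cong₂ _+_ (|S#| sh (next q)) (cong₂ _+_ (|E#| sh q) (cong₂ _+_ (|E#| sh (next q)) (|T#| sh)))))

    vertex-count : ∀ q → numVertices q (toTree sh) ≡ ℓ (type q)
    vertex-count q = trans (sym (length-map degree (ofColour q (toTree sh)))) (↭-length (≈ₘ⇒↭ (deg sh d q)))

    |la| : ℓ la ≡ 1 + (on grey + (tw grey + tw black))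
    |la| = trans (sym (vertex-count white)) (numVertices-toTree grey sh)
    |mu| : ℓ mu ≡ on white + (tw white + tw grey)
    |mu| = trans (sym (vertex-count black)) (numVertices-toTree white sh)
    |nu| : ℓ nu ≡ on black + (tw black + tw white)
    |nu| = trans (sym (vertex-count grey)) (numVertices-toTree black sh)

    private
      τ = toTree sh
      g = trianglesRootedAt grey τ
      w = trianglesRootedAt white τ
      b = trianglesRootedAt black τ

    -- Adding vertices to thorns gives the white slots of `slot-count` with two corrections: 1 for
    -- the root, and `g` because a triangle rooted at a grey vertex supplies both a white and a
    -- black vertex.
    white-count : th white + ℓ la + ℓ mu ≡ n + 1 + g
    white-count rewrite |la| | |mu| | triangles-toTree grey sh = trans
      (solve 6 (λ t a b x y z → t :+ (con 1 :+ (b :+ (z :+ y))) :+ (a :+ (x :+ z)) := (t :+ (b :+ (a :+ (x :+ (y :+ z))))) :+ con 1 :+ z) refl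
        (th white) (on white) (on grey) (tw white) (tw black) (tw grey))
      (cong (λ m → m + 1 + tw grey) (sym (slot-count grey)))
      where open +-*-Solver

    black-count : th black + ℓ mu + ℓ nu ≡ n + w
    black-count rewrite |mu| | |nu| | triangles-toTree white sh = trans
      (solve 6 (λ t a b x y z → t :+ (a :+ (x :+ z)) :+ (b :+ (y :+ x)) := (t :+ (a :+ (b :+ (x :+ (y :+ z))))) :+ x) refl
        (th black) (on white) (on black) (tw white) (tw black) (tw grey))
      (cong (_+ tw white) (sym (slot-count white)))
      where open +-*-Solver

    grey-count : th grey + ℓ la + ℓ nu ≡ n + 1 + b
    grey-count rewrite |la| | |nu| | triangles-toTree black sh = trans
      (solve 6 (λ t a b x y z → t :+ (con 1 :+ (a :+ (z :+ y))) :+ (b :+ (y :+ x)) := (t :+ (b :+ (a :+ (x :+ (y :+ z))))) :+ con 1 :+ y) refl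
        (th grey) (on grey) (on black) (tw white) (tw black) (tw grey))
      (cong (λ m → m + 1 + tw black) (sym (slot-count black)))
      where open +-*-Solver

    one-count : on black + w + b ≡ ℓ nu
    one-count rewrite |nu| | triangles-toTree white sh | triangles-toTree black sh =
      solve 3 (λ o x y → o :+ x :+ y := o :+ (y :+ x)) refl (on black) (tw white) (tw black)
      where open +-*-Solver

    thornCactus : IsThornCactus n la mu nu g w b τ
    thornCactus = record
      { valid = toTree-valid sh
      ; #white = vertex-count white ; #black = vertex-count black ; #grey = vertex-count grey
      ; triGrey = refl ; triWhite = refl ; triBlack = refl
      ; thornsW = subst (λ t → t + ℓ la + ℓ mu ≡ n + 1 + g) (sym (thornsOn-toTree white sh)) white-count
      ; thornsB = subst (λ t → t + ℓ mu + ℓ nu ≡ n + w) (sym (thornsOn-toTree black sh)) black-count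
      ; thornsG = subst (λ t → t + ℓ la + ℓ nu ≡ n + 1 + b) (sym (thornsOn-toTree grey sh)) grey-count
      ; degW = deg sh d white ; degB = deg sh d black ; degG = deg sh d grey }

  -- A tuple stripped of all numbers that its tree determines. The domains of the choices are the
  -- actual lists of thorns and edges of the shape.
  Args : Set
  Args = Σ Shape λ sh → Deg sh × S (length (Cp.S# sh grey)) × S (length (Cp.S# sh black)) ×
    OP (length (Cp.S# sh white)) (length (Cp.E# sh black))

  canon : Args → Tuples n la mu nu
  canon (sh , d , σ₁ , σ₂ , χ) = g , w , b , -, -, -, -,
    subst (λ t → t + ℓ la + ℓ nu ≡ n + 1 + b) (sym (|S#| sh grey)) (grey-count sh d) ,
    subst (λ t → t + ℓ mu + ℓ nu ≡ n + w) (sym (|S#| sh black)) (black-count sh d) ,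
    subst (λ t → t + ℓ la + ℓ mu ≡ n + 1 + g) (sym (|S#| sh white)) (white-count sh d) ,
    subst (λ r → r + w + b ≡ ℓ nu) (sym (|E#| sh black)) (one-count sh d) ,
    (toTree sh , thornCactus sh d) , σ₁ , σ₂ , χ
    where
    g = trianglesRootedAt grey (toTree sh)
    w = trianglesRootedAt white (toTree sh)
    b = trianglesRootedAt black (toTree sh)

  private
    cactus-irrelevant : ∀ {g w b τ} (x y : IsThornCactus n la mu nu g w b τ) → x ≡ y
    cactus-irrelevant
      record { valid = a₁ ; #white = b₁ ; #black = c₁ ; #grey = d₁ ; triGrey = e₁ ; triWhite = f₁ ; triBlack = g₁ ; thornsW = h₁ ; thornsB = i₁ ; thornsG = j₁ ; degW = k₁ ; degB = l₁ ; degG = m₁ }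
      record { valid = a₂ ; #white = b₂ ; #black = c₂ ; #grey = d₂ ; triGrey = e₂ ; triWhite = f₂ ; triBlack = g₂ ; thornsW = h₂ ; thornsB = i₂ ; thornsG = j₂ ; degW = k₂ ; degB = l₂ ; degG = m₂ }
      with refl ← T-irrelevant a₁ a₂ | refl ← ≡-irrelevant b₁ b₂ | refl ← ≡-irrelevant c₁ c₂ | refl ← ≡-irrelevant d₁ d₂ | refl ← ≡-irrelevant e₁ e₂ | refl ← ≡-irrelevant f₁ f₂ | refl ← ≡-irrelevant g₁ g₂ | refl ← ≡-irrelevant h₁ h₂ | refl ← ≡-irrelevant i₁ i₂ | refl ← ≡-irrelevant j₁ j₂ | refl ← ≡-irrelevant k₁ k₂ | refl ← ≡-irrelevant l₁ l₂ | refl ← ≡-irrelevant m₁ m₂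
      = refl

    tuple-cong : ∀ {g w b m₁ m₂ m₃ r τ} {e₁ e₁′ : m₁ + ℓ la + ℓ nu ≡ n + 1 + b} {e₂ e₂′ : m₂ + ℓ mu + ℓ nu ≡ n + w}
      {e₃ e₃′ : m₃ + ℓ la + ℓ mu ≡ n + 1 + g} {e₄ e₄′ : r + w + b ≡ ℓ nu} {i i′ : IsThornCactus n la mu nu g w b τ}
      {σ₁ : S m₁} {σ₂ : S m₂} {χ : OP m₃ r} →
      _≡_ {A = Tuples n la mu nu} (g , w , b , m₁ , m₂ , m₃ , r , e₁ , e₂ , e₃ , e₄ , (τ , i) , σ₁ , σ₂ , χ)
                                   (g , w , b , m₁ , m₂ , m₃ , r , e₁′ , e₂′ , e₃′ , e₄′ , (τ , i′) , σ₁ , σ₂ , χ)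
    tuple-cong {e₁ = e₁} {e₁′} {e₂} {e₂′} {e₃} {e₃′} {e₄} {e₄′} {i} {i′}
      with refl ← ≡-irrelevant e₁ e₁′ | refl ← ≡-irrelevant e₂ e₂′ | refl ← ≡-irrelevant e₃ e₃′ | refl ← ≡-irrelevant e₄ e₄′
         | refl ← cactus-irrelevant i i′ = refl

    tuple-injective : ∀ {g w b m₁ m₂ m₃ r e₁ e₂ e₃ e₄ ct σ₁ σ₁′ σ₂ σ₂′ χ χ′} →
      _≡_ {A = Tuples n la mu nu} (g , w , b , m₁ , m₂ , m₃ , r , e₁ , e₂ , e₃ , e₄ , ct , σ₁ , σ₂ , χ)
                                   (g , w , b , m₁ , m₂ , m₃ , r , e₁ , e₂ , e₃ , e₄ , ct , σ₁′ , σ₂′ , χ′) →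
      σ₁ ≡ σ₁′ × σ₂ ≡ σ₂′ × χ ≡ χ′
    tuple-injective refl = refl , refl , refl

    tree : Tuples n la mu nu → Tree
    tree (_ , _ , _ , _ , _ , _ , _ , _ , _ , _ , _ , (τ , _) , _) = τ

    cancel₂ : ∀ {m m′ a c s} → m + a + c ≡ s → m′ + a + c ≡ s → m ≡ m′
    cancel₂ {a = a} {c} e e′ = ℕP.+-cancelʳ-≡ a _ _ (ℕP.+-cancelʳ-≡ c _ _ (trans e (sym e′)))

  -- The numbers in a tuple are forced: `g`, `w`, `b` by the triangles of the tree and the remaining
  -- ones by cancellation in their equations.
  canon-surjective : ∀ t → ∃ λ x → canon x ≡ t
  canon-surjective (g , w , b , m₁ , m₂ , m₃ , r , e₁ , e₂ , e₃ , e₄ , (τ , ic) , σ₁ , σ₂ , χ)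
    with sh , refl ← fromTree τ (IsThornCactus.valid ic)
    with refl ← IsThornCactus.triGrey ic | refl ← IsThornCactus.triWhite ic | refl ← IsThornCactus.triBlack ic
    with d ← (IsThornCactus.degW ic , IsThornCactus.degB ic , IsThornCactus.degG ic)
    with refl ← trans (|S#| sh grey) (cancel₂ (grey-count sh d) e₁)
    with refl ← trans (|S#| sh black) (cancel₂ (black-count sh d) e₂)
    with refl ← trans (|S#| sh white) (cancel₂ (white-count sh d) e₃)
    with refl ← trans (|E#| sh black) (cancel₂ (one-count sh d) e₄)
    = (sh , d , σ₁ , σ₂ , χ) , tuple-cong

  canon-injective : ∀ x y → canon x ≡ canon y → x ≡ y
  canon-injective (sh , d@(p , q , r) , σ₁ , σ₂ , χ) (sh′ , d′@(p′ , q′ , r′) , σ₁′ , σ₂′ , χ′) e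
    with refl ← toItems-injective sh sh′ (node-injective (cong (just ∘ tree) e))
    with refl ← ≡-irrelevant p p′ | refl ← ≡-irrelevant q q′ | refl ← ≡-irrelevant r r′
    with refl , refl , refl ← tuple-injective e = refl

-- Permutations and set partitions as vectors.

∈-toList⁻ : ∀ {n} {a : A} (v : Vec A n) → a ∈ toList v → ∃ λ i → lookup v i ≡ a
∈-toList⁻ (x Vec.∷ v) (here e) = zero , sym e
∈-toList⁻ (x Vec.∷ v) (there p) with ∈-toList⁻ v p
... | i , e = suc i , e

∈-toList⁺ : ∀ {n} (v : Vec A n) i → lookup v i ∈ toList v
∈-toList⁺ (x Vec.∷ v) zero = here refl
∈-toList⁺ (x Vec.∷ v) (suc i) = there (∈-toList⁺ v i)

toList! : ∀ {n} (v : Vec A n) → (∀ {i j} → lookup v i ≡ lookup v j → i ≡ j) → Unique (toList v)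
toList! Vec.[] inj = []
toList! (x Vec.∷ v) inj = All.tabulate (λ { a∈ refl → case ∈-toList⁻ v a∈ of λ { (i , e) → case inj {suc i} {zero} e of λ () } }) ∷
  toList! v (FinP.suc-injective ∘ inj)

toList!⁻ : ∀ {n} (v : Vec A n) → Unique (toList v) → ∀ {i j} → lookup v i ≡ lookup v j → i ≡ j
toList!⁻ (x Vec.∷ v) (x∉ ∷ u) {zero} {zero} e = refl
toList!⁻ (x Vec.∷ v) (x∉ ∷ u) {zero} {suc j} e = contradiction e (All.lookup x∉ (∈-toList⁺ v j))
toList!⁻ (x Vec.∷ v) (x∉ ∷ u) {suc i} {zero} e = contradiction (sym e) (All.lookup x∉ (∈-toList⁺ v i))
toList!⁻ (x Vec.∷ v) (x∉ ∷ u) {suc i} {suc j} e = cong suc (toList!⁻ v u e)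

findᵇ-just : {X : Set} (p : X → Bool) (xs : List X) {x : X} → x ∈ xs → T (p x) → ∃ λ y → findᵇ p xs ≡ just y × T (p y)
findᵇ-just p (y ∷ ys) x∈ px with p y in eq
... | true = y , refl , subst T (sym eq) tt
findᵇ-just p (y ∷ ys) (here refl) px | false = contradiction (subst T eq px) id
findᵇ-just p (y ∷ ys) (there x∈) px | false = findᵇ-just p ys x∈ px

module _ {n : ℕ} (α : S n) where
  private
    v = proj₁ α
    v! = distinct⇒unique (toList v) (proj₂ α)

  perm-injective : ∀ {i j} → app α i ≡ app α j → i ≡ j
  perm-injective = toList!⁻ v v!

  -- By pigeonhole a vector without repetitions lists all of `Fin n`, so the search in `inverse`
  -- succeeds and never falls back on its default.
  inverseʳ : ∀ j → lookup v (lookup (inverse v) j) ≡ j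
  inverseʳ j with ∈-toList⁻ v (∈-resp-↭ (↭-sym (unique-⊆-↭ v! (λ {i} _ → ∈-allFin i)
        (ℕP.≤-reflexive (trans (length-tabulate id) (sym (VecP.length-toList v)))))) (∈-allFin j))
  ... | i , e with findᵇ-just (λ i → lookup v i ≡F j) (allFin n) (∈-allFin i) (≡⇒≡F e)
  ... | k , e′ , h = trans (cong (lookup v) (trans (VecP.lookup∘tabulate _ j) (cong (fromMaybe j) e′))) (≡F⇒≡ h)

  inverseˡ : ∀ i → lookup (inverse v) (lookup v i) ≡ i
  inverseˡ i = perm-injective (inverseʳ (lookup v i))

permutation : ∀ {n} (f : Fin n → Fin n) → (∀ {i j} → f i ≡ f j → i ≡ j) → S n
permutation f inj = tabulate f , unique⇒distinct (toList! (tabulate f)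
  (λ {i} {j} e → inj (trans (sym (VecP.lookup∘tabulate f i)) (trans e (VecP.lookup∘tabulate f j)))))

lookup-∷ʳ-inject₁ : ∀ {n} (xs : Vec A n) x i → lookup (xs Vec.∷ʳ x) (Fin.inject₁ i) ≡ lookup xs i
lookup-∷ʳ-inject₁ (y Vec.∷ xs) x zero = refl
lookup-∷ʳ-inject₁ (y Vec.∷ xs) x (suc i) = lookup-∷ʳ-inject₁ xs x i

lookup-∷ʳ-last : ∀ {n} (xs : Vec A n) x → lookup (xs Vec.∷ʳ x) (Fin.fromℕ n) ≡ x
lookup-∷ʳ-last Vec.[] x = refl
lookup-∷ʳ-last (y Vec.∷ xs) x = lookup-∷ʳ-last xs x

vec-ext : ∀ {n} {v w : Vec A n} → (∀ i → lookup v i ≡ lookup w i) → v ≡ w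
vec-ext {v = v} {w} h = trans (sym (VecP.tabulate∘lookup v)) (trans (VecP.tabulate-cong h) (VecP.tabulate∘lookup w))

least : ∀ {n} (p : Fin n → Bool) i → T (p i) → ∃ λ k → T (p k) × (∀ j → T (p j) → toℕ k ≤ toℕ j)
least {suc n} p i pi with p zero in eq
... | true = zero , subst T (sym eq) tt , λ _ _ → z≤n
least {suc n} p zero pi | false = contradiction (subst T eq pi) id
least {suc n} p (suc i) pi | false with least (p ∘ suc) i pi
... | k , pk , min = suc k , pk , λ { zero pj → contradiction (subst T eq pj) id ; (suc j) pj → s≤s (min j pj) }

module _ {n : ℕ} where

  minLabelling⁻ : (π : SetPartition n) → let f = lookup (proj₁ π) in ∀ i → toℕ (f i) ≤ toℕ i × f (f i) ≡ f i
  minLabelling⁻ (f , ok) i with ∧⁻ {toℕ (lookup f i) ≤ᵇ toℕ i} (All.lookup (allᵇ⁻ (allFin n) ok) (∈-allFin i))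
  ... | a , b = ℕP.≤ᵇ⇒≤ _ _ a , ≡F⇒≡ b

  -- Both labellings take the minimum of the same class: applying each of them to the label given by
  -- the other yields the two inequalities.
  minLabelling-unique : (π π′ : SetPartition n) → let f = lookup (proj₁ π) ; f′ = lookup (proj₁ π′) in
    (∀ i j → f i ≡ f j → f′ i ≡ f′ j) → (∀ i j → f′ i ≡ f′ j → f i ≡ f j) → π ≡ π′
  minLabelling-unique π@(f , ok) π′@(f′ , ok′) h h′ with vec-ext {v = f} {f′} (λ i → FinP.toℕ-injective (ℕP.≤-antisym
      (subst (λ k → toℕ k ≤ toℕ (lookup f′ i)) (h′ _ _ (proj₂ (minLabelling⁻ π′ i))) (proj₁ (minLabelling⁻ π (lookup f′ i))))
      (subst (λ k → toℕ k ≤ toℕ (lookup f i)) (h _ _ (proj₂ (minLabelling⁻ π i))) (proj₁ (minLabelling⁻ π′ (lookup f i))))))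
  ... | refl = cong (f ,_) (T-irrelevant ok ok′)

  module _ {X : Set} (_≟X_ : DecidableEquality X) (key : Fin n → X) where
    private
      least-key : ∀ i → ∃ λ k → T ⌊ key k ≟X key i ⌋ × (∀ j → T ⌊ key j ≟X key i ⌋ → toℕ k ≤ toℕ j)
      least-key i = least (λ j → ⌊ key j ≟X key i ⌋) i (same refl)
        where
        same : ∀ {x y} → x ≡ y → T ⌊ x ≟X y ⌋
        same {x} {y} e with x ≟X y
        ... | yes _ = tt
        ... | no ne = ne e

      yes⁻ : ∀ {x y} → T ⌊ x ≟X y ⌋ → x ≡ y
      yes⁻ {x} {y} h with x ≟X y
      ... | yes e = e

      yes⁺ : ∀ {x y} → x ≡ y → T ⌊ x ≟X y ⌋
      yes⁺ {x} {y} e with x ≟X y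
      ... | yes _ = tt
      ... | no ne = ne e

      first : Fin n → Fin n
      first i = proj₁ (least-key i)

      key-first : ∀ i → key (first i) ≡ key i
      key-first i = yes⁻ (proj₁ (proj₂ (least-key i)))

      first-cong : ∀ {i j} → key i ≡ key j → first i ≡ first j
      first-cong {i} {j} e = FinP.toℕ-injective (ℕP.≤-antisym
        (proj₂ (proj₂ (least-key i)) (first j) (yes⁺ (trans (key-first j) (sym e))))
        (proj₂ (proj₂ (least-key j)) (first i) (yes⁺ (trans (key-first i) e))))

      lk : ∀ i → lookup (tabulate first) i ≡ first i
      lk = VecP.lookup∘tabulate first

    kernel : SetPartition n
    kernel = tabulate first , allᵇ⁺ {p = λ i → (toℕ (lookup (tabulate first) i) ≤ᵇ toℕ i) ∧ (lookup (tabulate first) (lookup (tabulate first) i) ≡F lookup (tabulate first) i)} {xs = allFin n} (All.tabulate (λ {i} _ → ∧⁺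
      (subst (λ k → T (toℕ k ≤ᵇ toℕ i)) (sym (lk i)) (ℕP.≤⇒≤ᵇ (proj₂ (proj₂ (least-key i)) i (yes⁺ refl))))
      (≡⇒≡F (trans (cong (lookup (tabulate first)) (lk i)) (trans (lk (first i)) (trans (first-cong (key-first i)) (sym (lk i))))))))

    kernel⁺ : ∀ {i j} → key i ≡ key j → lookup (proj₁ kernel) i ≡ lookup (proj₁ kernel) j
    kernel⁺ {i} {j} e = trans (lk i) (trans (first-cong e) (sym (lk j)))

    kernel⁻ : ∀ {i j} → lookup (proj₁ kernel) i ≡ lookup (proj₁ kernel) j → key i ≡ key j
    kernel⁻ {i} {j} e = trans (sym (key-first i)) (trans (cong key (trans (sym (lk i)) (trans e (lk j)))) (key-first j))

Same : List (List A) → A → A → Set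
Same vs a b = ∃ λ v → v ∈ vs × a ∈ v × b ∈ v

module _ {n : ℕ} (π : SetPartition n) {vs : List (List A)} (slot : Fin n → A)
  (slot-injective : ∀ {i j} → slot i ≡ slot j → i ≡ j) (vs! : Unique (concat vs)) (nonempty : ∀ {v} → v ∈ vs → v ≢ [])
  (into : ∀ {v a} → v ∈ vs → a ∈ v → ∃ λ i → slot i ≡ a)
  (same⁺ : ∀ i j → lookup (proj₁ π) i ≡ lookup (proj₁ π) j → Same vs (slot i) (slot j))
  (same⁻ : ∀ i j → Same vs (slot i) (slot j) → lookup (proj₁ π) i ≡ lookup (proj₁ π) j) where
  private
    f = lookup (proj₁ π)

    class : Fin n → List A
    class i = proj₁ (same⁺ i i refl)

    class∈ : ∀ i → class i ∈ vs
    class∈ i = proj₁ (proj₂ (same⁺ i i refl))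

    ∈class : ∀ i → slot i ∈ class i
    ∈class i = proj₁ (proj₂ (proj₂ (same⁺ i i refl)))

    class-cong : ∀ {i v} → v ∈ vs → slot i ∈ v → class i ≡ v
    class-cong {i} v∈ p = ∈-concat-unique vs! (class∈ i) v∈ (∈class i) p

    reps = filter (λ r → T? (f r ≡F r)) (allFin n)

    reps⁻ : ∀ {r} → r ∈ reps → f r ≡ r
    reps⁻ r∈ = ≡F⇒≡ (proj₂ (∈-filter⁻ (λ r → T? (f r ≡F r)) {xs = allFin n} r∈))

    classes↭ : map class reps ↭ vs
    classes↭ = unique-set-↭
      (unique-map-on class (λ {r} {r′} p q e → trans (sym (reps⁻ p)) (trans
          (same⁻ r r′ (class r , class∈ r , ∈class r , subst (slot r′ ∈_) (sym e) (∈class r′))) (reps⁻ q)))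
        (UniqP.filter⁺ _ (UniqP.allFin⁺ n)))
      (concat-unique⇒unique-list vs! nonempty)
      (λ v∈ → case ∈-map⁻ class v∈ of λ { (r , _ , refl) → class∈ r })
      (λ { {[]} v∈ → contradiction refl (nonempty v∈) ; {a ∷ v} v∈ → onto v∈ (here refl) })
      where
      onto : ∀ {v a} → v ∈ vs → a ∈ v → v ∈ map class reps
      onto {v} v∈ a∈ with into v∈ a∈
      ... | i , refl with same⁺ (f i) i (proj₂ (minLabelling⁻ π i))
      ... | w , w∈ , p , q with refl ← ∈-concat-unique vs! w∈ v∈ q a∈ =
        subst (_∈ map class reps) (class-cong v∈ p) (∈-map⁺ class
          (∈-filter⁺ (λ r → T? (f r ≡F r)) (∈-allFin (f i)) (≡⇒≡F (proj₂ (minLabelling⁻ π i)))))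

    size-class : ∀ {r} → r ∈ reps → countᵇ (λ j → f j ≡F r) (allFin n) ≡ length (class r)
    size-class {r} r∈ = trans (sym (length-map slot members)) (↭-length (unique-set-↭
      (UniqP.map⁺ slot-injective (UniqP.filter⁺ _ (UniqP.allFin⁺ n)))
      (concat-unique⇒unique vs! (class∈ r))
      (λ a∈ → case ∈-map⁻ slot a∈ of λ { (j , j∈ , refl) → fwd j (≡F⇒≡ (proj₂ (∈-filter⁻ (λ j → T? (f j ≡F r)) {xs = allFin n} j∈))) })
      (λ a∈ → case into (class∈ r) a∈ of λ { (j , refl) → ∈-map⁺ slot (∈-filter⁺ (λ j → T? (f j ≡F r)) (∈-allFin j)
          (≡⇒≡F (trans (same⁻ j r (class r , class∈ r , a∈ , ∈class r)) (reps⁻ r∈)))) })))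
      where
      members = filter (λ j → T? (f j ≡F r)) (allFin n)
      fwd : ∀ j → f j ≡ r → slot j ∈ class r
      fwd j e with same⁺ j r (trans e (sym (reps⁻ r∈)))
      ... | w , w∈ , p , q with refl ← class-cong w∈ q = p

  -- Each block is represented by its least element, and the member of `vs` containing the slot of
  -- that element is its image under `slot`. This matches blocks with members of `vs` of the same
  -- size.
  blockSizes↭ : blockSizes π ↭ map length vs
  blockSizes↭ = ↭-trans (↭-reflexive (trans (map-cong-local (All.tabulate size-class)) (map-∘ reps))) (PermP.map⁺ length classes↭)

-- Partitioned cacti as tours.

module _ (m : ℕ) where
  private
    n = suc m

  γ-inject₁ : ∀ i → lookup (γ n) (Fin.inject₁ i) ≡ suc i
  γ-inject₁ i = trans (lookup-∷ʳ-inject₁ (Vec.map suc (Vec.allFin m)) zero i)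
    (trans (VecP.lookup-map i suc (Vec.allFin m)) (cong suc (VecP.lookup-allFin i)))

  γ-last : lookup (γ n) (Fin.fromℕ m) ≡ zero
  γ-last = lookup-∷ʳ-last (Vec.map suc (Vec.allFin m)) zero

  γS : S n
  γS = γ n , unique⇒distinct (subst Unique (sym (VecP.toList-∷ʳ zero (Vec.map suc (Vec.allFin m))))
    (UniqP.++⁺ (subst Unique (sym (VecP.toList-map suc (Vec.allFin m))) (UniqP.map⁺ FinP.suc-injective (toList! (Vec.allFin m)
       (λ {i} {j} e → trans (sym (VecP.lookup-allFin i)) (trans e (VecP.lookup-allFin j))))))
      ([] ∷ [])
      λ { (p , here refl) → case ∈-map⁻ suc (subst (zero ∈_) (VecP.toList-map suc (Vec.allFin m)) p) of λ () }))

module Tours (m : ℕ) (la mu nu : Partition (suc m)) where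
  n = suc m

  TS : Set
  TS = Colour × Fin n

  _≟T_ : DecidableEquality TS
  _≟T_ = ProdP.≡-dec _≟C_ FinP._≟_

  cyc : Fin n → Fin n
  cyc = lookup (γ n)

  cyc⁻ : Fin n → Fin n
  cyc⁻ = lookup (inverse (γ n))

  -- A cactus in terms of its walk alone: at time `t` a white, a grey and a black vertex are left in
  -- turn, and the next time is `cyc t`. The type of vertices is arbitrary, because they are block
  -- labels when the tour comes from a cactus and slot lists when it comes from a tree.
  record IsTour {X : Set} (π : TS → TS) (own : TS → X) : Set where
    field
      cube    : ∀ s → π (π (π s)) ≡ s
      turn    : ∀ s → next (proj₁ (π s)) ≡ proj₁ s
      step-wg : ∀ t → own (π (white , t)) ≡ own (grey , t)
      step-gb : ∀ t → own (π (grey , t)) ≡ own (black , t)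
      step-bw : ∀ t → own (π (black , t)) ≡ own (white , cyc t)
      colour  : ∀ {s s′} → own s ≡ own s′ → proj₁ s ≡ proj₁ s′

    π-white : ∀ i → π (white , i) ≡ (grey , proj₂ (π (white , i)))
    π-white i = cong (_, proj₂ (π (white , i))) (next-injective (turn (white , i)))
    π-black : ∀ i → π (black , i) ≡ (white , proj₂ (π (black , i)))
    π-black i = cong (_, proj₂ (π (black , i))) (next-injective (turn (black , i)))

  type# : Colour → Partition n
  type# white = la
  type# black = mu
  type# grey = nu

  -- The slot (q , t) is the one through which the walk leaves the t-th vertex of colour q that it visits; the triangle
  -- i ∈ [n] consists of the slots (white , i), (grey , σ⁻ i) and (black , τ⁻ i).
  module Of (c : C n la mu nu) where
    private
      π₁ = proj₁ (proj₁ c)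
      π₂ = proj₁ (proj₂ (proj₁ c))
      π₃ = proj₁ (proj₂ (proj₂ (proj₁ c)))
      α₁ = proj₁ (proj₂ (proj₂ (proj₂ (proj₁ c))))
      α₂ = proj₂ (proj₂ (proj₂ (proj₂ (proj₁ c))))
      open IsP3Cactus (proj₂ c)

    part# : Colour → SetPartition n
    part# white = π₁
    part# black = π₂
    part# grey = π₃

    typed : ∀ q → HasType (part# q) (type# q)
    typed white = type₁
    typed black = type₂
    typed grey = type₃

    f : Colour → Fin n → Fin n
    f q = lookup (proj₁ (part# q))

    a₁ a₂ b₁ b₂ : Fin n → Fin n
    a₁ = app α₁
    a₂ = app α₂
    b₁ = lookup (inverse (proj₁ α₁))
    b₂ = lookup (inverse (proj₁ α₂))

    -- `σ` is `α₃`, and `τ` is the inverse of `α₁` after the long cycle, that is, `α₂` after `α₃`.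
    σ τ σ⁻ τ⁻ : Fin n → Fin n
    τ = b₁ ∘ cyc
    τ⁻ = cyc⁻ ∘ a₁
    σ = b₂ ∘ τ
    σ⁻ = τ⁻ ∘ a₂

    b₁a₁ : ∀ i → b₁ (a₁ i) ≡ i
    b₁a₁ = inverseˡ α₁
    b₂a₂ : ∀ i → b₂ (a₂ i) ≡ i
    b₂a₂ = inverseˡ α₂

    ττ⁻ : ∀ i → τ (τ⁻ i) ≡ i
    ττ⁻ i = trans (cong b₁ (inverseʳ (γS m) (a₁ i))) (inverseˡ α₁ i)
    τ⁻τ : ∀ i → τ⁻ (τ i) ≡ i
    τ⁻τ i = trans (cong cyc⁻ (inverseʳ α₁ (cyc i))) (inverseˡ (γS m) i)
    σσ⁻ : ∀ i → σ (σ⁻ i) ≡ i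
    σσ⁻ i = trans (cong b₂ (ττ⁻ (a₂ i))) (inverseˡ α₂ i)
    σ⁻σ : ∀ i → σ⁻ (σ i) ≡ i
    σ⁻σ i = trans (cong τ⁻ (inverseʳ α₂ (τ i))) (τ⁻τ i)

    π : TS → TS
    π (white , i) = grey , σ⁻ i
    π (grey , t) = black , τ⁻ (σ t)
    π (black , t) = white , τ t

    -- An element of the block left at this moment. At time `t` the white and the grey block contain
    -- `t` itself, the black one contains `α₃ t`; for grey, `t` and `α₃ t` lie in the same block.
    index# : TS → Fin n
    index# (white , t) = t
    index# (grey , t) = t
    index# (black , t) = σ t

    slot# : Colour → Fin n → TS
    slot# white i = white , i
    slot# grey i = grey , i
    slot# black i = black , σ⁻ i

    own : TS → TS
    own s = proj₁ s , f (proj₁ s) (index# s)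

    slot-index : ∀ s → slot# (proj₁ s) (index# s) ≡ s
    slot-index (white , t) = refl
    slot-index (grey , t) = refl
    slot-index (black , t) = cong (black ,_) (σ⁻σ t)

    own-slot : ∀ q i → own (slot# q i) ≡ (q , f q i)
    own-slot white i = refl
    own-slot grey i = refl
    own-slot black i = cong (λ j → black , f black j) (σσ⁻ i)

    private
      union⁻ : ∀ (ρ : SetPartition n) α → T (unionOfCyclesᵇ ρ α) → ∀ i → lookup (proj₁ ρ) (lookup α i) ≡ lookup (proj₁ ρ) i
      union⁻ ρ α h i = ≡F⇒≡ (All.lookup (allᵇ⁻ (allFin n) h) (∈-allFin i))

      α₃-lookup : ∀ i → lookup (inverse (proj₁ α₂) ∘ₚ (inverse (proj₁ α₁) ∘ₚ γ n)) i ≡ σ i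
      α₃-lookup i = trans (VecP.lookup-map i b₂ (inverse (proj₁ α₁) ∘ₚ γ n)) (cong b₂ (VecP.lookup-map i b₁ (γ n)))

      inv-b₁ : ∀ i → f white (b₁ i) ≡ f white i
      inv-b₁ i = trans (sym (union⁻ π₁ (proj₁ α₁) inv₁ (b₁ i))) (cong (f white) (inverseʳ α₁ i))
      inv-b₂ : ∀ i → f black (b₂ i) ≡ f black i
      inv-b₂ i = trans (sym (union⁻ π₂ (proj₁ α₂) inv₂ (b₂ i))) (cong (f black) (inverseʳ α₂ i))
      inv-σ : ∀ i → f grey (σ i) ≡ f grey i
      inv-σ i = trans (cong (f grey) (sym (α₃-lookup i))) (union⁻ π₃ (inverse (proj₁ α₂) ∘ₚ (inverse (proj₁ α₁) ∘ₚ γ n)) inv₃ i)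

    isTour : IsTour π own
    isTour = record
      { cube = λ { (white , i) → cong (white ,_) (trans (ττ⁻ _) (σσ⁻ i))
                 ; (grey , t) → cong (grey ,_) (trans (cong σ⁻ (ττ⁻ _)) (σ⁻σ t))
                 ; (black , t) → cong (black ,_) (trans (cong τ⁻ (σσ⁻ _)) (τ⁻τ t)) }
      ; turn = λ { (white , i) → refl ; (grey , i) → refl ; (black , i) → refl }
      ; step-wg = λ t → cong (grey ,_) (trans (sym (inv-σ (σ⁻ t))) (cong (f grey) (σσ⁻ t)))
      ; step-gb = λ t → cong (black ,_) (trans (cong (f black ∘ b₂) (ττ⁻ (σ t))) (inv-b₂ (σ t)))
      ; step-bw = λ t → cong (white ,_) (inv-b₁ (cyc t))
      ; colour = cong proj₁ }

    -- Two applications of `π` lead from white `i` to black `τ⁻ i`, and `cyc` cancels the inverse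
    -- cycle in `τ⁻`. With `a₂-π` this recovers both permutations from the rotation.
    a₁-π : ∀ i → a₁ i ≡ cyc (proj₂ (π (π (white , i))))
    a₁-π i = trans (sym (inverseʳ (γS m) (a₁ i))) (cong (cyc ∘ τ⁻) (sym (σσ⁻ i)))

    a₂-π : ∀ i → a₂ i ≡ proj₂ (π (black , proj₂ (π (white , i))))
    a₂-π i = sym (ττ⁻ (a₂ i))

  open Of using () renaming (π to π#; own to own#) public

  perm-ext : ∀ (α β : S n) → (∀ i → app α i ≡ app β i) → α ≡ β
  perm-ext (v , p) (w , q) e with refl ← vec-ext {v = v} {w} e = cong (v ,_) (T-irrelevant p q)
  cactus≡ : ∀ {π₁ π₂ π₃ α₁ α₂} (x y : IsP3Cactus n la mu nu π₁ π₂ π₃ α₁ α₂) → x ≡ y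
  cactus≡ record { type₁ = a₁ ; type₂ = b₁ ; type₃ = c₁ ; inv₁ = d₁ ; inv₂ = e₁ ; inv₃ = f₁ }
          record { type₁ = a₂ ; type₂ = b₂ ; type₃ = c₂ ; inv₁ = d₂ ; inv₂ = e₂ ; inv₃ = f₂ }
    with refl ← ≡-irrelevant a₁ a₂ | refl ← ≡-irrelevant b₁ b₂ | refl ← ≡-irrelevant c₁ c₂
       | refl ← T-irrelevant d₁ d₂ | refl ← T-irrelevant e₁ e₂ | refl ← T-irrelevant f₁ f₂ = refl

  C-ext : ∀ {π₁ π₂ π₃ α₁ α₂ π₁′ π₂′ π₃′ α₁′ α₂′} {i : IsP3Cactus n la mu nu π₁ π₂ π₃ α₁ α₂} {i′ : IsP3Cactus n la mu nu π₁′ π₂′ π₃′ α₁′ α₂′} →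
    π₁ ≡ π₁′ → π₂ ≡ π₂′ → π₃ ≡ π₃′ → α₁ ≡ α₁′ → α₂ ≡ α₂′ →
    _≡_ {A = C n la mu nu} ((π₁ , π₂ , π₃ , α₁ , α₂) , i) ((π₁′ , π₂′ , π₃′ , α₁′ , α₂′) , i′)
  C-ext {i = i} {i′} refl refl refl refl refl = cong (_ ,_) (cactus≡ i i′)

  tour-determines : ∀ c c′ → (∀ s → π# c s ≡ π# c′ s) → (∀ s s′ → own# c s ≡ own# c s′ → own# c′ s ≡ own# c′ s′) →
    (∀ s s′ → own# c′ s ≡ own# c′ s′ → own# c s ≡ own# c s′) → c ≡ c′
  tour-determines c@((π₁ , π₂ , π₃ , α₁ , α₂) , i) c′@((π₁′ , π₂′ , π₃′ , α₁′ , α₂′) , i′) eπ h h′ = C-ext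
    (minLabelling-unique π₁ π₁′ (tr white) (tr′ white))
    (minLabelling-unique π₂ π₂′ (tr black) (tr′ black))
    (minLabelling-unique π₃ π₃′ (tr grey) (tr′ grey))
    (perm-ext α₁ α₁′ (λ j → trans (X.a₁-π j) (trans (cong (cyc ∘ proj₂) (trans (cong X.π (eπ (white , j))) (eπ (X′.π (white , j))))) (sym (X′.a₁-π j)))))
    (perm-ext α₂ α₂′ (λ j → trans (X.a₂-π j) (trans (cong proj₂ (trans (cong (λ s → X.π (black , proj₂ s)) (eπ (white , j))) (eπ (black , proj₂ (X′.π (white , j)))))) (sym (X′.a₂-π j)))))
    where
    module X = Of c
    module X′ = Of c′
    slot≡ : ∀ q i → X.slot# q i ≡ X′.slot# q i
    slot≡ white i = refl
    slot≡ grey i = refl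
    slot≡ black i = cong (λ s → black , proj₂ s) (eπ (white , i))
    tr : ∀ q i j → X.f q i ≡ X.f q j → X′.f q i ≡ X′.f q j
    tr q i j e = cong proj₂ (trans (sym (X′.own-slot q i)) (trans (cong X′.own (sym (slot≡ q i))) (trans
      (h _ _ (trans (X.own-slot q i) (trans (cong (q ,_) e) (sym (X.own-slot q j))))) (trans (cong X′.own (slot≡ q j)) (X′.own-slot q j)))))
    tr′ : ∀ q i j → X′.f q i ≡ X′.f q j → X.f q i ≡ X.f q j
    tr′ q i j e = cong proj₂ (trans (sym (X.own-slot q i)) (trans (cong X.own (slot≡ q i)) (trans
      (h′ _ _ (trans (X′.own-slot q i) (trans (cong (q ,_) e) (sym (X′.own-slot q j))))) (trans (cong X.own (sym (slot≡ q j))) (X.own-slot q j)))))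

  module Realise {X : Set} (_≟X_ : DecidableEquality X) (π : TS → TS) (own : TS → X) (tour : IsTour π own) where
    open IsTour tour

    private
      gw bw : Fin n → Fin n
      gw i = proj₂ (π (white , i))
      bw i = proj₂ (π (π (white , i)))

      π-inj : ∀ {s s′} → π s ≡ π s′ → s ≡ s′
      π-inj {s} {s′} e = trans (sym (cube s)) (trans (cong (π ∘ π) e) (cube s′))

      ππ-white : ∀ i → π (π (white , i)) ≡ (black , bw i)
      ππ-white i = cong (_, bw i) (next-injective (trans (turn (π (white , i))) (next-injective (turn (white , i)))))

      ππ-grey : ∀ i → π (π (grey , i)) ≡ (white , proj₂ (π (π (grey , i))))
      ππ-grey i = cong (_, proj₂ (π (π (grey , i)))) (next-injective (trans (turn (π (grey , i))) (next-injective (turn (grey , i)))))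

      π-bw : ∀ i → π (black , bw i) ≡ (white , i)
      π-bw i = trans (cong π (sym (ππ-white i))) (cube (white , i))

      -- The formulas of `a₁-π` and `a₂-π`, now read as definitions; `τt` and `σt` are the future
      -- `τ` and `σ`.
      A₁ A₂ τt σt : Fin n → Fin n
      A₁ i = cyc (bw i)
      A₂ i = proj₂ (π (black , gw i))
      τt t = proj₂ (π (black , t))
      σt t = proj₂ (π (π (grey , t)))

      A₁-inj : ∀ {i j} → A₁ i ≡ A₁ j → i ≡ j
      A₁-inj {i} {j} e = cong proj₂ (trans (sym (π-bw i)) (trans (cong (λ k → π (black , k)) (perm-injective (γS m) e)) (π-bw j)))

      A₂-inj : ∀ {i j} → A₂ i ≡ A₂ j → i ≡ j
      A₂-inj {i} {j} e = cong proj₂ (π-inj (trans (π-white i) (trans (cong (λ s → grey , proj₂ s)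
        (π-inj (trans (π-black (gw i)) (trans (cong (white ,_) e) (sym (π-black (gw j))))))) (sym (π-white j)))))

      α₁ α₂ : S n
      α₁ = permutation A₁ A₁-inj
      α₂ = permutation A₂ A₂-inj

      a₁≡ : ∀ i → app α₁ i ≡ A₁ i
      a₁≡ = VecP.lookup∘tabulate A₁
      a₂≡ : ∀ i → app α₂ i ≡ A₂ i
      a₂≡ = VecP.lookup∘tabulate A₂

      A₁-τ : ∀ t → A₁ (τt t) ≡ cyc t
      A₁-τ t = cong (cyc ∘ proj₂) (trans (cong (π ∘ π) (sym (π-black t))) (cube (black , t)))

      gw-σ : ∀ t → π (white , σt t) ≡ (grey , t)
      gw-σ t = trans (cong π (sym (ππ-grey t))) (cube (grey , t))

      A₂-σ : ∀ t → A₂ (σt t) ≡ τt t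
      A₂-σ t = cong (λ s → proj₂ (π (black , proj₂ s))) (gw-σ t)

      b₁≡ : ∀ t → lookup (inverse (proj₁ α₁)) (cyc t) ≡ τt t
      b₁≡ t = trans (cong (lookup (inverse (proj₁ α₁))) (sym (trans (a₁≡ (τt t)) (A₁-τ t)))) (inverseˡ α₁ (τt t))

      b₂≡ : ∀ t → lookup (inverse (proj₁ α₂)) (lookup (inverse (proj₁ α₁)) (cyc t)) ≡ σt t
      b₂≡ t = trans (cong (lookup (inverse (proj₁ α₂))) (trans (b₁≡ t) (sym (trans (a₂≡ (σt t)) (A₂-σ t))))) (inverseˡ α₂ (σt t))

    -- The counterpart of `slot#`: `gw` takes the place of the inverse of `α₃`.
    slotR : Colour → Fin n → TS
    slotR white i = white , i
    slotR grey i = grey , i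
    slotR black i = black , gw i

    slotR-injective : ∀ q {i j} → slotR q i ≡ slotR q j → i ≡ j
    slotR-injective white e = cong proj₂ e
    slotR-injective grey e = cong proj₂ e
    slotR-injective black {i} {j} e = cong proj₂ (π-inj (trans (π-white i) (trans (cong (λ s → grey , proj₂ s) e) (sym (π-white j)))))

    slotR-surjective : ∀ q t → ∃ λ i → slotR q i ≡ (q , t)
    slotR-surjective white t = t , refl
    slotR-surjective grey t = t , refl
    slotR-surjective black t = σt t , cong (λ s → black , proj₂ s) (gw-σ t)

    part : Colour → SetPartition n
    part q = kernel _≟X_ (own ∘ slotR q)

    private
      union⁺ : ∀ q α → (∀ i → own (slotR q (lookup α i)) ≡ own (slotR q i)) → T (unionOfCyclesᵇ (part q) α)
      union⁺ q α h = allᵇ⁺ {xs = allFin n} (All.tabulate (λ {i} _ → ≡⇒≡F (kernel⁺ _≟X_ (own ∘ slotR q) (h i))))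

      σ-lookup : ∀ i → lookup (inverse (proj₁ α₂) ∘ₚ (inverse (proj₁ α₁) ∘ₚ γ n)) i ≡ σt i
      σ-lookup i = trans (VecP.lookup-map i _ (inverse (proj₁ α₁) ∘ₚ γ n)) (trans (cong (lookup (inverse (proj₁ α₂))) (VecP.lookup-map i _ (γ n))) (b₂≡ i))

      white-inv : ∀ i → own (white , A₁ i) ≡ own (white , i)
      white-inv i = trans (sym (step-bw (bw i))) (cong own (π-bw i))

      black-inv : ∀ i → own (black , gw (A₂ i)) ≡ own (black , gw i)
      black-inv i = trans (sym (step-gb v)) (cong own (trans (cong π (sym eq)) (cube (black , gw i))))
        where
        v = gw (A₂ i)
        eq : π (π (black , gw i)) ≡ (grey , v)
        eq = trans (cong π (π-black (gw i))) (π-white (A₂ i))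

      grey-inv : ∀ t → own (grey , σt t) ≡ own (grey , t)
      grey-inv t = trans (sym (step-wg (σt t))) (cong own (gw-σ t))

    module _ (types : ∀ q → HasType (part q) (type# q)) where

      realise : C n la mu nu
      realise = (part white , part black , part grey , α₁ , α₂) , record
        { type₁ = types white ; type₂ = types black ; type₃ = types grey
        ; inv₁ = union⁺ white (proj₁ α₁) (λ i → trans (cong (λ k → own (white , k)) (a₁≡ i)) (white-inv i))
        ; inv₂ = union⁺ black (proj₁ α₂) (λ i → trans (cong (λ k → own (black , gw k)) (a₂≡ i)) (black-inv i))
        ; inv₃ = union⁺ grey (inverse (proj₁ α₂) ∘ₚ (inverse (proj₁ α₁) ∘ₚ γ n)) (λ i → trans (cong (λ k → own (grey , k)) (σ-lookup i)) (grey-inv i)) }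

    -- Only the values of the two permutations and the coincidences of block labels enter the
    -- comparison, so it is made for an arbitrary cactus with these values.
    module Agree (c : C n la mu nu) (h₁ : ∀ i → Of.a₁ c i ≡ A₁ i) (h₂ : ∀ i → Of.a₂ c i ≡ A₂ i)
      (hf⁺ : ∀ q i j → own (slotR q i) ≡ own (slotR q j) → Of.f c q i ≡ Of.f c q j)
      (hf⁻ : ∀ q i j → Of.f c q i ≡ Of.f c q j → own (slotR q i) ≡ own (slotR q j)) where
      private
        module R = Of c

        τ≡ : ∀ t → R.τ t ≡ τt t
        τ≡ t = trans (cong R.b₁ (sym (trans (h₁ (τt t)) (A₁-τ t)))) (R.b₁a₁ (τt t))

        σ≡ : ∀ t → R.σ t ≡ σt t
        σ≡ t = trans (cong R.b₂ (trans (τ≡ t) (sym (trans (h₂ (σt t)) (A₂-σ t))))) (R.b₂a₂ (σt t))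

      agree-π : ∀ s → R.π s ≡ π s
      agree-π (black , t) = trans (cong (white ,_) (τ≡ t)) (sym (π-black t))
      agree-π (white , i) = trans (sym (cube (grey , u))) (cong π (trans (ππ-grey u) (cong (white ,_) (trans (sym (σ≡ u)) (R.σσ⁻ i)))))
        where u = R.σ⁻ i
      agree-π (grey , t) = trans (sym (cube (black , u))) (trans (cong (π ∘ π) (trans (π-black u)
          (trans (cong (white ,_) (trans (sym (τ≡ u)) (trans (R.ττ⁻ (R.σ t)) (σ≡ t)))) (sym (ππ-grey t))))) (cong π (cube (grey , t))))
        where u = R.τ⁻ (R.σ t)

      private
        slot≡ : ∀ s → slotR (proj₁ s) (R.index# s) ≡ s
        slot≡ (white , t) = refl
        slot≡ (grey , t) = refl
        slot≡ (black , t) = trans (cong (λ s → black , proj₂ s) (sym (agree-π (white , R.σ t)))) (cong (black ,_) (R.σ⁻σ t))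

      agree-own⁺ : ∀ s s′ → own s ≡ own s′ → R.own s ≡ R.own s′
      agree-own⁺ s@(q , t) s′@(q′ , t′) e with refl ← colour e = cong (q ,_)
        (hf⁺ q _ _ (trans (cong own (slot≡ s)) (trans e (cong own (sym (slot≡ s′))))))

      agree-own⁻ : ∀ s s′ → R.own s ≡ R.own s′ → own s ≡ own s′
      agree-own⁻ s@(q , t) s′@(q′ , t′) e with refl ← cong proj₁ e = trans (cong own (sym (slot≡ s)))
        (trans (hf⁻ q _ _ (cong proj₂ e)) (cong own (slot≡ s′)))

    realisation : (∀ q → HasType (part q) (type# q)) → ∃ λ c → (∀ s → π# c s ≡ π s) ×
      (∀ s s′ → own s ≡ own s′ → own# c s ≡ own# c s′) × (∀ s s′ → own# c s ≡ own# c s′ → own s ≡ own s′)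
    realisation types = realise types , Z.agree-π , Z.agree-own⁺ , Z.agree-own⁻
      where
      hf⁺ : ∀ q i j → own (slotR q i) ≡ own (slotR q j) → Of.f (realise types) q i ≡ Of.f (realise types) q j
      hf⁺ white i j e = kernel⁺ _≟X_ (own ∘ slotR white) e
      hf⁺ black i j e = kernel⁺ _≟X_ (own ∘ slotR black) e
      hf⁺ grey i j e = kernel⁺ _≟X_ (own ∘ slotR grey) e
      hf⁻ : ∀ q i j → Of.f (realise types) q i ≡ Of.f (realise types) q j → own (slotR q i) ≡ own (slotR q j)
      hf⁻ white i j e = kernel⁻ _≟X_ (own ∘ slotR white) e
      hf⁻ black i j e = kernel⁻ _≟X_ (own ∘ slotR black) e
      hf⁻ grey i j e = kernel⁻ _≟X_ (own ∘ slotR grey) e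
      module Z = Agree (realise types) a₁≡ a₂≡ hf⁺ hf⁻

-- Vertices of one colour, and trails under renaming of slots.

module _ (col : A → Colour) (I : Items A) (cl : Coloured col white I) where
  private
    cv = cverts white I
    coloured : All (λ (d , x) → All (λ a → col a ≡ d) x) cv
    coloured = let cs = cdesc-coloured col white I cl in proj₁ cs ∷ proj₂ cs

    verts-cv : map proj₂ cv ≡ verts I
    verts-cv = cong (slots I ∷_) (map-cdesc white I)

  vertsOf⁻ : ∀ {q v} → v ∈ vertsOf q I → v ∈ verts I × (∀ {a} → a ∈ v → col a ≡ q)
  vertsOf⁻ {q} v∈ with ∈-map⁻ proj₂ v∈
  ... | (d , v) , p , refl with ∈-filter⁻ (λ p → proj₁ p ≟C q) {xs = cv} p
  ... | p′ , refl = subst (v ∈_) verts-cv (∈-map⁺ proj₂ p′) , All.lookup (All.lookup coloured p′)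

  vertsOf⁺ : ∀ {q v a} → v ∈ verts I → a ∈ v → col a ≡ q → v ∈ vertsOf q I
  vertsOf⁺ {q} {v} v∈ a∈ e with ∈-map⁻ proj₂ (subst (v ∈_) (sym verts-cv) v∈)
  ... | (d , v) , p , refl = ∈-map⁺ proj₂ (∈-filter⁺ (λ p → proj₁ p ≟C q) {xs = cv} p (trans (sym (All.lookup (All.lookup coloured p) a∈)) e))

  monochrome : ∀ {v a b} → v ∈ verts I → a ∈ v → b ∈ v → col a ≡ col b
  monochrome {b = b} v∈ a∈ b∈ = proj₂ (vertsOf⁻ (vertsOf⁺ {q = col b} v∈ b∈ refl)) a∈

  root-white : ∀ {a} → a ∈ slots I → col a ≡ white
  root-white = All.lookup (proj₁ (cdesc-coloured col white I cl))

  vertsOf! : ∀ q → Unique (concat (verts I)) → Unique (concat (vertsOf q I))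
  vertsOf! q u = go cv (subst (λ vs → Unique (concat vs)) (sym verts-cv) u)
    where
    go : ∀ ps → Unique (concat (map proj₂ ps)) → Unique (concat (map proj₂ (filter (λ p → proj₁ p ≟C q) ps)))
    go [] u = []
    go ((d , v) ∷ ps) u with unique-++⁻ v u
    ... | uv , ups , dis with d ≟C q
    ... | no _ = go ps ups
    ... | yes _ = UniqP.++⁺ uv (go ps ups) λ { (p , p′) → case ∈-concat⁻′ (map proj₂ (filter (λ p → proj₁ p ≟C q) ps)) p′ of λ
          { (w , a∈w , w∈) → case ∈-map⁻ proj₂ w∈ of λ { (e , e∈ , refl) →
            dis p (∈-concat⁺′ a∈w (∈-map⁺ proj₂ (proj₁ (∈-filter⁻ (λ p → proj₁ p ≟C q) {xs = ps} e∈)))) } } }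

∷ʳ≢[] : (xs : List A) {x : A} → xs ∷ʳ x ≢ []
∷ʳ≢[] [] ()
∷ʳ≢[] (_ ∷ _) ()

descendants-nonempty : ∀ (J : Items A) {v} → v ∈ descendants J → v ≢ []
descendants-nonempty (thorn s K) p = descendants-nonempty K p
descendants-nonempty (one s l J K) (here refl) e = ∷ʳ≢[] (slots J) e
descendants-nonempty (one s l J K) (there p) = [ descendants-nonempty J , descendants-nonempty K ]′ (∈-++⁻ (descendants J) p)
descendants-nonempty (two s l l′ J J′ K) (here refl) e = ∷ʳ≢[] (slots J) e
descendants-nonempty (two s l l′ J J′ K) (there (here refl)) e = ∷ʳ≢[] (slots J′) e
descendants-nonempty (two s l l′ J J′ K) (there (there p)) =
  [ descendants-nonempty J , (λ q → [ descendants-nonempty J′ , descendants-nonempty K ]′ (∈-++⁻ (descendants J′) q)) ]′ (∈-++⁻ (descendants J) p)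

-- The slot carrying a child is the image of the last slot of the child, so `next` of its colour is
-- the colour of that last slot, and a vertex has a single colour. Hence the colour of the root
-- fixes all others.
coloured-items : (col : A → Colour) {π : A → A} → ∀ c J → Edges π J → (∀ {a} → a ∈ labels J → next (col (π a)) ≡ col a) →
  (∀ {v a b} → v ∈ descendants J → a ∈ v → b ∈ v → col a ≡ col b) → (∀ {a} → a ∈ slots J → col a ≡ c) → Coloured col c J
coloured-items col c ∅ e t mono s = tt
coloured-items col c (thorn s K) e t mono sl = sl (here refl) , coloured-items col c K e (t ∘ there) mono (sl ∘ there)
coloured-items col c (one s l J K) (refl , eJ , eK) t mono sl = sl (here refl) , cl ,
  coloured-items col (next c) J eJ (t ∘ there ∘ there ∘ ∈-++⁺ˡ) (mono ∘ there ∘ ∈-++⁺ˡ)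
    (λ a∈ → trans (mono (here refl) (∈-++⁺ˡ a∈) (∈-++⁺ʳ (slots J) (here refl))) cl) ,
  coloured-items col c K eK (t ∘ there ∘ there ∘ ∈-++⁺ʳ (labels J)) (mono ∘ there ∘ ∈-++⁺ʳ (descendants J)) (sl ∘ there)
  where
  cl : col l ≡ next c
  cl = trans (sym (t (there (here refl)))) (cong next (sl (here refl)))
coloured-items col c (two s l l′ J J′ K) (refl , refl , eJ , eJ′ , eK) t mono sl = sl (here refl) , cl , cl′ ,
  coloured-items col (next c) J eJ (t ∘ there ∘ there ∘ there ∘ ∈-++⁺ˡ) (mono ∘ there ∘ there ∘ ∈-++⁺ˡ)
    (λ a∈ → trans (mono (here refl) (∈-++⁺ˡ a∈) (∈-++⁺ʳ (slots J) (here refl))) cl) ,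
  coloured-items col (next (next c)) J′ eJ′ (t ∘ there ∘ there ∘ there ∘ ∈-++⁺ʳ (labels J) ∘ ∈-++⁺ˡ)
    (mono ∘ there ∘ there ∘ ∈-++⁺ʳ (descendants J) ∘ ∈-++⁺ˡ)
    (λ a∈ → trans (mono (there (here refl)) (∈-++⁺ˡ a∈) (∈-++⁺ʳ (slots J′) (here refl))) cl′) ,
  coloured-items col c K eK (t ∘ there ∘ there ∘ there ∘ ∈-++⁺ʳ (labels J) ∘ ∈-++⁺ʳ (labels J′))
    (mono ∘ there ∘ there ∘ ∈-++⁺ʳ (descendants J) ∘ ∈-++⁺ʳ (descendants J′)) (sl ∘ there)
  where
  cl : col l ≡ next c
  cl = trans (sym (t (there (here refl)))) (cong next (sl (here refl)))
  cl′ : col l′ ≡ next (next c)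
  cl′ = trans (sym (t (there (there (here refl))))) (cong next cl)

unique-map-injective : (f : A → B) {xs : List A} → Unique (map f xs) → ∀ {a b} → a ∈ xs → b ∈ xs → f a ≡ f b → a ≡ b
unique-map-injective f u (here refl) (here refl) e = refl
unique-map-injective f (x∉ ∷ u) (here refl) (there q) e = contradiction e (All.lookup x∉ (∈-map⁺ f q))
unique-map-injective f (x∉ ∷ u) (there p) (here refl) e = contradiction (sym e) (All.lookup x∉ (∈-map⁺ f p))
unique-map-injective f (x∉ ∷ u) (there p) (there q) e = unique-map-injective f u p q e

map-injective-on : (f : A → B) (xs ys : List A) → (∀ {a b} → f a ≡ f b → a ≡ b) → map f xs ≡ map f ys → xs ≡ ys
map-injective-on f [] [] inj e = refl
map-injective-on f (x ∷ xs) (y ∷ ys) inj e = cong₂ _∷_ (inj (∷-injectiveˡ e)) (map-injective-on f xs ys inj (∷-injectiveʳ e))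

map-agree : (f g : A → B) (xs : List A) → map f xs ≡ map g xs → ∀ {a} → a ∈ xs → f a ≡ g a
map-agree f g (x ∷ xs) e (here refl) = ∷-injectiveˡ e
map-agree f g (x ∷ xs) e (there p) = map-agree f g xs (∷-injectiveʳ e) p

module _ (_≟A_ : DecidableEquality A) (d : B) where

  -- The value d is returned only for elements that do not occur in the list of keys.
  assoc : List A → List B → A → B
  assoc (x ∷ xs) (y ∷ ys) a with a ≟A x
  ... | yes _ = y
  ... | no _ = assoc xs ys a
  assoc _ _ a = d

  map-assoc : ∀ xs ys → Unique xs → length ys ≡ length xs → map (assoc xs ys) xs ≡ ys
  map-assoc [] [] u e = refl
  map-assoc (x ∷ xs) (y ∷ ys) (x∉ ∷ u) e = cong₂ _∷_ head
    (trans (map-cong-local (All.map skip x∉)) (map-assoc xs ys u (ℕP.suc-injective e)))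
    where
    head : assoc (x ∷ xs) (y ∷ ys) x ≡ y
    head with x ≟A x
    ... | yes _ = refl
    ... | no ne = contradiction refl ne
    skip : ∀ {a} → x ≢ a → assoc (x ∷ xs) (y ∷ ys) a ≡ assoc xs ys a
    skip {a} ne with a ≟A x
    ... | yes refl = contradiction refl ne
    ... | no _ = refl

module _ (_≟A_ : DecidableEquality A) (_≟B_ : DecidableEquality B) (f : A → B) (inj : ∀ {a b} → f a ≡ f b → a ≡ b)
         (π : A → A) (ρ : B → B) (f-π : ∀ a → f (π a) ≡ ρ (f a)) where
  private
    module WA = Walk _≟A_ π
    module WB = Walk _≟B_ ρ
    open DecMem _≟A_ using () renaming (_∈?_ to _∈A?_)
    open DecMem _≟B_ using () renaming (_∈?_ to _∈B?_)

  ∈-map-injective⁻ : ∀ {a v} → f a ∈ map f v → a ∈ v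
  ∈-map-injective⁻ {v = v} p with ∈-map⁻ f p
  ... | b , b∈ , e = subst (_∈ v) (sym (inj e)) b∈

  sect-map : ∀ v us → WB.sect (map f v) (map f us) ≡ map f (WA.sect v us)
  sect-map v us = filter-map f (_∈B? map f v) (_∈A? v) (λ _ → ∈-map-injective⁻) (λ _ → ∈-map⁺ f) us

  trail-map : ∀ {vs r us} → WA.Trail vs r us → WB.Trail (map (map f) vs) (map f r) (map f us)
  trail-map {vs} {r} {us} t = record
    { chain = go us chain
    ; ordered = λ v∈ → case ∈-map⁻ (map f) v∈ of λ { (v , v∈′ , refl) → trans (sect-map v us) (cong (map f) (ordered v∈′)) }
    ; covers = ↭-trans (PermP.map⁺ f covers) (↭-reflexive (sym (concat-map vs))) }
    where
    open WA.Trail t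
    go : ∀ {v} ss → WA.Chain vs v ss r → WB.Chain (map (map f) vs) (map f v) (map f ss) (map f r)
    go [] refl = refl
    go (s ∷ ss) (s∈ , x , x∈ , p , ch) =
      ∈-map⁺ f s∈ , map f x , ∈-map⁺ (map f) x∈ , subst (_∈ map f x) (f-π s) (∈-map⁺ f p) , go ss ch

  trail-resp-↭ : ∀ {vs ws r us} → vs ↭ ws → WA.Trail vs r us → WA.Trail ws r us
  trail-resp-↭ p t = record
    { chain = WA.Chain-mono (∈-resp-↭ p) _ (WA.Trail.chain t)
    ; ordered = WA.Trail.ordered t ∘ ∈-resp-↭ (↭-sym p)
    ; covers = ↭-trans (WA.Trail.covers t) (concat-↭ p) }

-- The walk of a cactus as a trail through its blocks.

module Time (m : ℕ) (la mu nu : Partition (suc m)) where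
  open Tours m la mu nu public

  -- Within one time the exits occur in the order white, grey, black, so `allTS` is itself the
  -- itinerary of every tour.
  tsOf : List (Fin n) → List TS
  tsOf [] = []
  tsOf (t ∷ ts) = (white , t) ∷ (grey , t) ∷ (black , t) ∷ tsOf ts

  private
    ∈-tsOf⁺ : ∀ {q t ts} → t ∈ ts → (q , t) ∈ tsOf ts
    ∈-tsOf⁺ {white} (here refl) = here refl
    ∈-tsOf⁺ {grey} (here refl) = there (here refl)
    ∈-tsOf⁺ {black} (here refl) = there (there (here refl))
    ∈-tsOf⁺ (there p) = there (there (there (∈-tsOf⁺ p)))

    ∈-tsOf⁻ : ∀ {q t} ts → (q , t) ∈ tsOf ts → t ∈ ts
    ∈-tsOf⁻ (_ ∷ ts) (here refl) = here refl
    ∈-tsOf⁻ (_ ∷ ts) (there (here refl)) = here refl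
    ∈-tsOf⁻ (_ ∷ ts) (there (there (here refl))) = here refl
    ∈-tsOf⁻ (_ ∷ ts) (there (there (there p))) = there (∈-tsOf⁻ ts p)

    tsOf! : ∀ {ts} → Unique ts → Unique (tsOf ts)
    tsOf! [] = []
    tsOf! {t ∷ ts} (t∉ ∷ u) = ((λ ()) ∷ (λ ()) ∷ fresh) ∷ ((λ ()) ∷ fresh) ∷ fresh ∷ tsOf! u
      where
      fresh : ∀ {q} → All ((q , t) ≢_) (tsOf ts)
      fresh = All.tabulate (λ { p refl → All.lookup t∉ (∈-tsOf⁻ ts p) refl })

    length-tsOf : ∀ ts → length (tsOf ts) ≡ length ts + (length ts + length ts)
    length-tsOf [] = refl
    length-tsOf (t ∷ ts) = trans (cong (3 +_) (length-tsOf ts))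
      (solve 1 (λ k → con 3 :+ (k :+ (k :+ k)) := (con 1 :+ k) :+ ((con 1 :+ k) :+ (con 1 :+ k))) refl (length ts))
      where open +-*-Solver

  abstract
    allTS : List TS
    allTS = tsOf (allFin n)

    allTS≡ : allTS ≡ tsOf (allFin n)
    allTS≡ = refl

    ∈-allTS : ∀ s → s ∈ allTS
    ∈-allTS (q , t) = ∈-tsOf⁺ (∈-allFin t)

    allTS! : Unique allTS
    allTS! = tsOf! (UniqP.allFin⁺ n)

    |allTS| : length allTS ≡ n + (n + n)
    |allTS| = trans (length-tsOf (allFin n)) (cong (λ k → k + (k + k)) (length-tabulate {n = n} id))

  Succ : Fin n → List (Fin n) → Set
  Succ z [] = ⊤
  Succ z (t ∷ []) = cyc t ≡ z
  Succ z (t ∷ ts@(t′ ∷ _)) = cyc t ≡ t′ × Succ z ts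

  succ-all : Succ zero (allFin n)
  succ-all = go m id (γ-inject₁ m) (γ-last m)
    where
    go : ∀ k (f : Fin (suc k) → Fin n) → (∀ i → cyc (f (Fin.inject₁ i)) ≡ f (suc i)) → cyc (f (Fin.fromℕ k)) ≡ zero →
      Succ zero (List.tabulate f)
    go zero f h e = e
    go (suc k) f h e = h zero , go k (f ∘ suc) (h ∘ suc) e

  module Classes {π : TS → TS} {own : TS → TS} (tour : IsTour π own) where
    open IsTour tour
    open Walk _≟T_ π
    open DecMem _≟T_ using (_∈?_)

    -- Filtering `allTS` lists the slots of a vertex by the time of their use, which makes the order
    -- condition of the trail automatic.
    cls : TS → List TS
    cls x = filter (λ s → own s ≟T x) allTS

    names : List TS
    names = List.deduplicate _≟T_ (map own allTS)

    classes : List (List TS)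
    classes = map cls names

    cls⁻ : ∀ {x s} → s ∈ cls x → own s ≡ x
    cls⁻ {x} p = proj₂ (∈-filter⁻ (λ s → own s ≟T x) {xs = allTS} p)

    cls⁺ : ∀ {x s} → own s ≡ x → s ∈ cls x
    cls⁺ {x} {s} e = ∈-filter⁺ (λ s → own s ≟T x) (∈-allTS s) e

    cls∈ : ∀ s → cls (own s) ∈ classes
    cls∈ s = ∈-map⁺ cls (∈-deduplicate⁺ _≟T_ (∈-map⁺ own (∈-allTS s)))

    classes⁻ : ∀ {v} → v ∈ classes → ∃ λ s → v ≡ cls (own s)
    classes⁻ v∈ with ∈-map⁻ cls v∈
    ... | x , x∈ , refl with ∈-map⁻ own (∈-deduplicate⁻ _≟T_ (map own allTS) x∈)
    ... | s , _ , refl = s , refl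

    same-class⁻ : ∀ {v s s′} → v ∈ classes → s ∈ v → s′ ∈ v → own s ≡ own s′
    same-class⁻ v∈ p q with classes⁻ v∈
    ... | _ , refl = trans (cls⁻ p) (sym (cls⁻ q))

    classes-nonempty : ∀ {v} → v ∈ classes → v ≢ []
    classes-nonempty v∈ refl with classes⁻ v∈
    ... | s , e with () ← subst (s ∈_) (sym e) (cls⁺ {own s} {s} refl)

    classes! : Unique (concat classes)
    classes! = go (DedupP.deduplicate-! _≟T_ (map own allTS))
      where
      go : ∀ {xs} → Unique xs → Unique (concat (map cls xs))
      go [] = []
      go {x ∷ xs} (x∉ ∷ u) = UniqP.++⁺ (UniqP.filter⁺ (λ s → own s ≟T x) allTS!) (go u) λ { (p , q) → case ∈-concat⁻′ (map cls xs) q of λ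
        { (v , a∈ , v∈) → case ∈-map⁻ cls v∈ of λ { (y , y∈ , refl) → All.lookup x∉ y∈ (trans (sym (cls⁻ p)) (cls⁻ a∈)) } } }

    class-trail : Trail classes (cls (own (white , zero))) allTS
    class-trail = record
      { chain = subst (λ us → Chain classes (cls (own (white , zero))) us (cls (own (white , zero)))) (sym allTS≡) (go (allFin n) succ-all)
      ; ordered = λ v∈ → case classes⁻ v∈ of λ { (s , refl) → filter-≐ (_∈? cls (own s)) (λ t → own t ≟T own s) (cls⁻ , cls⁺) allTS }
      ; covers = unique-set-↭ allTS! classes! (λ {s} _ → ∈-concat⁺′ (cls⁺ refl) (cls∈ s)) (λ {s} _ → ∈-allTS s) }
      where
      -- The `foldr` is the first time in `ts`. Its default `zero` stands for the end of the walk,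
      -- which is back where it started.
      go : ∀ ts → Succ zero ts → Chain classes (cls (own (white , List.foldr (λ t _ → t) zero ts))) (tsOf ts) (cls (own (white , zero)))
      go [] _ = refl
      go (t ∷ ts) su = cls⁺ refl , cls (own (grey , t)) , cls∈ _ , cls⁺ (step-wg t) ,
        cls⁺ refl , cls (own (black , t)) , cls∈ _ , cls⁺ (step-gb t) ,
        cls⁺ refl , cls (own (white , cyc t)) , cls∈ _ , cls⁺ (step-bw t) , rest ts su
        where
        rest : ∀ ts → Succ zero (t ∷ ts) → Chain classes (cls (own (white , cyc t))) (tsOf ts) (cls (own (white , zero)))
        rest [] e = cong (λ k → cls (own (white , k))) e
        rest (t′ ∷ ts) (e , su) = subst (λ k → Chain classes (cls (own (white , k))) (tsOf (t′ ∷ ts)) _) (sym e) (go (t′ ∷ ts) su)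

-- The correspondence between cacti and tuples.

module Main (m : ℕ) (la mu nu : Partition (suc m)) where
  open Time m la mu nu
  open Tup (suc m) la mu nu

  module X (x : Args) where
    sh = proj₁ x
    d = proj₁ (proj₂ x)
    σ₁ = proj₁ (proj₂ (proj₂ x))
    σ₂ = proj₁ (proj₂ (proj₂ (proj₂ x)))
    χ = proj₂ (proj₂ (proj₂ (proj₂ x)))

    open Cp sh public using (S#; E#; Codes; cycles)

    bal = balanced sh d

    S! : ∀ q → Unique (S# q)
    S! q = UniqP.filter⁺ (λ a → proj₁ a ≟C q) (Cp.thorns! sh bal)

    zW zG zB : List Label
    zW = choice (S! white) χ
    zG = choice (S! grey) σ₁
    zB = choice (S! black) σ₂

    codes : Codes zW zG zB
    codes = record
      { zW! = choice! (S! white) χ ; zG! = choice! (S! grey) σ₁ ; zB! = choice! (S! black) σ₂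
      ; zW⊆ = choice⊆ (S! white) χ ; zG⊆ = choice⊆ (S! grey) σ₁ ; zB⊆ = choice⊆ (S! black) σ₂
      ; |zW| = |choice| (S! white) χ ; |zG| = |choice| (S! grey) σ₁ ; |zB| = |choice| (S! black) σ₂ }

    rot : Label → Label
    rot = rotate _≟L_ (cycles zW zG zB)

    V = verts (model sh)
    R = slots (model sh)

    abstract
      rot-edges : Edges rot (model sh)
      rot-edges = Cp.rotation-edges sh bal codes
      rot-cube : ∀ {a} → a ∈ labels (model sh) → rot (rot (rot a)) ≡ a
      rot-cube = Cp.rotation-cube sh bal codes
      rot-closed : ∀ {a} → a ∈ labels (model sh) → rot a ∈ labels (model sh)
      rot-closed = Cp.rotation-closed sh bal codes
      rot-turn : ∀ {a} → a ∈ labels (model sh) → next (proj₁ (rot a)) ≡ proj₁ a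
      rot-turn = Cp.rotation-turn sh bal codes
      rot-orbits : ∀ {t} → t ∈ cycles zW zG zB → Orbit rot t
      rot-orbits = Cp.rotation-orbits sh bal codes
      V! : Unique (concat V)
      V! = unique-resp-↭ (labels↭verts (model sh)) (labels-number! sh)

    L⇒V : ∀ {a} → a ∈ labels (model sh) → a ∈ concat V
    L⇒V = ∈-resp-↭ (labels↭verts (model sh))

    V⇒L : ∀ {a} → a ∈ concat V → a ∈ labels (model sh)
    V⇒L = ∈-resp-↭ (↭-sym (labels↭verts (model sh)))

  -- `at` renames the time at which a slot is used into its label in the tree of `x`. It carries the
  -- itinerary to a trail from the root, `π` to the rotation built from the choices, and blocks to
  -- vertices.
  record Rep (c : C n la mu nu) (x : Args) : Set where
    open X x
    field
      at        : TS → Label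
      injective : ∀ {s s′} → at s ≡ at s′ → s ≡ s′
      trail     : Walk.Trail _≟L_ rot V R (map at allTS)
      at-π      : ∀ s → at (π# c s) ≡ rot (at s)
      same⁺     : ∀ s s′ → own# c s ≡ own# c s′ → Same V (at s) (at s′)
      same⁻     : ∀ s s′ → Same V (at s) (at s′) → own# c s ≡ own# c s′

    at∈V : ∀ s → at s ∈ concat V
    at∈V s = ∈-resp-↭ (Walk.Trail.covers trail) (∈-map⁺ at (∈-allTS s))

    onto : ∀ {a} → a ∈ labels (model sh) → ∃ λ s → at s ≡ a
    onto a∈ with ∈-map⁻ at (∈-resp-↭ (↭-sym (Walk.Trail.covers trail)) (L⇒V a∈))
    ... | s , _ , e = s , sym e

    root∈ : at (white , zero) ∈ R
    root∈ with Walk.Trail.chain trail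
    ... | ch rewrite allTS≡ = proj₁ ch

  -- Both renamings turn `allTS` into trails of the same slot system, so they agree by
  -- `trail-unique`. The rotation and the blocks of the cactus are then read through one and the
  -- same renaming.
  rep-unique-C : ∀ {c c′ x} → Rep c x → Rep c′ x → c ≡ c′
  rep-unique-C {c} {c′} {x} ρ ρ′ = tour-determines c c′
    (λ s → P.injective (trans (P.at-π s) (trans (cong rot (eq s)) (trans (sym (P′.at-π s)) (sym (eq (π# c′ s)))))))
    (λ s s′ e → P′.same⁻ s s′ (subst₂′ (eq s) (eq s′) (P.same⁺ s s′ e)))
    (λ s s′ e → P.same⁻ s s′ (subst₂′ (sym (eq s)) (sym (eq s′)) (P′.same⁺ s s′ e)))
    where
    open X x
    module P = Rep ρ
    module P′ = Rep ρ′
    eq : ∀ s → P.at s ≡ P′.at s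
    eq s = map-agree P.at P′.at allTS (Walk.trail-unique _≟L_ rot V! (here refl) P.trail P′.trail) (∈-allTS s)
    subst₂′ : ∀ {a b a′ b′} → a ≡ a′ → b ≡ b′ → Same V a b → Same V a′ b′
    subst₂′ refl refl h = h

  module _ {c : C n la mu nu} where

    -- The tree is pulled back along `at` to one whose slots are those of the cactus. Trees of
    -- different tuples representing `c` thereby become comparable.
    module Lifted {x : Args} (ρ : Rep c x) where
      open X x public
      open Rep ρ public
      open DecMem _≟T_ using (_∈?_)

      lifted = lift-items at (model sh) onto

      I : Items TS
      I = proj₁ lifted

      I≡ : mapI at I ≡ model sh
      I≡ = proj₂ lifted

      shape≡ : shape I ≡ sh
      shape≡ = trans (sym (shape-map at I)) (trans (cong shape I≡) (shape-number white 0 sh))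

      V≡ : V ≡ map (map at) (verts I)
      V≡ = trans (cong verts (sym I≡)) (verts-map at I)

      V⁺ : ∀ {v} → v ∈ verts I → map at v ∈ V
      V⁺ {v} v∈ = subst (map at v ∈_) (sym V≡) (∈-map⁺ (map at) v∈)

      edges : Edges (π# c) I
      edges = edges-map⁻ at injective at-π I (subst (Edges rot) (sym I≡) rot-edges)

      labels! : Unique (labels I)
      labels! = UniqP.map⁻ {f = at} (subst Unique (trans (cong labels (sym I≡)) (labels-map at I)) (labels-number! sh))

      sorted : ∀ {v} → v ∈ verts I → filter (_∈? v) allTS ≡ v
      sorted {v} v∈ = map-injective-on at _ _ injective
        (trans (sym (sect-map _≟T_ _≟L_ at injective (π# c) rot at-π v allTS)) (Walk.Trail.ordered trail (V⁺ v∈)))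

      class⁺ : ∀ {v s t} → v ∈ verts I → s ∈ v → t ∈ v → own# c s ≡ own# c t
      class⁺ v∈ s∈ t∈ = same⁻ _ _ (_ , V⁺ v∈ , ∈-map⁺ at s∈ , ∈-map⁺ at t∈)

      ∈at⁻ : ∀ {s v} → at s ∈ map at v → s ∈ v
      ∈at⁻ = ∈-map-injective⁻ _≟T_ _≟L_ at injective (π# c) rot at-π

      class⁻ : ∀ {v s t} → v ∈ verts I → s ∈ v → own# c s ≡ own# c t → t ∈ v
      class⁻ {v} {s} {t} v∈ s∈ e with same⁺ s t e
      ... | w , w∈ , p , q with refl ← ∈-concat-unique V! w∈ (V⁺ v∈) p (∈-map⁺ at s∈) = ∈at⁻ q

      find : ∀ s → ∃ λ v → v ∈ verts I × s ∈ v
      find s with same⁺ s s refl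
      ... | w , w∈ , p , _ with ∈-map⁻ (map at) (subst (w ∈_) V≡ w∈)
      ... | v , v∈ , refl = v , v∈ , ∈at⁻ p

      root : (white , zero) ∈ slots I
      root = ∈at⁻ (subst (at (white , zero) ∈_) (trans (cong slots (sym I≡)) (slots-map at I)) root∈)

      inhabited : ∀ {v} → v ∈ verts I → ∃ λ s → s ∈ v
      inhabited (here refl) = -, root
      inhabited {[]} (there v∈) = contradiction refl (descendants-nonempty I v∈)
      inhabited {s ∷ v} (there v∈) = s , here refl

      ∈labels : ∀ s → s ∈ labels I
      ∈labels s with find s
      ... | v , v∈ , s∈ = ∈-resp-↭ (↭-sym (labels↭verts I)) (∈-concat⁺′ s∈ v∈)

    module _ {x x′ : Args} (ρ : Rep c x) (ρ′ : Rep c x′) where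
      private
        module P = Lifted ρ
        module P′ = Lifted ρ′
      open DecMem _≟T_ using (_∈?_)

      -- By `sorted` a vertex of the pulled-back tree is a class of `own# c` listed by time, and
      -- this description does not involve the tuple.
      class-eq : ∀ {v v′ s} → v ∈ verts P.I → v′ ∈ verts P′.I → s ∈ v → s ∈ v′ → v ≡ v′
      class-eq {v} {v′} v∈ v′∈ s∈ s∈′ = trans (sym (P.sorted v∈)) (trans
        (filter-≐ (_∈? v) (_∈? v′) ((λ t∈ → P′.class⁻ v′∈ s∈′ (P.class⁺ v∈ s∈ t∈)) , (λ t∈ → P.class⁻ v∈ s∈ (P′.class⁺ v′∈ s∈′ t∈))) allTS)
        (P′.sorted v′∈))

      verts-⊆ : verts P.I ⊆ verts P′.I
      verts-⊆ v∈ with P.inhabited v∈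
      ... | s , s∈ with P′.find s
      ... | v′ , v′∈ , s∈′ = subst (_∈ verts P′.I) (sym (class-eq v∈ v′∈ s∈ s∈′)) v′∈

    tree-eq : ∀ {x x′} (ρ : Rep c x) (ρ′ : Rep c x′) → Lifted.I ρ ≡ Lifted.I ρ′
    tree-eq ρ ρ′ = tree-unique (π# c) P.edges P′.edges (class-eq ρ ρ′ (here refl) (here refl) P.root P′.root)
      (unique-set-↭ (vs! P.I P.labels! P.inhabited) (vs! P′.I P′.labels! P′.inhabited) (verts-⊆ ρ ρ′) (verts-⊆ ρ′ ρ))
      P.labels! (λ _ _ e → trans (sym (cube _)) (trans (cong (π# c ∘ π# c) e) (cube _)))
      where
      module P = Lifted ρ
      module P′ = Lifted ρ′
      open IsTour (Of.isTour c)
      vs! : ∀ J → Unique (labels J) → (∀ {v} → v ∈ verts J → ∃ λ s → s ∈ v) → Unique (verts J)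
      vs! J u h = concat-unique⇒unique-list (unique-resp-↭ (labels↭verts J) u) λ { v∈ refl → case h v∈ of λ { (_ , ()) } }

  -- By `tree-eq` the pulled-back trees coincide, so the shapes do, then the renamings, then the two
  -- rotations on all labels. The choices follow by `codes-determined`.
  rep-unique-args : ∀ {c x x′} → Rep c x → Rep c x′ → x ≡ x′
  rep-unique-args {c} {sh , d , σ₁ , σ₂ , χ} {sh′ , d′ , σ₁′ , σ₂′ , χ′} ρ ρ′ = go sh≡ ρ ρ′
    where
    sh≡ : sh ≡ sh′
    sh≡ = trans (sym (P.shape≡)) (trans (cong shape (tree-eq ρ ρ′)) P′.shape≡)
      where
      module P = Lifted ρ
      module P′ = Lifted ρ′
    go : ∀ {sh sh′ d d′ σ₁ σ₂ χ σ₁′ σ₂′ χ′} → sh ≡ sh′ → Rep c (sh , d , σ₁ , σ₂ , χ) → Rep c (sh′ , d′ , σ₁′ , σ₂′ , χ′) →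
      _≡_ {A = Args} (sh , d , σ₁ , σ₂ , χ) (sh′ , d′ , σ₁′ , σ₂′ , χ′)
    go {sh} {d = d@(p , q , r)} {d′@(p′ , q′ , r′)} {σ₁} {σ₂} {χ} {σ₁′} {σ₂′} {χ′} refl ρ ρ′ =
      args-ext (≡-irrelevant p p′) (≡-irrelevant q q′) (≡-irrelevant r r′)
        (choice-injective (P.S! grey) σ₁ σ₁′ zG≡) (choice-injective (P.S! black) σ₂ σ₂′ zB≡) (choice-injective (P.S! white) χ χ′ zW≡)
      where
      module P = Lifted ρ
      module P′ = Lifted ρ′
      at≡ : ∀ s → P.at s ≡ P′.at s
      at≡ s = map-agree P.at P′.at (labels P.I)
        (trans (sym (labels-map P.at P.I)) (trans (cong labels (trans P.I≡ (trans (sym P′.I≡) (cong (mapI P′.at) (sym (tree-eq ρ ρ′)))))) (labels-map P′.at P.I)))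
        (P.∈labels s)
      rot≡ : ∀ {a} → a ∈ labels (model sh) → P.rot a ≡ P′.rot a
      rot≡ a∈ with P.onto a∈
      ... | s , refl = trans (sym (P.at-π s)) (trans (at≡ (π# c s)) (trans (P′.at-π s) (cong P′.rot (sym (at≡ s)))))
      -- The cycles of the first tuple are also orbits of the second rotation, so both sets of codes
      -- can be read off from `P′.rot`.
      orbits : ∀ {t} → t ∈ P.cycles P.zW P.zG P.zB → Orbit P′.rot t
      orbits {t} t∈ with P.rot-orbits t∈ | ∈-flat (P.cycles P.zW P.zG P.zB) t∈
      ... | x , y , z | a , b , e = trans (sym (rot≡ (l a))) x , trans (sym (rot≡ (l b))) y , trans (sym (rot≡ (l e))) z
        where
        l : ∀ {a} → a ∈ flat (P.cycles P.zW P.zG P.zB) → a ∈ labels (model sh)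
        l = ∈-resp-↭ (Cp.flat-cycles sh P.bal P.codes)
      det = Cp.codes-determined sh P.bal P.codes {P′.rot} orbits
      det′ = Cp.codes-determined sh P′.bal P′.codes {P′.rot} P′.rot-orbits
      zW≡ : P.zW ≡ P′.zW
      zW≡ = trans (proj₁ det) (sym (proj₁ det′))
      zG≡ : P.zG ≡ P′.zG
      zG≡ = trans (proj₁ (proj₂ det)) (trans (cong (λ z → map (P′.rot ∘ proj₂) (P.E# white) ++ map P′.rot (Cp.rest sh z)) zW≡) (sym (proj₁ (proj₂ det′))))
      zB≡ : P.zB ≡ P′.zB
      zB≡ = trans (proj₂ (proj₂ det)) (trans (cong (λ z → map (P′.rot ∘ proj₂) (P.E# grey) ++ map P′.rot (map P′.rot (Cp.rest sh z))) zW≡) (sym (proj₂ (proj₂ det′))))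
      args-ext : ∀ {p p′ q q′ r r′} {σ₁ σ₁′ σ₂ σ₂′ χ χ′} → p ≡ p′ → q ≡ q′ → r ≡ r′ → σ₁ ≡ σ₁′ → σ₂ ≡ σ₂′ → χ ≡ χ′ →
        _≡_ {A = Args} (sh , (p , q , r) , σ₁ , σ₂ , χ) (sh , (p′ , q′ , r′) , σ₁′ , σ₂′ , χ′)
      args-ext refl refl refl refl refl refl = refl

  module Represent (c : C n la mu nu) (I : Items TS)
    (sl : slots I ≡ Classes.cls (Of.isTour c) (own# c (white , zero)))
    (vp : verts I ↭ Classes.classes (Of.isTour c)) (edges : Edges (π# c) I) where
    open Classes (Of.isTour c)
    open Of c using (part#; typed; slot#; slot-index; own-slot; index#)
    open IsTour (Of.isTour c)

    private
      π = π# c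
      own = own# c

      verts⇒ : ∀ {v} → v ∈ verts I → v ∈ classes
      verts⇒ = ∈-resp-↭ vp
      ⇒verts : ∀ {v} → v ∈ classes → v ∈ verts I
      ⇒verts = ∈-resp-↭ (↭-sym vp)

      verts! : Unique (concat (verts I))
      verts! = unique-resp-↭ (concat-↭ (↭-sym vp)) classes!

      u : Unique (labels I)
      u = unique-resp-↭ (↭-sym (labels↭verts I)) verts!

      ∈labels : ∀ s → s ∈ labels I
      ∈labels s = ∈-resp-↭ (↭-sym (labels↭verts I)) (∈-concat⁺′ (cls⁺ refl) (⇒verts (cls∈ s)))

      cl : Coloured proj₁ white I
      cl = coloured-items proj₁ white I edges (λ {a} _ → turn a)
        (λ v∈ a∈ b∈ → colour (same-class⁻ (verts⇒ (there v∈)) a∈ b∈)) (λ a∈ → colour (cls⁻ (subst (_ ∈_) sl a∈)))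

    -- Colour and preorder position in the explored tree. By `renumber` this turns the explored tree
    -- into the model of its shape.
    at : TS → Label
    at s = proj₁ s , index _≟T_ (labels I) s

    sh : Shape
    sh = shape I

    private
      M≡ : mapI at I ≡ model sh
      M≡ = renumber proj₁ (index _≟T_ (labels I)) white 0 I cl (map-index _≟T_ (labels I) u)

      inj : ∀ {s s′} → at s ≡ at s′ → s ≡ s′
      inj {s} {s′} e = index-injective _≟T_ (labels I) (∈labels s) (∈labels s′) (cong proj₂ e)

      same-verts : ∀ {s s′} → own s ≡ own s′ → Same (verts I) s s′
      same-verts {s} e = cls (own s) , ⇒verts (cls∈ s) , cls⁺ refl , cls⁺ (sym e)

      slot-inj : ∀ q {i j} → slot# q i ≡ slot# q j → i ≡ j
      slot-inj white e = cong proj₂ e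
      slot-inj grey e = cong proj₂ e
      slot-inj black {i} {j} e = trans (sym (Of.σσ⁻ c i)) (trans (cong (Of.σ c ∘ proj₂) e) (Of.σσ⁻ c j))

      slot-col : ∀ q i → proj₁ (slot# q i) ≡ q
      slot-col white i = refl
      slot-col black i = refl
      slot-col grey i = refl

      sizes : ∀ q → blockSizes (part# q) ↭ map length (vertsOf q I)
      sizes q = blockSizes↭ (part# q) (slot# q) (slot-inj q) (vertsOf! proj₁ I cl q verts!)
        (λ v∈ → classes-nonempty (verts⇒ (proj₁ (vertsOf⁻ proj₁ I cl {q} v∈))))
        (λ {_} {s} v∈ s∈ → index# s , trans (cong (λ q → slot# q (index# s)) (sym (proj₂ (vertsOf⁻ proj₁ I cl {q} v∈) s∈))) (slot-index s))
        (λ i j e → case same-verts (trans (own-slot q i) (trans (cong (q ,_) e) (sym (own-slot q j)))) of λ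
          { (v , v∈ , p , p′) → v , vertsOf⁺ proj₁ I cl {q} v∈ p (slot-col q i) , p , p′ })
        (λ { i j (v , v∈ , p , p′) → cong proj₂ (trans (sym (own-slot q i))
          (trans (same-class⁻ (verts⇒ (proj₁ (vertsOf⁻ proj₁ I cl {q} v∈))) p p′) (own-slot q j))) })

      dq : ∀ q → degrees q (toTree sh) ≈ₘ parts (type# q)
      dq q = ↭⇒≈ₘ (↭-trans (degrees↭ q I) (↭-trans (↭-sym (sizes q)) (≈ₘ⇒↭ (typed q))))

    d : Deg sh
    d = dq white , dq black , dq grey

    private
      -- The rotation of the cactus transported to labels. All labels of the model come from slots,
      -- so on them the default value does not occur.
      ρ : Label → Label
      ρ = assoc _≟L_ (white , 0) (map at allTS) (map (at ∘ π) allTS)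

      ρ-at : ∀ s → ρ (at s) ≡ at (π s)
      ρ-at s = map-agree (ρ ∘ at) (at ∘ π) allTS (trans (map-∘ allTS) (map-assoc _≟L_ (white , 0) (map at allTS) (map (at ∘ π) allTS)
        (UniqP.map⁺ inj allTS!) (trans (length-map _ allTS) (sym (length-map at allTS))))) (∈-allTS s)

      at∈ : ∀ s → at s ∈ labels (model sh)
      at∈ s = subst (at s ∈_) (trans (sym (labels-map at I)) (cong labels M≡)) (∈-map⁺ at (∈labels s))

      onto : ∀ {a} → a ∈ labels (model sh) → ∃ λ s → a ≡ at s
      onto a∈ with ∈-map⁻ at (subst (_ ∈_) (trans (cong labels (sym M≡)) (labels-map at I)) a∈)
      ... | s , _ , e = s , e

      ρ-closed : ∀ {a} → a ∈ labels (model sh) → ρ a ∈ labels (model sh)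
      ρ-closed a∈ with onto a∈
      ... | s , refl = subst (_∈ labels (model sh)) (sym (ρ-at s)) (at∈ (π s))

      ρ-cube : ∀ {a} → a ∈ labels (model sh) → ρ (ρ (ρ a)) ≡ a
      ρ-cube a∈ with onto a∈
      ... | s , refl = trans (cong (ρ ∘ ρ) (ρ-at s)) (trans (cong ρ (ρ-at (π s))) (trans (ρ-at (π (π s))) (cong at (cube s))))

      ρ-turn : ∀ {a} → a ∈ labels (model sh) → next (proj₁ (ρ a)) ≡ proj₁ a
      ρ-turn a∈ with onto a∈
      ... | s , refl = trans (cong (next ∘ proj₁) (ρ-at s)) (turn s)

      ρ-edges : Edges ρ (model sh)
      ρ-edges = subst (Edges ρ) M≡ (edges-map at I (λ {s} _ → sym (ρ-at s)) edges)

      bal : ∀ q → length (ofCol proj₁ q (labels (model sh))) ≡ n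
      bal = balanced sh d

      S! : ∀ q → Unique (Cp.S# sh q)
      S! q = UniqP.filter⁺ (λ a → proj₁ a ≟C q) (Cp.thorns! sh bal)

      zW zG zB : List Label
      zW = Cp.zW₀ sh bal ρ ρ-closed ρ-cube ρ-turn ρ-edges
      zG = Cp.zG₀ sh bal ρ ρ-closed ρ-cube ρ-turn ρ-edges
      zB = Cp.zB₀ sh bal ρ ρ-closed ρ-cube ρ-turn ρ-edges

      codes : Cp.Codes sh zW zG zB
      codes = Cp.codes₀ sh bal ρ ρ-closed ρ-cube ρ-turn ρ-edges

    module Finish (σ₁ : S (length (Cp.S# sh grey))) (σ₂ : S (length (Cp.S# sh black)))
      (χ : OP (length (Cp.S# sh white)) (length (Cp.E# sh black)))
      (eW : choice (S! white) χ ≡ zW) (eG : choice (S! grey) σ₁ ≡ zG) (eB : choice (S! black) σ₂ ≡ zB) where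

      args : Args
      args = sh , d , σ₁ , σ₂ , χ

      private
        module Y = X args

        ρ-orbits : ∀ {t} → t ∈ Y.cycles Y.zW Y.zG Y.zB → Orbit ρ t
        ρ-orbits {t} t∈ = Cp.orbits₀ sh bal ρ ρ-closed ρ-cube ρ-turn ρ-edges
          (subst (t ∈_) (trans (cong (λ z → Y.cycles z Y.zG Y.zB) eW) (cong₂ (Y.cycles zW) eG eB)) t∈)

        -- `ρ` and the rotation built from the choices have the same orbits `cycles`, and these
        -- cover all labels.
        at-π : ∀ s → at (π s) ≡ Y.rot (at s)
        at-π s = trans (sym (ρ-at s)) (orbits-agree _≟L_ (Y.cycles Y.zW Y.zG Y.zB) ρ-orbits Y.rot-orbits
          (∈-resp-↭ (↭-sym (Cp.flat-cycles sh Y.bal Y.codes)) (at∈ s)))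

        V≡ : map (map at) (verts I) ≡ Y.V
        V≡ = trans (sym (verts-map at I)) (cong verts M≡)

      rep : Rep c args
      rep = record
        { at = at ; injective = inj
        ; trail = subst₂ (λ V R → Walk.Trail _≟L_ Y.rot V R (map at allTS)) V≡ (trans (sym (slots-map at I)) (cong slots M≡))
            (trail-map _≟T_ _≟L_ at inj π Y.rot at-π (subst (λ r → Walk.Trail _≟T_ π (verts I) r allTS) (sym sl)
              (trail-resp-↭ _≟T_ _≟L_ at inj π Y.rot at-π (↭-sym vp) class-trail)))
        ; at-π = at-π
        ; same⁺ = λ s s′ e → case same-verts e of λ { (v , v∈ , p , p′) →
            map at v , subst (map at v ∈_) V≡ (∈-map⁺ (map at) v∈) , ∈-map⁺ at p , ∈-map⁺ at p′ }
        ; same⁻ = λ { s s′ (w , w∈ , p , p′) → case ∈-map⁻ (map at) (subst (w ∈_) (sym V≡) w∈) of λ { (v , v∈ , refl) →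
            same-class⁻ (verts⇒ v∈) (back p) (back p′) } } }
        where
        back : ∀ {s v} → at s ∈ map at v → s ∈ v
        back = ∈-map-injective⁻ _≟T_ _≟L_ at inj π Y.rot at-π

    represented : ∃ (Rep c)
    represented = finish (choice-surjective (S! white) zW zW! zW⊆ |zW|) (choice-surjective (S! grey) zG zG! zG⊆ |zG|)
                         (choice-surjective (S! black) zB zB! zB⊆ |zB|)
      where
      open Cp.Codes sh codes
      finish : (∃ λ χ → choice (S! white) χ ≡ zW) → (∃ λ σ₁ → choice (S! grey) σ₁ ≡ zG) → (∃ λ σ₂ → choice (S! black) σ₂ ≡ zB) → ∃ (Rep c)
      finish (χ , eW) (σ₁ , eG) (σ₂ , eB) = -, Finish.rep σ₁ σ₂ χ eW eG eB

  abstract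
    rep-exists-args : ∀ c → ∃ (Rep c)
    rep-exists-args c = finish (explore _≟T_ (π# c) classes! (cls∈ (white , zero)) class-trail (λ {a} _ → IsTour.cube (Of.isTour c) a) classes-nonempty)
      where
      open Classes (Of.isTour c)
      finish : (∃ λ I → slots I ≡ cls (own# c (white , zero)) × verts I ↭ classes × Edges (π# c) I) → ∃ (Rep c)
      finish (I , sl , vp , edges) = Represent.represented c I sl vp edges

-- From a tuple to its cactus, and the bijection.

module Construct (m : ℕ) (la mu nu : Partition (suc m)) where
  open Time m la mu nu
  open Tup (suc m) la mu nu
  open Main m la mu nu

  module Build (x : Args) (us : List Label) (t₀ : Walk.Trail _≟L_ (X.rot x) (X.V x) (X.R x) us) where
    open X x
    private
      module W = Walk _≟L_ rot

      cl : Coloured proj₁ white (model sh)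
      cl = coloured-number white 0 sh

      |us| : length us ≡ length allTS
      |us| = begin
        length us                   ≡⟨ ↭-length (↭-trans (W.Trail.covers t₀) (↭-sym (labels↭verts (model sh)))) ⟩
        length (labels (model sh))  ≡⟨ ↭-length (filter-colours proj₁ (labels (model sh))) ⟩
        length (L white ++ L black ++ L grey)
          ≡⟨ trans (length-++ (L white)) (cong (length (L white) +_) (length-++ (L black))) ⟩
        length (L white) + (length (L black) + length (L grey)) ≡⟨ cong₂ _+_ (bal white) (cong₂ _+_ (bal black) (bal grey)) ⟩
        n + (n + n)                 ≡⟨ |allTS| ⟨
        length allTS                ∎
        where
        open ≡-Reasoning
        L : Colour → List Label
        L q = ofCol proj₁ q (labels (model sh))

    abstract
      -- The itinerary and the trail have the same length, three times n, and are matched entry by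
      -- entry.
      at : TS → Label
      at = assoc _≟T_ (white , 0) allTS us

      at-us : map at allTS ≡ us
      at-us = map-assoc _≟T_ (white , 0) allTS us allTS! |us|

    trail : W.Trail V R (map at allTS)
    trail = subst (W.Trail V R) (sym at-us) t₀

    injective : ∀ {s s′} → at s ≡ at s′ → s ≡ s′
    injective {s} {s′} = unique-map-injective at (unique-resp-↭ (↭-sym (W.Trail.covers trail)) V!) (∈-allTS s) (∈-allTS s′)

    private
      at∈V : ∀ s → at s ∈ concat V
      at∈V s = ∈-resp-↭ (W.Trail.covers trail) (∈-map⁺ at (∈-allTS s))

      onto : ∀ {a} → a ∈ concat V → ∃ λ s → at s ≡ a
      onto a∈ with ∈-map⁻ at (∈-resp-↭ (↭-sym (W.Trail.covers trail)) a∈)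
      ... | s , _ , e = s , sym e

      Steps : Fin n → Set
      Steps t = (∀ q → proj₁ (at (q , t)) ≡ q) × Same V (rot (at (white , t))) (at (grey , t)) ×
        Same V (rot (at (grey , t))) (at (black , t)) × Same V (rot (at (black , t))) (at (white , cyc t))

      turn-to : ∀ {q v s} → proj₁ (at s) ≡ next q → v ∈ V → rot (at s) ∈ v → ∀ {a} → a ∈ v → proj₁ a ≡ q
      turn-to {s = s} e v∈ p a∈ = next-injective (trans (cong next (monochrome proj₁ (model sh) cl v∈ a∈ p)) (trans (rot-turn (V⇒L (at∈V s))) e))

      -- The trail is read three exits at a time. It starts in the white root, the rotation lowers
      -- the colour at each step and vertices are monochrome, so the exits cycle through white, grey
      -- and black as the itinerary does.
      unchain : at (white , zero) ∈ R → ∀ ts {v} → Succ zero ts → (∀ {a} → a ∈ v → proj₁ a ≡ white) →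
        W.Chain V v (map at (tsOf ts)) R → All Steps ts
      unchain root [] su wh ch = []
      unchain root (t ∷ ts) su wh (w∈ , x , x∈ , px , g∈ , y , y∈ , py , b∈ , z , z∈ , pz , ch) =
        ((λ { white → cw ; grey → cg ; black → cb }) , (x , x∈ , px , g∈) , (y , y∈ , py , b∈) , (z , z∈ , pz , next∈ ts su ch)) ∷
        rest ts su ch
        where
        cw : proj₁ (at (white , t)) ≡ white
        cw = wh w∈
        cg : proj₁ (at (grey , t)) ≡ grey
        cg = turn-to cw x∈ px g∈
        cb : proj₁ (at (black , t)) ≡ black
        cb = turn-to cg y∈ py b∈
        next∈ : ∀ ts → Succ zero (t ∷ ts) → W.Chain V z (map at (tsOf ts)) R → at (white , cyc t) ∈ z
        -- After the last time the walk has returned to the root and `cyc t` is `zero`, whose white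
        -- slot belongs to the root.
        next∈ [] e refl = subst (λ k → at (white , k) ∈ R) (sym e) root
        next∈ (t′ ∷ ts) (e , _) (p , _) = subst (λ k → at (white , k) ∈ z) (sym e) p
        rest : ∀ ts → Succ zero (t ∷ ts) → W.Chain V z (map at (tsOf ts)) R → All Steps ts
        rest [] e ch = []
        rest (t′ ∷ ts) (_ , su) ch = unchain root (t′ ∷ ts) su (turn-to cb z∈ pz) ch

      chain-allFin : W.Chain V R (map at (tsOf (allFin n))) R
      chain-allFin = subst (λ ss → W.Chain V R (map at ss) R) allTS≡ (W.Trail.chain trail)

      steps : ∀ t → Steps t
      steps t = All.lookup (unchain (proj₁ chain-allFin) (allFin n) succ-all (root-white proj₁ (model sh) cl) chain-allFin) (∈-allFin t)

      at-colour : ∀ s → proj₁ (at s) ≡ proj₁ s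
      at-colour (q , t) = proj₁ (steps t) q

      abstract
        preimage : ∀ s → ∃ λ s′ → at s′ ≡ rot (at s)
        preimage s = onto (L⇒V (rot-closed (V⇒L (at∈V s))))

        home : ∀ s → ∃ λ v → at s ∈ v × v ∈ V
        home s = ∈-concat⁻′ V (at∈V s)

    π : TS → TS
    π s = proj₁ (preimage s)

    at-π : ∀ s → at (π s) ≡ rot (at s)
    at-π s = proj₂ (preimage s)

    -- The vertex itself serves as the name of the block; disjointness of vertices makes the choice
    -- in `home` irrelevant.
    own : TS → List Label
    own s = proj₁ (home s)

    own⁺ : ∀ {s s′} → Same V (at s) (at s′) → own s ≡ own s′
    own⁺ {s} {s′} (v , v∈ , p , p′) = trans
      (∈-concat-unique V! (proj₂ (proj₂ (home s))) v∈ (proj₁ (proj₂ (home s))) p)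
      (∈-concat-unique V! v∈ (proj₂ (proj₂ (home s′))) p′ (proj₁ (proj₂ (home s′))))

    own⁻ : ∀ {s s′} → own s ≡ own s′ → Same V (at s) (at s′)
    own⁻ {s} {s′} e = own s , proj₂ (proj₂ (home s)) , proj₁ (proj₂ (home s)) , subst (at s′ ∈_) (sym e) (proj₁ (proj₂ (home s′)))

    abstract
      isTour : IsTour π own
      isTour = record
        { cube = λ s → injective (trans (at-π _) (trans (cong rot (trans (at-π _) (cong rot (at-π s)))) (rot-cube (V⇒L (at∈V s)))))
        ; turn = λ s → trans (cong next (trans (sym (at-colour (π s))) (cong proj₁ (at-π s)))) (trans (rot-turn (V⇒L (at∈V s))) (at-colour s))
        ; step-wg = λ t → own⁺ (subst (λ a → Same V a (at (grey , t))) (sym (at-π (white , t))) (proj₁ (proj₂ (steps t))))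
        ; step-gb = λ t → own⁺ (subst (λ a → Same V a (at (black , t))) (sym (at-π (grey , t))) (proj₁ (proj₂ (proj₂ (steps t)))))
        ; step-bw = λ t → own⁺ (subst (λ a → Same V a (at (white , cyc t))) (sym (at-π (black , t))) (proj₂ (proj₂ (proj₂ (steps t)))))
        ; colour = λ {s} {s′} e → case own⁻ {s} {s′} e of λ { (v , v∈ , p , p′) →
            trans (sym (at-colour s)) (trans (monochrome proj₁ (model sh) cl v∈ p p′) (at-colour s′)) } }

    open Realise (LP.≡-dec _≟L_) π own isTour

    private
      vertex-inhabited : ∀ {v} → v ∈ V → v ≢ []
      vertex-inhabited (here refl) e with () ← subst (at (white , zero) ∈_) e (proj₁ chain-allFin)
      vertex-inhabited (there v∈) = descendants-nonempty (model sh) v∈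

      slot-colour : ∀ q i → proj₁ (slotR q i) ≡ q
      slot-colour white i = refl
      slot-colour black i = refl
      slot-colour grey i = refl

      into : ∀ q {v a} → v ∈ vertsOf q (model sh) → a ∈ v → ∃ λ i → at (slotR q i) ≡ a
      into q {v} {a} v∈ a∈ with vertsOf⁻ proj₁ (model sh) cl {q} v∈
      ... | v∈V , col with onto (∈-concat⁺′ a∈ v∈V)
      ... | s , refl with slotR-surjective q (proj₂ s)
      ... | i , e = i , cong at (trans e (cong (_, proj₂ s) (sym (trans (sym (at-colour s)) (col a∈)))))

      sizes : ∀ q → blockSizes (part q) ↭ map length (vertsOf q (model sh))
      sizes q = blockSizes↭ (part q) (at ∘ slotR q) (slotR-injective q ∘ injective) (vertsOf! proj₁ (model sh) cl q V!)
        (λ v∈ → vertex-inhabited (proj₁ (vertsOf⁻ proj₁ (model sh) cl {q} v∈))) (into q)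
        (λ i j e → case own⁻ {slotR q i} {slotR q j} (kernel⁻ (LP.≡-dec _≟L_) (own ∘ slotR q) e) of λ
          { (v , v∈ , p , p′) → v , vertsOf⁺ proj₁ (model sh) cl {q} v∈ p (trans (at-colour (slotR q i)) (slot-colour q i)) , p , p′ })
        (λ { i j (v , v∈ , p , p′) → kernel⁺ (LP.≡-dec _≟L_) (own ∘ slotR q) (own⁺ {slotR q i} {slotR q j} (v , proj₁ (vertsOf⁻ proj₁ (model sh) cl {q} v∈) , p , p′)) })

      degrees-type : ∀ q → degrees q (toTree sh) ≈ₘ parts (type# q)
      degrees-type white = deg sh d white
      degrees-type black = deg sh d black
      degrees-type grey = deg sh d grey

      types : ∀ q → HasType (part q) (type# q)
      types q = ↭⇒≈ₘ (↭-trans (sizes q) (↭-trans (↭-sym (degrees↭ q (model sh)))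
        (↭-trans (↭-reflexive (cong (λ s → degrees q (toTree s)) (shape-number white 0 sh))) (≈ₘ⇒↭ (degrees-type q)))))

    built : ∃ λ c → Rep c x
    built = finish (realisation types)
      where
      finish : (∃ λ c → (∀ s → π# c s ≡ π s) × (∀ s s′ → own s ≡ own s′ → own# c s ≡ own# c s′) × (∀ s s′ → own# c s ≡ own# c s′ → own s ≡ own s′)) →
        ∃ λ c → Rep c x
      finish (c , eπ , o⁺ , o⁻) = c , record
        { at = at ; injective = injective ; trail = trail
        ; at-π = λ s → trans (cong at (eπ s)) (at-π s)
        ; same⁺ = λ s s′ e → own⁻ {s} {s′} (o⁻ s s′ e)
        ; same⁻ = λ s s′ h → o⁺ s s′ (own⁺ {s} {s′} h) }

  abstract
    rep-exists-C : ∀ x → ∃ λ c → Rep c x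
    rep-exists-C x = finish (Walk.trail-exists _≟L_ rot V! R (here refl) (L⇒V ∘ rot-closed ∘ V⇒L)
        (λ a∈ b∈ e → trans (sym (rot-cube (V⇒L a∈))) (trans (cong (rot ∘ rot) e) (rot-cube (V⇒L b∈))))
        -- The rotation extends the edges of the model tree, so the tree supplies the induction that
        -- the greedy walk requires.
        (λ P root step a∈ → [ root , items-rooted P step (model sh) rot-edges there root ]′ (∈-++⁻ R a∈)))
      where
      open X x
      finish : ∃ (Walk.Trail _≟L_ rot V R) → ∃ λ c → Rep c x
      finish (us , t) = Build.built x us t

  private
    args : C n la mu nu → Args
    args c = proj₁ (rep-exists-args c)

    args-rep : ∀ c → Rep c (args c)
    args-rep c = proj₂ (rep-exists-args c)

    cactus : Args → C n la mu nu
    cactus x = proj₁ (rep-exists-C x)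

    cactus-rep : ∀ x → Rep (cactus x) x
    cactus-rep x = proj₂ (rep-exists-C x)

  to : C n la mu nu → Tuples n la mu nu
  to c = canon (args c)

  to-injective : ∀ {c c′} → to c ≡ to c′ → c ≡ c′
  to-injective {c} {c′} e = rep-unique-C {c} {c′} {args c} (args-rep c)
    (subst (Rep c′) (sym (canon-injective (args c) (args c′) e)) (args-rep c′))

  to-surjective : ∀ t → ∃ λ c → ∀ {c′} → c′ ≡ c → to c′ ≡ t
  to-surjective t = finish (canon-surjective t)
    where
    finish : (∃ λ x → canon x ≡ t) → ∃ λ c → ∀ {c′} → c′ ≡ c → to c′ ≡ t
    finish (x , e) = cactus x , λ { {c′} refl →
      trans (cong canon (rep-unique-args {cactus x} {args (cactus x)} {x} (args-rep (cactus x)) (cactus-rep x))) e }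

theorem2 : (n : ℕ) → 1 ≤ n → (la mu nu : Partition n) →
    C n la mu nu ⤖ Tuples n la mu nu
theorem2 (suc m) _ la mu nu = mk⤖ (to-injective , to-surjective)
  where open Construct m la mu nu
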